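{- Let $n\ge 1$. There exist polynomials $\gamma_{n,k}(q)$ with nonnegative integer coefficients, for integers $0\le k\le (n-1)/2$, such that $$\sum_{\sigma\in\mathfrak{S}_n} q^{\mathrm{inv}\,\sigma-\mathrm{exc}\,\sigma}\,t^{\mathrm{exc}\,\sigma}=\sum_{0\le k\le (n-1)/2}\gamma_{n,k}(q)\,t^k(1+t)^{n-1-2k}.$$ Moreover, for every integer $k$ with $0\le k\le (n-1)/2$, $$\gamma_{n,k}(q)=\sum_{\sigma\in\mathfrak{S}_{n,k}} q^{2\cdot(2\text{ - }13)\sigma+(31\text{ - }2)\sigma},$$ and $\gamma_{n,k}(q)$ is divisible by $q^k(1+q)^k$ in $\mathbb{Z}[q]$.
   Context: $\mathfrak{S}_n$ is the set of permutations of $[n]=\{1,\dots,n\}$, with $\sigma\in\mathfrak{S}_n$ written as $\sigma=\sigma(1)\cdots\sigma(n)$; $q$ and $t$ are indeterminates. Statistics on $\sigma\in\mathfrak{S}_n$: - $\mathrm{inv}\,\sigma$ is the number of inversions, i.e. pairs $(i,j)$ with $1\le i<j\le n$ and $\sigma(i)>\sigma(j)$. - $\mathrm{exc}\,\sigma$ is the number of excedances, i.e. $i\in[n]$ with $i<\sigma(i)$. - $(31\text{ - }2)\sigma$ is the number of pairs $(i,j)$ such that $2\le i<j\le n$ and $\sigma(i-1)>\sigma(j)>\sigma(i)$. - $(2\text{ - }13)\sigma$ is the number of pairs $(i,j)$ such that $1\le i<j\le n-1$ and $\sigma(j+1)>\sigma(i)>\sigma(j)$. Valleys and double descents: with the convention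 $\sigma(0)=\sigma(n+1)=0$, for $i\in[n]$ the value $\sigma(i)$ is called a valley of $\sigma$ if $\sigma(i-1)>\sigma(i)$ and $\sigma(i)<\sigma(i+1)$, and a double descent of $\sigma$ if $\sigma(i-1)>\sigma(i)$ and $\sigma(i)>\sigma(i+1)$. $\mathfrak{S}_{n,k}$ is the set of permutations $\sigma\in\mathfrak{S}_n$ with exactly $k$ valleys and no double descents. -}

module Defs where

open import Algebra.Bundles.Raw using (RawRing)
open import Data.Fin using (Fin; toℕ; fromℕ<)
import Data.Fin.Properties as Fin
open import Data.Integer as ℤ using (ℤ)
open import Data.List as List using (List; []; _∷_; _++_; length; filter; foldr; allFin; applyUpTo; cartesianProduct; cartesianProductWith)
open import Data.List.Properties using (length-++; filter-++; filter-some)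
open import Data.List.Relation.Unary.Any using (Any; any?)
open import Data.List.Relation.Unary.Any.Properties using (map⁺; applyUpTo⁺)
open import Data.List.Relation.Unary.All using (All; []; _∷_)
import Data.List.Relation.Unary.All.Properties as All
open import Data.Nat using (ℕ; zero; suc)
open import Data.Product using (_×_; _,_)
open import Data.Vec using (Vec; []; _∷_; lookup)
open import Data.Vec.Relation.Unary.AllPairs using (allPairs?)
open import Data.Vec.Relation.Unary.Unique.Propositional using (Unique)
open import Data.Vec.Relation.Unary.Unique.Propositional.Properties using (lookup-injective)
open import Relation.Binary.PropositionalEquality using (_≡_; refl; sym; trans; cong; subst)
open import Relation.Nullary using (yes; no; contradiction; ¬?; _×-dec_)
open import Relation.Unary using (Pred; Decidable)

import Algebra.Definitions.RawSemiring as RawSemiringDefs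

-- Univariate polynomials over a ring, as coefficient lists with the constant
-- term first.  Trailing zeros are allowed, so polynomials are compared
-- coefficient by coefficient.

module Polynomial {c ℓ} (R : RawRing c ℓ) where
  open RawRing R

  Poly : Set c
  Poly = List Carrier

  coeff : Poly → ℕ → Carrier
  coeff []      _       = 0#
  coeff (a ∷ p) zero    = a
  coeff (a ∷ p) (suc i) = coeff p i

  _≈ₚ_ : Poly → Poly → Set ℓ
  p ≈ₚ r = ∀ i → coeff p i ≈ coeff r i

  _+ₚ_ : Poly → Poly → Poly
  []      +ₚ r       = r
  (a ∷ p) +ₚ []      = a ∷ p
  (a ∷ p) +ₚ (b ∷ r) = (a + b) ∷ (p +ₚ r)

  _*ₚ_ : Poly → Poly → Poly
  []      *ₚ r = []
  (a ∷ p) *ₚ r = List.map (a *_) r +ₚ (0# ∷ (p *ₚ r))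

  const : Carrier → Poly
  const a = a ∷ []

  X : Poly
  X = 0# ∷ 1# ∷ []

  rawRing : RawRing c ℓ
  rawRing = record
    { Carrier = Poly
    ; _≈_     = _≈ₚ_
    ; _+_     = _+ₚ_
    ; _*_     = _*ₚ_
    ; -_      = List.map (-_)
    ; 0#      = []
    ; 1#      = const 1#
    }

module RingNotation {c ℓ} (R : RawRing c ℓ) where
  open RawRing R public using (Carrier; _≈_; _+_; _*_; 0#; 1#)
  open RawSemiringDefs (RawRing.rawSemiring R) public using (_^_; _∣_)

  ∑ : ∀ {a} {A : Set a} → List A → (A → Carrier) → Carrier
  ∑ xs f = foldr _+_ 0# (List.map f xs)

ℤ[q] : RawRing _ _
ℤ[q] = Polynomial.rawRing ℤ.+-*-rawRing

ℤ[q][t] : RawRing _ _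
ℤ[q][t] = Polynomial.rawRing ℤ[q]

module Q  = RingNotation ℤ[q]
module QT = RingNotation ℤ[q][t]

q : Q.Carrier
q = Polynomial.X ℤ.+-*-rawRing

t : QT.Carrier
t = Polynomial.X ℤ[q]

ι : Q.Carrier → QT.Carrier
ι = Polynomial.const ℤ[q]

NonNegativeCoefficients : Q.Carrier → Set
NonNegativeCoefficients p = ∀ i → ℤ.0ℤ ℤ.≤ Polynomial.coeff ℤ.+-*-rawRing p i

open import Data.Nat
open import Data.Nat.Properties

-- A permutation σ is its one-line word σ(1)⋯σ(n), a vector of n distinct
-- elements of Fin n; the entry a : Fin n stands for the value toℕ a + 1.

Word : ℕ → Set
Word n = Vec (Fin n) n

vectors : ∀ n m → List (Vec (Fin n) m)
vectors n zero    = [] ∷ []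
vectors n (suc m) = cartesianProductWith _∷_ (allFin n) (vectors n m)

unique? : ∀ {n m} → Decidable (Unique {A = Fin n} {n = m})
unique? = allPairs? (λ a b → ¬? (a Fin.≟ b))

𝔖 : ∀ n → List (Word n)
𝔖 n = filter unique? (vectors n n)

-- σ ⟨ i ⟩ is σ(i) for 1 ≤ i ≤ n, and 0 for all other i; in particular
-- σ(0) = σ(n+1) = 0.

infix 8 _⟨_⟩
_⟨_⟩ : ∀ {n} → Word n → ℕ → ℕ
σ ⟨ zero ⟩ = 0
_⟨_⟩ {n} σ (suc i) with i <? n
... | yes i<n = suc (toℕ (lookup σ (fromℕ< i<n)))
... | no  _   = 0

[1⋯_] : ℕ → List ℕ
[1⋯ n ] = applyUpTo suc n

count : ∀ {a p} {A : Set a} {P : Pred A p} → Decidable P → List A → ℕ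
count P? xs = length (filter P? xs)

module _ {n : ℕ} (σ : Word n) where

  positions : List ℕ
  positions = [1⋯ n ]

  pairs : List (ℕ × ℕ)
  pairs = cartesianProduct positions positions

  inv : ℕ
  inv = count (λ (i , j) → i <? j ×-dec σ ⟨ i ⟩ >? σ ⟨ j ⟩) pairs

  exc : ℕ
  exc = count (λ i → i <? σ ⟨ i ⟩) positions

  [31-2] : ℕ
  [31-2] = count (λ (i , j) → 2 ≤? i ×-dec i <? j ×-dec
                              σ ⟨ i ∸ 1 ⟩ >? σ ⟨ j ⟩ ×-dec σ ⟨ j ⟩ >? σ ⟨ i ⟩) pairs

  [2-13] : ℕ
  [2-13] = count (λ (i , j) → i <? j ×-dec j ≤? n ∸ 1 ×-dec
                              σ ⟨ j + 1 ⟩ >? σ ⟨ i ⟩ ×-dec σ ⟨ i ⟩ >? σ ⟨ j ⟩) pairs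

  valleys : ℕ
  valleys = count (λ i → σ ⟨ i ∸ 1 ⟩ >? σ ⟨ i ⟩ ×-dec σ ⟨ i ⟩ <? σ ⟨ i + 1 ⟩) positions

  doubleDescents : ℕ
  doubleDescents = count (λ i → σ ⟨ i ∸ 1 ⟩ >? σ ⟨ i ⟩ ×-dec σ ⟨ i ⟩ >? σ ⟨ i + 1 ⟩) positions

𝔖[_,_] : ∀ n → ℕ → List (Word n)
𝔖[ n , k ] = filter (λ σ → valleys σ ≟ k ×-dec doubleDescents σ ≟ 0) (𝔖 n)

-- exc σ ≤ inv σ for every permutation σ, so inv σ ∸ exc σ is the true
-- difference: each excedance i is the left end of some inversion, since
-- otherwise the values at positions i, …, n would all be at least σ(i) > i.

private
  count-++ : ∀ {a p} {A : Set a} {P : Pred A p} (P? : Decidable P) xs ys →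
             count P? (xs ++ ys) ≡ count P? xs + count P? ys
  count-++ P? xs ys = trans (cong length (filter-++ P? xs ys)) (length-++ (filter P? xs))

  count-≤ : ∀ {a b p r} {A : Set a} {B : Set b} {P : Pred A p} {R : Pred (A × B) r}
            (P? : Decidable P) (R? : Decidable R) ys {xs} →
            All (λ x → P x → Any (λ y → R (x , y)) ys) xs →
            count P? xs ≤ count R? (cartesianProduct xs ys)
  count-≤ P? R? ys [] = z≤n
  count-≤ P? R? ys {x ∷ xs} (w ∷ ws) =
    subst (count P? (x ∷ xs) ≤_) (sym (count-++ R? (List.map (x ,_) ys) _)) (step (P? x) refl)
    where
    step : ∀ d → P? x ≡ d →
           count P? (x ∷ xs) ≤ count R? (List.map (x ,_) ys) + count R? (cartesianProduct xs ys)
    step (yes px) eq rewrite eq = +-mono-≤ (filter-some R? (map⁺ (w px))) (count-≤ P? R? ys ws)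
    step (no  _)  eq rewrite eq = ≤-trans (count-≤ P? R? ys ws) (m≤n+m _ _)

  value : ∀ {n} (σ : Word n) {i} (i<n : i < n) → σ ⟨ suc i ⟩ ≡ suc (toℕ (lookup σ (fromℕ< i<n)))
  value {n} σ {i} i<n with i <? n
  ... | yes p  = cong (λ z → suc (toℕ (lookup σ (fromℕ< z)))) (<-irrelevant p i<n)
  ... | no  ¬p = contradiction i<n ¬p

  value-injective : ∀ {n} {σ : Word n} → Unique σ → ∀ {i j} → i < n → j < n →
                    σ ⟨ suc i ⟩ ≡ σ ⟨ suc j ⟩ → i ≡ j
  value-injective {σ = σ} u i<n j<n eq =
    Fin.fromℕ<-injective _ _ i<n j<n
      (lookup-injective u _ _ (Fin.toℕ-injective (suc-injective
        (trans (sym (value σ i<n)) (trans eq (value σ j<n))))))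

  value-≤ : ∀ {n} (σ : Word n) {i} → i < n → σ ⟨ suc i ⟩ ≤ n
  value-≤ σ i<n = subst (_≤ _) (sym (value σ i<n)) (Fin.toℕ<n _)

  inversion-at : ∀ {n} (σ : Word n) → Unique σ → ∀ {i} → i < n → suc i < σ ⟨ suc i ⟩ →
                 Any (λ j → suc i < j × σ ⟨ suc i ⟩ > σ ⟨ j ⟩) [1⋯ n ]
  inversion-at {n} σ u {i} i<n i<σi
    with any? (λ j → suc i <? j ×-dec σ ⟨ suc i ⟩ >? σ ⟨ j ⟩) [1⋯ n ]
  ... | yes w = w
  ... | no ¬w = contradiction k≡l (<⇒≢ k<l)
    where
    v = σ ⟨ suc i ⟩

    bound : ∀ (k : Fin (n ∸ i)) → i + toℕ k < n
    bound k = subst (i + toℕ k <_) (m+[n∸m]≡n (<⇒≤ i<n)) (+-monoʳ-< i (Fin.toℕ<n k))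

    above : ∀ (k : Fin (n ∸ i)) → v ≤ σ ⟨ suc (i + toℕ k) ⟩
    above k with toℕ k in eq
    ... | zero  = ≤-reflexive (cong (λ z → σ ⟨ suc z ⟩) (sym (+-identityʳ i)))
    ... | suc d = ≮⇒≥ λ lt → ¬w (applyUpTo⁺ suc
                    (s≤s (subst (i <_) (sym (+-suc i d)) (s≤s (m≤m+n i d))) , lt)
                    (subst (λ z → i + z < n) eq (bound k)))

    f : Fin (n ∸ i) → Fin (suc (n ∸ v))
    f k = fromℕ< {σ ⟨ suc (i + toℕ k) ⟩ ∸ v} (s≤s (∸-monoˡ-≤ v (value-≤ σ (bound k))))

    fewer : suc (n ∸ v) < n ∸ i
    fewer = subst (2 + (n ∸ v) ≤_) (sym (+-∸-assoc 2 (≤-trans i<σi (value-≤ σ i<n))))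
                  (+-monoʳ-≤ 2 (∸-monoʳ-≤ n i<σi))

    collision = Fin.pigeonhole fewer f
    k = let (k , _) = collision in k
    l = let (_ , l , _) = collision in l

    k<l : toℕ k < toℕ l
    k<l = let (_ , _ , lt , _) = collision in lt

    fk≡fl : f k ≡ f l
    fk≡fl = let (_ , _ , _ , eq) = collision in eq

    k≡l : toℕ k ≡ toℕ l
    k≡l = +-cancelˡ-≡ i _ _ (value-injective u (bound k) (bound l)
            (∸-cancelʳ-≡ (above k) (above l)
              (trans (sym (Fin.toℕ-fromℕ< _)) (trans (cong toℕ fk≡fl) (Fin.toℕ-fromℕ< _)))))

exc≤inv : ∀ {n} (σ : Word n) → Unique σ → exc σ ≤ inv σ
exc≤inv {n} σ u = count-≤ _ _ [1⋯ n ] (All.applyUpTo⁺₁ suc n (inversion-at σ u))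

-- Both generating functions are sums over weighted lattice paths, with the
-- weights V (1 + h) = q ^ h + ⋯ + q ^ (2 h).
--
-- For inv − exc and exc, restrict to the permutations whose first a entries avoid
-- the b smallest values, where b is a or a + 1.  Either this still holds for the
-- next larger b (or a), or the entry responsible can be deleted; the deletion
-- lowers inv − exc by an amount that depends only on its place, and exc by 0 or 1.
-- This gives the S-fraction with coefficients V 1, t V 1, V 2, t V 2, …, which
-- contracts to Motzkin paths with level weights (1 + t) V (1 + h) and weights
-- t V h V (1 + h) for a down step to height h − 1 together with its up step.
--
-- For the permutations without double descents, delete the letters in increasing
-- order: what remains is a sequence of blocks, and deleting a valley, a double
-- ascent or a peak changes the number m of blocks by 1, 0 or −1.  A smallest letter
-- in block i + 1 of m is the 2 of i patterns 31-2 and m − 1 − i patterns 2-13, so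
-- each step has weight V m.  The resulting Motzkin paths differ from the former
-- only in that a level step loses its factor 1 + t and a down step its factor t,
-- which is the γ-expansion.  Divisibility holds because q (1 + q) divides V h
-- whenever h is even, hence every product V h V (1 + h).

module Submission where

open import Defs

-- The two sides are never matched permutation by permutation; both are reduced to one array `D` of
-- partial Motzkin paths, which start at an arbitrary height h. Partial paths have h down steps
-- without a partner, and these account for the correction factors `V! h` on the block side and
-- `t ^ h` on the excedance side. For excedances, h measures the avoided corner and n - 1 - h is the
-- number of remaining steps, so the boundary values come from corners that leave the word no room.
-- Single permutations are not closed under deletion of the smallest letter, since removing a valley
-- leaves two pieces. The sums therefore run over permutations together with all ways of cutting
-- them, and the uncut ones are selected only at the end. Ring elements are only added and
-- multiplied, so everything is done over an arbitrary commutative semiring and used both at ℤ[q]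
-- and at ℤ[q][t]. Truncated subtraction is confined to exponents, where `exc≤inv` or the vanishing
-- of `D` justifies it.

module PolynomialRings where

  open import Algebra.Bundles using (CommutativeSemiring)
  open import Algebra.Bundles.Raw using (RawRing)
  open import Algebra.Structures using (IsCommutativeSemiring)
  open import Algebra.Structures.Biased using (isCommutativeSemiringˡ; isCommutativeMonoidˡ)
  open import Data.List using (List; []; _∷_)
  import Data.List as List
  open import Data.Nat using (zero; suc)
  open import Relation.Binary.Bundles using (Setoid)

  -- Polynomials over a commutative semiring form a commutative semiring

  module PolynomialSemiring {c ℓ} (R : RawRing c ℓ)
    (isCS : IsCommutativeSemiring (RawRing._≈_ R) (RawRing._+_ R) (RawRing._*_ R) (RawRing.0# R) (RawRing.1# R))
    where

    open RawRing R
    open Polynomial R hiding (rawRing)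
    open IsCommutativeSemiring isCS hiding (setoid)

    private
      baseSemiring : CommutativeSemiring c ℓ
      baseSemiring = record { isCommutativeSemiring = isCS }

      open import Algebra.Solver.Ring.NaturalCoefficients.Default baseSemiring
      import Relation.Binary.Reasoning.Setoid as Reasoning
      module ≈-Reasoning = Reasoning (CommutativeSemiring.setoid baseSemiring)

      infixl 6 _⊕_
      infixl 7 _⊗_
      infixr 8 _·_

      _⊕_ _⊗_ : Poly → Poly → Poly
      _⊕_ = _+ₚ_
      _⊗_ = _*ₚ_

      _·_ : Carrier → Poly → Poly
      a · p = List.map (a *_) p

      shift : Poly → Poly
      shift p = 0# ∷ p

      -- ≈ₚ as a record, from which p and r can be inferred.
      infix 4 _≋_
      record _≋_ (p r : Poly) : Set ℓ where
        constructor pointwise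
        field at : p ≈ₚ r
      open _≋_

      polySetoid : Setoid c ℓ
      polySetoid = record
        { Carrier       = Poly
        ; _≈_           = _≋_
        ; isEquivalence = record
          { refl  = pointwise λ _ → refl
          ; sym   = λ e → pointwise λ i → sym (at e i)
          ; trans = λ e f → pointwise λ i → trans (at e i) (at f i)
          }
        }

      open Setoid polySetoid using () renaming (refl to ≋-refl; sym to ≋-sym; trans to ≋-trans)
      module ≋-Reasoning = Reasoning polySetoid

      coeff-+ : ∀ p r i → coeff (p ⊕ r) i ≈ coeff p i + coeff r i
      coeff-+ []      r       i       = sym (+-identityˡ _)
      coeff-+ (a ∷ p) []      i       = sym (+-identityʳ _)
      coeff-+ (a ∷ p) (b ∷ r) zero    = refl
      coeff-+ (a ∷ p) (b ∷ r) (suc i) = coeff-+ p r i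

      coeff-· : ∀ a p i → coeff (a · p) i ≈ a * coeff p i
      coeff-· a []      i       = sym (zeroʳ a)
      coeff-· a (b ∷ p) zero    = refl
      coeff-· a (b ∷ p) (suc i) = coeff-· a p i

      coeff-∷-* : ∀ a p r i → coeff ((a ∷ p) ⊗ r) i ≈ a * coeff r i + coeff (shift (p ⊗ r)) i
      coeff-∷-* a p r i = trans (coeff-+ (a · r) _ i) (+-congʳ (coeff-· a r i))

      ⊕-cong : ∀ {p p′ r r′} → p ≋ p′ → r ≋ r′ → p ⊕ r ≋ p′ ⊕ r′
      ⊕-cong {p} {p′} {r} {r′} e f = pointwise λ i →
        trans (coeff-+ p r i) (trans (+-cong (at e i) (at f i)) (sym (coeff-+ p′ r′ i)))

      ⊕-assoc : ∀ p r u → (p ⊕ r) ⊕ u ≋ p ⊕ (r ⊕ u)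
      ⊕-assoc p r u = pointwise λ i → begin
        coeff ((p ⊕ r) ⊕ u) i              ≈⟨ coeff-+ (p ⊕ r) u i ⟩
        coeff (p ⊕ r) i + coeff u i        ≈⟨ +-congʳ (coeff-+ p r i) ⟩
        coeff p i + coeff r i + coeff u i   ≈⟨ +-assoc _ _ _ ⟩
        coeff p i + (coeff r i + coeff u i) ≈⟨ +-congˡ (coeff-+ r u i) ⟨
        coeff p i + coeff (r ⊕ u) i        ≈⟨ coeff-+ p (r ⊕ u) i ⟨
        coeff (p ⊕ (r ⊕ u)) i              ∎
        where open ≈-Reasoning

      ⊕-comm : ∀ p r → p ⊕ r ≋ r ⊕ p
      ⊕-comm p r = pointwise λ i →
        trans (coeff-+ p r i) (trans (+-comm _ _) (sym (coeff-+ r p i)))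

      shift-cong : ∀ {p r} → p ≋ r → shift p ≋ shift r
      shift-cong e = pointwise λ { zero → refl ; (suc i) → at e i }

      shift-[] : shift [] ≋ []
      shift-[] = pointwise λ { zero → refl ; (suc i) → refl }

      shift-⊕ : ∀ p r → shift (p ⊕ r) ≋ shift p ⊕ shift r
      shift-⊕ p r = pointwise λ { zero → sym (+-identityˡ _) ; (suc i) → refl }

      shift-· : ∀ a p → shift (a · p) ≋ a · shift p
      shift-· a p = pointwise λ { zero → sym (zeroʳ a) ; (suc i) → refl }

      ·-cong : ∀ a {p r} → p ≋ r → a · p ≋ a · r
      ·-cong a {p} {r} e = pointwise λ i →
        trans (coeff-· a p i) (trans (*-congˡ (at e i)) (sym (coeff-· a r i)))

      ⊗-congˡ : ∀ p {r r′} → r ≋ r′ → p ⊗ r ≋ p ⊗ r′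
      ⊗-congˡ []      e = ≋-refl
      ⊗-congˡ (a ∷ p) e = ⊕-cong (·-cong a e) (shift-cong (⊗-congˡ p e))

      ⊗-zeroʳ : ∀ p → p ⊗ [] ≋ []
      ⊗-zeroʳ []      = ≋-refl
      ⊗-zeroʳ (a ∷ p) = ≋-trans (shift-cong (⊗-zeroʳ p)) shift-[]

      -- Multiplication recurses on its first factor; this is the matching recursion in the second.
      -- Commutativity follows from it by induction, and through commutativity every law on the
      -- other side.
      ⊗-∷ : ∀ p b r → p ⊗ (b ∷ r) ≋ b · p ⊕ shift (p ⊗ r)
      ⊗-∷ []      b r = pointwise λ { zero → refl ; (suc i) → refl }
      ⊗-∷ (a ∷ p) b r = pointwise λ
        { zero    → +-congʳ (*-comm a b)
        ; (suc i) → begin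
            coeff (a · r ⊕ p ⊗ (b ∷ r)) i                             ≈⟨ coeff-+ (a · r) (p ⊗ (b ∷ r)) i ⟩
            coeff (a · r) i + coeff (p ⊗ (b ∷ r)) i                    ≈⟨ +-congˡ (at (⊗-∷ p b r) i) ⟩
            coeff (a · r) i + coeff (b · p ⊕ shift (p ⊗ r)) i         ≈⟨ +-congˡ (coeff-+ (b · p) _ i) ⟩
            coeff (a · r) i + (coeff (b · p) i + coeff (shift (p ⊗ r)) i)
              ≈⟨ solve 3 (λ x y z → x :+ (y :+ z) := y :+ (x :+ z)) refl _ _ _ ⟩
            coeff (b · p) i + (coeff (a · r) i + coeff (shift (p ⊗ r)) i) ≈⟨ +-congˡ (coeff-+ (a · r) _ i) ⟨
            coeff (b · p) i + coeff ((a ∷ p) ⊗ r) i                     ≈⟨ coeff-+ (b · p) ((a ∷ p) ⊗ r) i ⟨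
            coeff (b · p ⊕ (a ∷ p) ⊗ r) i                             ∎ }
        where open ≈-Reasoning

      ⊗-comm : ∀ p r → p ⊗ r ≋ r ⊗ p
      ⊗-comm []      r = ≋-sym (⊗-zeroʳ r)
      ⊗-comm (a ∷ p) r = ≋-trans (⊕-cong ≋-refl (shift-cong (⊗-comm p r))) (≋-sym (⊗-∷ r a p))

      ⊗-cong : ∀ {p p′ r r′} → p ≋ p′ → r ≋ r′ → p ⊗ r ≋ p′ ⊗ r′
      ⊗-cong {p} {p′} {r} {r′} e f = begin
        p ⊗ r   ≈⟨ ⊗-congˡ p f ⟩
        p ⊗ r′  ≈⟨ ⊗-comm p r′ ⟩
        r′ ⊗ p  ≈⟨ ⊗-congˡ r′ e ⟩
        r′ ⊗ p′ ≈⟨ ⊗-comm r′ p′ ⟩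
        p′ ⊗ r′ ∎
        where open ≋-Reasoning

      ⊗-distribˡ : ∀ p r u → p ⊗ (r ⊕ u) ≋ p ⊗ r ⊕ p ⊗ u
      ⊗-distribˡ []      r u = ≋-refl
      ⊗-distribˡ (a ∷ p) r u = pointwise λ i → begin
        coeff ((a ∷ p) ⊗ (r ⊕ u)) i                                         ≈⟨ coeff-∷-* a p (r ⊕ u) i ⟩
        a * coeff (r ⊕ u) i + coeff (shift (p ⊗ (r ⊕ u))) i
          ≈⟨ +-cong (*-congˡ (coeff-+ r u i))
                    (trans (at (≋-trans (shift-cong (⊗-distribˡ p r u)) (shift-⊕ (p ⊗ r) (p ⊗ u))) i)
                           (coeff-+ (shift (p ⊗ r)) (shift (p ⊗ u)) i)) ⟩
        a * (coeff r i + coeff u i) + (coeff (shift (p ⊗ r)) i + coeff (shift (p ⊗ u)) i)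
          ≈⟨ solve 5 (λ a x y z w → a :* (x :+ y) :+ (z :+ w) := (a :* x :+ z) :+ (a :* y :+ w)) refl _ _ _ _ _ ⟩
        (a * coeff r i + coeff (shift (p ⊗ r)) i) + (a * coeff u i + coeff (shift (p ⊗ u)) i)
          ≈⟨ +-cong (coeff-∷-* a p r i) (coeff-∷-* a p u i) ⟨
        coeff ((a ∷ p) ⊗ r) i + coeff ((a ∷ p) ⊗ u) i                        ≈⟨ coeff-+ ((a ∷ p) ⊗ r) _ i ⟨
        coeff ((a ∷ p) ⊗ r ⊕ (a ∷ p) ⊗ u) i                                 ∎
        where open ≈-Reasoning

      ⊗-distribʳ : ∀ u p r → (p ⊕ r) ⊗ u ≋ p ⊗ u ⊕ r ⊗ u
      ⊗-distribʳ u p r = begin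
        (p ⊕ r) ⊗ u    ≈⟨ ⊗-comm (p ⊕ r) u ⟩
        u ⊗ (p ⊕ r)    ≈⟨ ⊗-distribˡ u p r ⟩
        u ⊗ p ⊕ u ⊗ r ≈⟨ ⊕-cong (⊗-comm u p) (⊗-comm u r) ⟩
        p ⊗ u ⊕ r ⊗ u ∎
        where open ≋-Reasoning

      ·-⊗ : ∀ a r u → (a · r) ⊗ u ≋ a · (r ⊗ u)
      ·-⊗ a []      u = ≋-refl
      ·-⊗ a (b ∷ r) u = pointwise λ i → begin
        coeff ((a · (b ∷ r)) ⊗ u) i                              ≈⟨ coeff-∷-* (a * b) (a · r) u i ⟩
        a * b * coeff u i + coeff (shift ((a · r) ⊗ u)) i
          ≈⟨ +-cong (*-assoc a b _) (at (≋-trans (shift-cong (·-⊗ a r u)) (shift-· a (r ⊗ u))) i) ⟩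
        a * (b * coeff u i) + coeff (a · shift (r ⊗ u)) i        ≈⟨ +-congˡ (coeff-· a (shift (r ⊗ u)) i) ⟩
        a * (b * coeff u i) + a * coeff (shift (r ⊗ u)) i        ≈⟨ distribˡ a _ _ ⟨
        a * (b * coeff u i + coeff (shift (r ⊗ u)) i)            ≈⟨ *-congˡ (coeff-∷-* b r u i) ⟨
        a * coeff ((b ∷ r) ⊗ u) i                                ≈⟨ coeff-· a ((b ∷ r) ⊗ u) i ⟨
        coeff (a · ((b ∷ r) ⊗ u)) i                              ∎
        where open ≈-Reasoning

      shift-⊗ : ∀ p u → shift p ⊗ u ≋ shift (p ⊗ u)
      shift-⊗ p u = pointwise λ i →
        trans (coeff-∷-* 0# p u i) (trans (+-congʳ (zeroˡ _)) (+-identityˡ _))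

      ⊗-assoc : ∀ p r u → (p ⊗ r) ⊗ u ≋ p ⊗ (r ⊗ u)
      ⊗-assoc []      r u = ≋-refl
      ⊗-assoc (a ∷ p) r u = begin
        (a · r ⊕ shift (p ⊗ r)) ⊗ u          ≈⟨ ⊗-distribʳ u (a · r) (shift (p ⊗ r)) ⟩
        (a · r) ⊗ u ⊕ shift (p ⊗ r) ⊗ u      ≈⟨ ⊕-cong (·-⊗ a r u) (shift-⊗ (p ⊗ r) u) ⟩
        a · (r ⊗ u) ⊕ shift ((p ⊗ r) ⊗ u)    ≈⟨ ⊕-cong ≋-refl (shift-cong (⊗-assoc p r u)) ⟩
        a · (r ⊗ u) ⊕ shift (p ⊗ (r ⊗ u))    ∎
        where open ≋-Reasoning

      ⊗-identityˡ : ∀ p → const 1# ⊗ p ≋ p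
      ⊗-identityˡ p = pointwise λ i → begin
        coeff (const 1# ⊗ p) i                ≈⟨ coeff-∷-* 1# [] p i ⟩
        1# * coeff p i + coeff (shift []) i   ≈⟨ +-cong (*-identityˡ _) (at shift-[] i) ⟩
        coeff p i + 0#                        ≈⟨ +-identityʳ _ ⟩
        coeff p i                             ∎
        where open ≈-Reasoning

    -- Applied twice: over ℤ for ℤ[q], then over ℤ[q] for ℤ[q][t].
    isCommutativeSemiring : IsCommutativeSemiring _≈ₚ_ _+ₚ_ _*ₚ_ [] (const 1#)
    isCommutativeSemiring = isCommutativeSemiringˡ record
      { +-isCommutativeMonoid = isCommutativeMonoidˡ record
        { isSemigroup = record
          { isMagma = record
            { isEquivalence = ≈ₚ-isEquivalence
            ; ∙-cong        = λ {p} {p′} {r} {r′} e f → at (⊕-cong {p} {p′} {r} {r′} (pointwise e) (pointwise f))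
            }
          ; assoc = λ p r u → at (⊕-assoc p r u)
          }
        ; identityˡ = λ p i → refl
        ; comm      = λ p r → at (⊕-comm p r)
        }
      ; *-isCommutativeMonoid = isCommutativeMonoidˡ record
        { isSemigroup = record
          { isMagma = record
            { isEquivalence = ≈ₚ-isEquivalence
            ; ∙-cong        = λ {p} {p′} {r} {r′} e f → at (⊗-cong {p} {p′} {r} {r′} (pointwise e) (pointwise f))
            }
          ; assoc = λ p r u → at (⊗-assoc p r u)
          }
        ; identityˡ = λ p → at (⊗-identityˡ p)
        ; comm      = λ p r → at (⊗-comm p r)
        }
      ; distribʳ = λ u p r → at (⊗-distribʳ u p r)
      ; zeroˡ    = λ p i → refl
      }
      where
      open import Relation.Binary.Structures using (IsEquivalence)
      ≈ₚ-isEquivalence : IsEquivalence _≈ₚ_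
      ≈ₚ-isEquivalence = record
        { refl  = λ _ → refl
        ; sym   = λ e i → sym (e i)
        ; trans = λ e f i → trans (e i) (f i)
        }

-- Finite sums with side conditions

module FiniteSums where

  open import Algebra.Bundles using (CommutativeSemiring)
  open import Data.List using (List; []; _∷_; _++_; map; foldr; filter; cartesianProductWith; upTo; allFin)
  open import Data.List.Properties using (map-∘; map-upTo; map-applyUpTo; map-tabulate)
  open import Data.List.Membership.Propositional using (_∈_)
  open import Data.List.Relation.Unary.Any using (here; there)
  open import Data.List.Relation.Binary.Permutation.Propositional using (_↭_; refl; prep; swap; trans)
  open import Data.Nat as ℕ using (ℕ; zero; suc)
  open import Data.Nat.Properties using (_<?_)
  open import Data.Fin using (Fin; zero; suc; toℕ)
  open import Function using (_∘_)
  open import Relation.Binary.PropositionalEquality as ≡ using (_≡_; cong)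
  open import Relation.Nullary using (Dec; ¬_; yes; no; contradiction; ¬?; _×-dec_)
  open import Relation.Unary using (Pred; Decidable)

  module Summation {c ℓ} (S : CommutativeSemiring c ℓ) where
    open CommutativeSemiring S hiding (zero) renaming (refl to ≈-refl; sym to ≈-sym; trans to ≈-trans)
    open import Relation.Binary.Reasoning.Setoid setoid
    open import Algebra.Solver.Ring.NaturalCoefficients.Default S

    ∑ : ∀ {a} {A : Set a} → List A → (A → Carrier) → Carrier
    ∑ xs f = foldr _+_ 0# (map f xs)

    infix 5 _when_
    -- Side conditions are put on the summands rather than on the range, so that the range remains
    -- all of `𝔖 n`, which is what the insertion bijections reindex.
    _when_ : ∀ {p} {P : Set p} → Carrier → Dec P → Carrier
    x when yes _ = x
    x when no  _ = 0#

    when-⇔ : ∀ {p r} {P : Set p} {R : Set r} (P? : Dec P) (R? : Dec R) →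
             (P → R) → (R → P) → ∀ x → (x when P?) ≈ (x when R?)
    when-⇔ (yes p) (yes r) f g x = ≈-refl
    when-⇔ (yes p) (no ¬r) f g x = contradiction (f p) ¬r
    when-⇔ (no ¬p) (yes r) f g x = contradiction (g r) ¬p
    when-⇔ (no ¬p) (no ¬r) f g x = ≈-refl

    when-cong : ∀ {p} {P : Set p} (P? : Dec P) {x y} → (P → x ≈ y) → (x when P?) ≈ (y when P?)
    when-cong (yes p) e = e p
    when-cong (no ¬p) e = ≈-refl

    when-yes : ∀ {p} {P : Set p} (P? : Dec P) → P → ∀ x → (x when P?) ≈ x
    when-yes (yes _) p x = ≈-refl
    when-yes (no ¬p) p x = contradiction p ¬p

    when-no : ∀ {p} {P : Set p} (P? : Dec P) → ¬ P → ∀ x → (x when P?) ≈ 0#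
    when-no (yes p) ¬p x = contradiction p ¬p
    when-no (no _)  ¬p x = ≈-refl

    when-×-dec : ∀ {p r} {P : Set p} {R : Set r} (P? : Dec P) (R? : Dec R) x →
                 (x when (P? ×-dec R?)) ≈ ((x when R?) when P?)
    when-×-dec (yes p) (yes r) x = ≈-refl
    when-×-dec (yes p) (no ¬r) x = ≈-refl
    when-×-dec (no ¬p) (yes r) x = ≈-refl
    when-×-dec (no ¬p) (no ¬r) x = ≈-refl

    when-split : ∀ {p r} {P : Set p} {R : Set r} (P? : Dec P) (R? : Dec R) → (R → P) →
                 ∀ x → (x when P?) ≈ (x when R?) + (x when (P? ×-dec ¬? R?))
    when-split (yes p) (yes r) f x = ≈-sym (+-identityʳ _)
    when-split (yes p) (no ¬r) f x = ≈-sym (+-identityˡ _)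
    when-split (no ¬p) (yes r) f x = contradiction (f r) ¬p
    when-split (no ¬p) (no ¬r) f x = ≈-sym (+-identityˡ _)

    *-when : ∀ {p} {P : Set p} (P? : Dec P) y x → y * (x when P?) ≈ (y * x when P?)
    *-when (yes _) y x = ≈-refl
    *-when (no _)  y x = zeroʳ y

    module _ {a} {A : Set a} where

      ∑-cong-∈ : ∀ (xs : List A) {f g} → (∀ x → x ∈ xs → f x ≈ g x) → ∑ xs f ≈ ∑ xs g
      ∑-cong-∈ []       e = ≈-refl
      ∑-cong-∈ (x ∷ xs) e = +-cong (e x (here ≡.refl)) (∑-cong-∈ xs λ y y∈xs → e y (there y∈xs))

      ∑-cong : ∀ (xs : List A) {f g} → (∀ x → f x ≈ g x) → ∑ xs f ≈ ∑ xs g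
      ∑-cong xs e = ∑-cong-∈ xs λ x _ → e x

      ∑-++ : ∀ (xs ys : List A) f → ∑ (xs ++ ys) f ≈ ∑ xs f + ∑ ys f
      ∑-++ []       ys f = ≈-sym (+-identityˡ _)
      ∑-++ (x ∷ xs) ys f = ≈-trans (+-congˡ (∑-++ xs ys f)) (≈-sym (+-assoc _ _ _))

      ∑-distrib-+ : ∀ (xs : List A) f g → ∑ xs (λ x → f x + g x) ≈ ∑ xs f + ∑ xs g
      ∑-distrib-+ []       f g = ≈-sym (+-identityˡ _)
      ∑-distrib-+ (x ∷ xs) f g = ≈-trans (+-congˡ (∑-distrib-+ xs f g))
        (solve 4 (λ a b c d → (a :+ b) :+ (c :+ d) := (a :+ c) :+ (b :+ d)) ≈-refl _ _ _ _)

      ∑-*ˡ : ∀ y (xs : List A) f → y * ∑ xs f ≈ ∑ xs (λ x → y * f x)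
      ∑-*ˡ y []       f = zeroʳ y
      ∑-*ˡ y (x ∷ xs) f = ≈-trans (distribˡ y _ _) (+-congˡ (∑-*ˡ y xs f))

      ∑-zero : ∀ (xs : List A) {f} → (∀ x → x ∈ xs → f x ≈ 0#) → ∑ xs f ≈ 0#
      ∑-zero []       e = ≈-refl
      ∑-zero (x ∷ xs) e =
        ≈-trans (+-cong (e x (here ≡.refl)) (∑-zero xs λ y y∈xs → e y (there y∈xs))) (+-identityˡ _)

      ∑-↭ : ∀ {xs ys : List A} f → xs ↭ ys → ∑ xs f ≈ ∑ ys f
      ∑-↭ f refl          = ≈-refl
      ∑-↭ f (prep x p)    = +-congˡ (∑-↭ f p)
      ∑-↭ f (swap x y p)  = ≈-trans (+-congˡ (+-congˡ (∑-↭ f p)))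
        (solve 3 (λ a b c → a :+ (b :+ c) := b :+ (a :+ c)) ≈-refl _ _ _)
      ∑-↭ f (trans p r)   = ≈-trans (∑-↭ f p) (∑-↭ f r)

      ∑-filter : ∀ {p} {P : Pred A p} (P? : Decidable P) xs f →
                 ∑ (filter P? xs) f ≈ ∑ xs (λ x → f x when P? x)
      ∑-filter P? []       f = ≈-refl
      ∑-filter P? (x ∷ xs) f with P? x
      ... | yes _ = +-congˡ (∑-filter P? xs f)
      ... | no  _ = ≈-trans (∑-filter P? xs f) (≈-sym (+-identityˡ _))

      ∑-when : ∀ {p} {P : Set p} (P? : Dec P) (xs : List A) f → ∑ xs (λ x → f x when P?) ≈ (∑ xs f when P?)
      ∑-when (yes _) xs f = ≈-refl
      ∑-when (no _)  xs f = ∑-zero xs λ _ _ → ≈-refl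

    ∑-map : ∀ {a b} {A : Set a} {B : Set b} (h : A → B) xs f → ∑ (map h xs) f ≡ ∑ xs (f ∘ h)
    ∑-map h xs f = cong (foldr _+_ 0#) (≡.sym (map-∘ xs))

    ∑-swap : ∀ {a b} {A : Set a} {B : Set b} (xs : List A) (ys : List B) (f : A → B → Carrier) →
             ∑ xs (λ x → ∑ ys (f x)) ≈ ∑ ys (λ y → ∑ xs (λ x → f x y))
    ∑-swap []       ys f = ≈-sym (∑-zero ys λ _ _ → ≈-refl)
    ∑-swap (x ∷ xs) ys f = ≈-trans (+-congˡ (∑-swap xs ys f)) (≈-sym (∑-distrib-+ ys (f x) _))

    ∑-cartesianProductWith : ∀ {a b d} {A : Set a} {B : Set b} {D : Set d} (h : A → B → D) xs ys f →
      ∑ (cartesianProductWith h xs ys) f ≈ ∑ xs (λ x → ∑ ys (λ y → f (h x y)))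
    ∑-cartesianProductWith h []       ys f = ≈-refl
    ∑-cartesianProductWith h (x ∷ xs) ys f = ≈-trans (∑-++ (map (h x) ys) _ f)
      (+-cong (reflexive (∑-map (h x) ys f)) (∑-cartesianProductWith h xs ys f))

    ∑-upTo-suc : ∀ n f → ∑ (upTo (suc n)) f ≡ f 0 + ∑ (upTo n) (f ∘ suc)
    ∑-upTo-suc n f = cong (λ xs → f 0 + foldr _+_ 0# xs)
      (≡.trans (map-applyUpTo suc f n) (≡.sym (map-upTo (f ∘ suc) n)))

    ∑-allFin-suc : ∀ n f → ∑ (allFin (suc n)) f ≡ f zero + ∑ (allFin n) (f ∘ suc)
    ∑-allFin-suc n f = cong (λ xs → f zero + foldr _+_ 0# xs)
      (≡.trans (map-tabulate suc f) (≡.sym (map-tabulate (λ i → i) (f ∘ suc))))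

    -- Takes a sum over all insertion places, of which only those below m contribute, to the range
    -- over which `V-suc` sums.
    ∑-allFin-< : ∀ {n m} → m ℕ.≤ n → ∀ f →
      ∑ (allFin n) (λ i → f (toℕ i) when (toℕ i <? m)) ≈ ∑ (upTo m) f
    ∑-allFin-< {n}     {zero}  _         f = ∑-zero (allFin n) λ i _ → when-no (toℕ i <? 0) (λ ()) (f (toℕ i))
    ∑-allFin-< {suc n} {suc m} (ℕ.s≤s m≤n) f = begin
      ∑ (allFin (suc n)) (λ i → f (toℕ i) when (toℕ i <? suc m))
        ≡⟨ ∑-allFin-suc n _ ⟩
      f 0 + ∑ (allFin n) (λ i → f (suc (toℕ i)) when (suc (toℕ i) <? suc m))
        ≈⟨ +-congˡ (∑-cong (allFin n) λ i → when-⇔ (suc (toℕ i) <? suc m) (toℕ i <? m) ℕ.s≤s⁻¹ ℕ.s≤s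
            (f (suc (toℕ i)))) ⟩
      f 0 + ∑ (allFin n) (λ i → f (suc (toℕ i)) when (toℕ i <? m))
        ≈⟨ +-congˡ (∑-allFin-< m≤n (f ∘ suc)) ⟩
      f 0 + ∑ (upTo m) (f ∘ suc)
        ≡⟨ ∑-upTo-suc m f ⟨
      ∑ (upTo (suc m)) f ∎

-- The step weights V as geometric sums

module QWeightSums where

  open import Algebra.Bundles using (CommutativeSemiring)
  open import Data.List using (upTo)
  open import Data.Nat as ℕ using (ℕ; zero; suc)
  open import Data.Nat.Properties as ℕ using ()
  open import Relation.Binary.PropositionalEquality using (cong)
  open FiniteSums

  module QWeights {c ℓ} (S : CommutativeSemiring c ℓ) (q : CommutativeSemiring.Carrier S) where

    open CommutativeSemiring S hiding (zero) renaming (refl to ≈-refl; sym to ≈-sym; trans to ≈-trans)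
    open Summation S
    open import Algebra.Properties.Semiring.Exp semiring using (_^_; ^-homo-*)
    open import Algebra.Solver.Ring.NaturalCoefficients.Default S
    open import Relation.Binary.Reasoning.Setoid setoid

    -- V (1 + h) = q ^ h + q ^ (1 + h) + ⋯ + q ^ (2 * h).
    V : ℕ → Carrier
    V zero    = 0#
    V (suc h) = q ^ (2 ℕ.* h) + q * V h

    private
      geometric : ℕ → Carrier
      geometric n = ∑ (upTo n) (q ^_)

      geometric-front : ∀ n → geometric (suc n) ≈ 1# + q * geometric n
      geometric-front n = ≈-trans (reflexive (∑-upTo-suc n (q ^_))) (+-congˡ (≈-sym (∑-*ˡ q (upTo n) (q ^_))))

      geometric-back : ∀ n → geometric (suc n) ≈ geometric n + q ^ n
      geometric-back zero    = +-comm _ _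
      geometric-back (suc n) = begin
        geometric (suc (suc n))          ≈⟨ geometric-front (suc n) ⟩
        1# + q * geometric (suc n)       ≈⟨ +-congˡ (*-congˡ (geometric-back n)) ⟩
        1# + q * (geometric n + q ^ n)   ≈⟨ solve 3
            (λ q g x → con 1 :+ q :* (g :+ x) := (con 1 :+ q :* g) :+ q :* x) ≈-refl q (geometric n) (q ^ n) ⟩
        1# + q * geometric n + q ^ suc n ≈⟨ +-congʳ (geometric-front n) ⟨
        geometric (suc n) + q ^ suc n    ∎

      V≈geometric : ∀ h → V (suc h) ≈ q ^ h * geometric (suc h)
      V≈geometric zero    = solve 1 (λ q → con 1 :+ q :* con 0 := con 1 :* (con 1 :+ con 0)) ≈-refl q
      V≈geometric (suc h) = begin
        q ^ (2 ℕ.* suc h) + q * V (suc h)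
          ≈⟨ +-cong (reflexive (cong (q ^_) (cong suc (cong (h ℕ.+_) (ℕ.+-identityʳ (suc h))))))
              (*-congˡ (V≈geometric h)) ⟩
        q ^ (suc h ℕ.+ suc h) + q * (q ^ h * geometric (suc h))
          ≈⟨ +-congʳ (^-homo-* q (suc h) (suc h)) ⟩
        q ^ suc h * q ^ suc h + q * (q ^ h * geometric (suc h))
          ≈⟨ solve 3 (λ q x g → (q :* x) :* (q :* x) :+ q :* (x :* g) := (q :* x) :* (g :+ q :* x)) ≈-refl q
              (q ^ h) (geometric (suc h)) ⟩
        q ^ suc h * (geometric (suc h) + q ^ suc h)
          ≈⟨ *-congˡ (geometric-back (suc h)) ⟨
        q ^ suc h * geometric (suc (suc h)) ∎

    -- The exponents `h + i` are the increments of inv - exc at the possible insertion places, while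
    -- the recursion defining `V` fits the pattern counts `gains`. This identity is where the two
    -- sides acquire the same weights.
    V-suc : ∀ h → V (suc h) ≈ ∑ (upTo (suc h)) (λ i → q ^ (h ℕ.+ i))
    V-suc h = ≈-trans (V≈geometric h) (≈-trans (∑-*ˡ (q ^ h) (upTo (suc h)) (q ^_))
      (∑-cong (upTo (suc h)) λ i → ≈-sym (^-homo-* q h i)))

-- Decomposition of permutations by one entry

module Insertions where

  open import Data.Fin as Fin using (Fin; zero; suc; punchIn; punchOut)
  open import Data.Fin.Properties as Finₚ using (punchIn-injective; punchInᵢ≢i; punchIn-punchOut; injective⇒≤; punchOut-injective; any?)
  open import Data.List using (List; allFin; cartesianProductWith)
  open import Data.List.Membership.Propositional using (_∈_)
  open import Data.List.Membership.Propositional.Properties using (∈-cartesianProductWith⁺; ∈-cartesianProductWith⁻; ∈-allFin; ∈-filter⁺; ∈-filter⁻)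
  open import Data.List.Membership.Propositional.Properties.WithK using (unique∧set⇒bag)
  open import Data.List.Relation.Binary.BagAndSetEquality using (∼bag⇒↭)
  open import Data.List.Relation.Binary.Permutation.Propositional using (_↭_)
  open import Data.List.Relation.Unary.Any using (here)
  import Data.List.Relation.Unary.AllPairs as ListAllPairs
  import Data.List.Relation.Unary.All as ListAll
  import Data.List.Relation.Unary.Unique.Propositional as List using (Unique)
  import Data.List.Relation.Unary.Unique.Propositional.Properties as List
  open import Data.Nat using (ℕ; zero; suc)
  open import Data.Nat.Properties using (1+n≰n)
  open import Data.Product using (_×_; _,_; ∃; ∃₂; proj₂)
  open import Data.Vec as Vec using (Vec; []; _∷_; lookup; insertAt; tabulate)
  open import Data.Vec.Properties using (insertAt-lookup; insertAt-punchIn; lookup-map; tabulate∘lookup; lookup∘tabulate; tabulate-cong; ∷-injective)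
  open import Data.Vec.Relation.Unary.Unique.Propositional using (Unique)
  open import Data.Vec.Relation.Unary.Unique.Propositional.Properties using (lookup-injective; tabulate⁺)
  open import Function using (mk⇔)
  open import Relation.Binary.PropositionalEquality using (_≡_; _≢_; refl; sym; trans; cong; subst)
  open import Relation.Nullary using (yes; no; contradiction)

  private variable n m : ℕ

  ∈-vectors : ∀ n m (xs : Vec (Fin n) m) → xs ∈ vectors n m
  ∈-vectors n zero    []       = here refl
  ∈-vectors n (suc m) (x ∷ xs) = ∈-cartesianProductWith⁺ _∷_ (∈-allFin x) (∈-vectors n m xs)

  vectors-unique : ∀ n m → List.Unique (vectors n m)
  vectors-unique n zero    = ListAll.[] ListAllPairs.∷ ListAllPairs.[]
  vectors-unique n (suc m) =
    List.cartesianProductWith⁺ _∷_ ∷-injective (List.allFin⁺ n) (vectors-unique n m)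

  𝔖-unique : ∀ n → List.Unique (𝔖 n)
  𝔖-unique n = List.filter⁺ unique? (vectors-unique n n)

  ∈-𝔖⁺ : {σ : Word n} → Unique σ → σ ∈ 𝔖 n
  ∈-𝔖⁺ {σ = σ} u = ∈-filter⁺ unique? (∈-vectors _ _ σ) u

  ∈-𝔖⁻ : {σ : Word n} → σ ∈ 𝔖 n → Unique σ
  ∈-𝔖⁻ {n} σ∈ = proj₂ (∈-filter⁻ unique? {xs = vectors n n} σ∈)

  lookup-extensional : ∀ {A : Set} {xs ys : Vec A n} → (∀ i → lookup xs i ≡ lookup ys i) → xs ≡ ys
  lookup-extensional {xs = xs} {ys} e =
    trans (sym (tabulate∘lookup xs)) (trans (tabulate-cong e) (tabulate∘lookup ys))

  injective⇒unique : ∀ {A : Set} (xs : Vec A n) → (∀ {i j} → lookup xs i ≡ lookup xs j → i ≡ j) → Unique xs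
  injective⇒unique xs inj = subst Unique (tabulate∘lookup xs) (tabulate⁺ inj)

  -- The permutation with value v in position p whose remaining entries,
  -- standardised, form σ.
  ins : Fin (suc n) → Fin (suc n) → Word n → Word (suc n)
  ins p v σ = insertAt (Vec.map (punchIn v) σ) p v

  ins-at : ∀ p v (σ : Word n) → lookup (ins p v σ) p ≡ v
  ins-at p v σ = insertAt-lookup _ p v

  ins-punchIn : ∀ p v (σ : Word n) i → lookup (ins p v σ) (punchIn p i) ≡ punchIn v (lookup σ i)
  ins-punchIn p v σ i = trans (insertAt-punchIn _ p v i) (lookup-map i (punchIn v) σ)

  data PunchView (p : Fin (suc n)) : Fin (suc n) → Set where
    at    : PunchView p p
    other : ∀ i → PunchView p (punchIn p i)

  punchView : (p i : Fin (suc n)) → PunchView p i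
  punchView p i with p Finₚ.≟ i
  ... | yes refl = at
  ... | no  p≢i  = subst (PunchView p) (punchIn-punchOut p≢i) (other (punchOut p≢i))

  ins-unique : ∀ p v {σ : Word n} → Unique σ → Unique (ins p v σ)
  ins-unique p v {σ} u = injective⇒unique _ λ {i} {j} → inj (punchView p i) (punchView p j)
    where
    inj : ∀ {i j} → PunchView p i → PunchView p j → lookup (ins p v σ) i ≡ lookup (ins p v σ) j → i ≡ j
    inj at        at        e = refl
    inj at        (other j) e = contradiction (trans (sym (ins-punchIn p v σ j)) (trans (sym e) (ins-at p v σ)))
        (punchInᵢ≢i v _)
    inj (other i) at        e = contradiction (trans (sym (ins-punchIn p v σ i)) (trans e (ins-at p v σ)))
        (punchInᵢ≢i v _)
    inj (other i) (other j) e = cong (punchIn p) (lookup-injective u i j (punchIn-injective v _ _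
      (trans (sym (ins-punchIn p v σ i)) (trans e (ins-punchIn p v σ j)))))

  ins-injective : ∀ {p p′ v v′} {σ τ : Word n} → ins p v σ ≡ ins p′ v′ τ → p ≡ p′ → v ≡ v′ → σ ≡ τ
  ins-injective {p = p} {v = v} {σ = σ} {τ} e refl refl = lookup-extensional λ i → punchIn-injective v _ _
    (trans (sym (ins-punchIn p v σ i)) (trans (cong (λ ρ → lookup ρ (punchIn p i)) e) (ins-punchIn p v τ i)))

  ins-surjective : ∀ {σ : Word (suc n)} p → Unique σ → ∃ λ τ → Unique τ × σ ≡ ins p (lookup σ p) τ
  ins-surjective {n} {σ} p u = τ , injective⇒unique τ τ-injective , lookup-extensional λ i → agree (punchView p i)
    where
    v = lookup σ p

    v≢ : ∀ i → v ≢ lookup σ (punchIn p i)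
    v≢ i e = punchInᵢ≢i p i (sym (lookup-injective u _ _ e))

    τ : Word n
    τ = tabulate λ i → punchOut (v≢ i)

    τ-injective : ∀ {i j} → lookup τ i ≡ lookup τ j → i ≡ j
    τ-injective {i} {j} e = punchIn-injective p i j (lookup-injective u _ _ (punchOut-injective (v≢ i) (v≢ j)
      (trans (sym (lookup∘tabulate _ i)) (trans e (lookup∘tabulate _ j)))))

    agree : ∀ {i} → PunchView p i → lookup σ i ≡ lookup (ins p v τ) i
    agree at        = sym (ins-at p v τ)
    agree (other i) = sym (trans (ins-punchIn p v τ i)
      (trans (cong (punchIn v) (lookup∘tabulate _ i)) (punchIn-punchOut (v≢ i))))

  -- Pigeonhole: if v were missing, punching it out of the entries would inject `suc n` positions
  -- into n values.
  value-occurs : ∀ {σ : Word n} → Unique σ → ∀ v → ∃ λ p → lookup σ p ≡ v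
  value-occurs {suc n} {σ} u v with any? (λ p → lookup σ p Finₚ.≟ v)
  ... | yes found = found
  ... | no absent = contradiction (injective⇒≤ {f = λ p → punchOut (v≢ p)} λ {i} {j} e →
                      lookup-injective u i j (punchOut-injective (v≢ i) (v≢ j) e)) 1+n≰n
    where
    v≢ : ∀ p → v ≢ lookup σ p
    v≢ p e = absent (p , sym e)

  -- Duplicate-free lists with the same members are rearrangements of each other, so bijectivity of
  -- `f` on words with distinct entries is enough. Keeping `f` abstract serves both the insertions
  -- with fixed position and those with fixed value.
  𝔖-suc-↭ : ∀ (f : Fin (suc n) → Word n → Word (suc n)) →
            (∀ {a b σ τ} → f a σ ≡ f b τ → a ≡ b × σ ≡ τ) →
            (∀ a {σ} → Unique σ → Unique (f a σ)) →
            (∀ {σ} → Unique σ → ∃₂ λ a τ → Unique τ × σ ≡ f a τ) →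
            𝔖 (suc n) ↭ cartesianProductWith f (allFin (suc n)) (𝔖 n)
  𝔖-suc-↭ {n} f inj valid onto = ∼bag⇒↭ (unique∧set⇒bag (𝔖-unique (suc n))
    (List.cartesianProductWith⁺ f inj (List.allFin⁺ (suc n)) (𝔖-unique n)) (mk⇔ to from))
    where
    to : ∀ {σ} → σ ∈ 𝔖 (suc n) → σ ∈ cartesianProductWith f (allFin (suc n)) (𝔖 n)
    to σ∈ with a , τ , u , refl ← onto (∈-𝔖⁻ σ∈) = ∈-cartesianProductWith⁺ f (∈-allFin a) (∈-𝔖⁺ u)

    from : ∀ {σ} → σ ∈ cartesianProductWith f (allFin (suc n)) (𝔖 n) → σ ∈ 𝔖 (suc n)
    from σ∈ with a , τ , _ , τ∈ , refl ← ∈-cartesianProductWith⁻ f (allFin (suc n)) (𝔖 n) σ∈ =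
      ∈-𝔖⁺ (valid a (∈-𝔖⁻ τ∈))

  𝔖-by-position : ∀ p → 𝔖 (suc n) ↭ cartesianProductWith (ins p) (allFin (suc n)) (𝔖 n)
  𝔖-by-position p = 𝔖-suc-↭ (ins p)
    (λ {a} {b} {σ} {τ} e →
      let a≡b = trans (sym (ins-at p a σ)) (trans (cong (λ ρ → lookup ρ p) e) (ins-at p b τ))
      in a≡b , ins-injective e refl a≡b)
    (λ v → ins-unique p v)
    (λ {σ} u → lookup σ p , ins-surjective p u)

  𝔖-by-value : ∀ v → 𝔖 (suc n) ↭ cartesianProductWith (λ p → ins p v) (allFin (suc n)) (𝔖 n)
  𝔖-by-value v = 𝔖-suc-↭ (λ p → ins p v) inj (λ p → ins-unique p v) onto
    where
    inj : ∀ {a b σ τ} → ins a v σ ≡ ins b v τ → a ≡ b × σ ≡ τ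
    inj {a} {b} {σ} {τ} e with punchView b a
    ... | at      = refl , ins-injective e refl refl
    -- In `ins b v τ` the value v stands at b only, whereas the equation also puts it at a.
    ... | other i = contradiction
          (trans (sym (ins-punchIn b v τ i)) (trans (cong (λ ρ → lookup ρ a) (sym e)) (ins-at a v σ)))
          (punchInᵢ≢i v _)

    onto : ∀ {σ} → Unique σ → ∃₂ λ p τ → Unique τ × σ ≡ ins p v τ
    onto u with p , refl ← value-occurs u v = p , ins-surjective p u

-- Inversions and excedances under insertion

module InversionsAndExcedances where

  open import Data.Fin as Fin using (Fin; zero; suc; toℕ; punchIn)
  open import Data.Fin.Properties as Finₚ using (punchIn-mono-≤; punchIn-cancel-≤; toℕ<n; fromℕ<-toℕ)
  open import Data.Fin.Permutation as Permutation using (Permutation)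
  open import Data.List as List using (List; []; _∷_; _++_; applyUpTo; cartesianProduct; filter)
  open import Data.List.Properties using (filter-++; length-++)
  open import Data.Nat
  open import Data.Nat.Properties
  open import Data.Product using (_×_; _,_; proj₁; proj₂)
  open import Data.Vec using (lookup)
  open import Data.Vec.Relation.Unary.Unique.Propositional using (Unique)
  open import Data.Vec.Relation.Unary.Unique.Propositional.Properties using (lookup-injective)
  open import Function using (_∘_)
  open import Relation.Binary.PropositionalEquality using (_≡_; refl; sym; trans; cong; cong₂; subst; subst₂; module ≡-Reasoning)
  open import Relation.Nullary using (Dec; ¬_; yes; no; contradiction; _×-dec_; _→-dec_)
  open import Relation.Unary using (Pred; Decidable)
  open import Algebra.Properties.CommutativeMonoid.Sum +-0-commutativeMonoid using (sum; sum-remove; ∑-distrib-+; sum-permute; sum-cong-≗)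
  open Insertions

  private variable n : ℕ

  ind : ∀ {p} {P : Set p} → Dec P → ℕ
  ind (yes _) = 1
  ind (no _)  = 0

  ind-⇔ : ∀ {p r} {P : Set p} {R : Set r} (P? : Dec P) (R? : Dec R) → (P → R) → (R → P) → ind P? ≡ ind R?
  ind-⇔ (yes p) (yes r) f g = refl
  ind-⇔ (yes p) (no ¬r) f g = contradiction (f p) ¬r
  ind-⇔ (no ¬p) (yes r) f g = contradiction (g r) ¬p
  ind-⇔ (no ¬p) (no ¬r) f g = refl

  ind-no : ∀ {p} {P : Set p} (P? : Dec P) → ¬ P → ind P? ≡ 0
  ind-no (yes p) ¬p = contradiction p ¬p
  ind-no (no _)  ¬p = refl

  ind-yes : ∀ {p} {P : Set p} (P? : Dec P) → P → ind P? ≡ 1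
  ind-yes (yes _) p = refl
  ind-yes (no ¬p) p = contradiction p ¬p

  module _ {a p} {A : Set a} {P : Pred A p} (P? : Decidable P) where

    count-∷ : ∀ x xs → count P? (x ∷ xs) ≡ ind (P? x) + count P? xs
    count-∷ x xs with P? x
    ... | yes _ = refl
    ... | no  _ = refl

    count-++ : ∀ xs ys → count P? (xs ++ ys) ≡ count P? xs + count P? ys
    count-++ xs ys = trans (cong List.length (filter-++ P? xs ys)) (length-++ (filter P? xs))

    count-map : ∀ {b} {B : Set b} (f : B → A) xs → count P? (List.map f xs) ≡ count (P? ∘ f) xs
    count-map f []       = refl
    count-map f (x ∷ xs) with P? (f x)
    ... | yes _ = cong suc (count-map f xs)
    ... | no  _ = count-map f xs

    count-applyUpTo : ∀ (f : ℕ → A) n → count P? (applyUpTo f n) ≡ sum {n} (λ i → ind (P? (f (toℕ i))))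
    count-applyUpTo f zero    = refl
    count-applyUpTo f (suc n) = trans (count-∷ (f 0) _) (cong (ind (P? (f 0)) +_) (count-applyUpTo (f ∘ suc) n))

  -- Counts of pairs become double sums over `Fin`, from which `sum-remove` can split off the row
  -- and the column of an inserted position.
  count-pairs : ∀ {a b p} {A : Set a} {B : Set b} {P : Pred (A × B) p} (P? : Decidable P) (f : ℕ → A) m
      (g : ℕ → B) n →
                count P? (cartesianProduct (applyUpTo f m) (applyUpTo g n)) ≡
                sum {m} (λ i → sum {n} (λ j → ind (P? (f (toℕ i) , g (toℕ j)))))
  count-pairs P? f zero    g n = refl
  count-pairs P? f (suc m) g n = trans (count-++ P? (List.map (f 0 ,_) (applyUpTo g n)) _)
    (cong₂ _+_ (trans (count-map P? (f 0 ,_) (applyUpTo g n)) (count-applyUpTo (λ y → P? (f 0 , y)) g n))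
               (count-pairs P? (f ∘ suc) m g n))

  ⟨⟩-lookup : ∀ (σ : Word n) i → σ ⟨ suc (toℕ i) ⟩ ≡ suc (toℕ (lookup σ i))
  ⟨⟩-lookup {n} σ i with toℕ i <? n
  ... | yes i<n = cong (λ j → suc (toℕ (lookup σ j))) (fromℕ<-toℕ i i<n)
  ... | no  i≮n = contradiction (toℕ<n i) i≮n

  inverts : Word n → Fin n → Fin n → ℕ
  inverts σ i j = ind (toℕ i <? toℕ j ×-dec toℕ (lookup σ j) <? toℕ (lookup σ i))

  inversions : Word n → ℕ
  inversions σ = sum λ i → sum λ j → inverts σ i j

  inv≡inversions : ∀ (σ : Word n) → inv σ ≡ inversions σ
  inv≡inversions {n} σ = trans (count-pairs _ suc n suc n) (sum-cong-≗ {n} λ i → sum-cong-≗ {n} λ j → ind-⇔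
    (suc (toℕ i) <? suc (toℕ j) ×-dec σ ⟨ suc (toℕ i) ⟩ >? σ ⟨ suc (toℕ j) ⟩)
    (toℕ i <? toℕ j ×-dec toℕ (lookup σ j) <? toℕ (lookup σ i))
    (λ (i<j , σi>σj) → s≤s⁻¹ i<j , s≤s⁻¹ (subst₂ _<_ (⟨⟩-lookup σ j) (⟨⟩-lookup σ i) σi>σj))
    (λ (i<j , σi>σj) → s≤s i<j , subst₂ _<_ (sym (⟨⟩-lookup σ j)) (sym (⟨⟩-lookup σ i)) (s≤s σi>σj)))

  excedances : Word n → ℕ
  excedances σ = sum λ i → ind (toℕ i <? toℕ (lookup σ i))

  exc≡excedances : ∀ (σ : Word n) → exc σ ≡ excedances σ
  exc≡excedances {n} σ = trans (count-applyUpTo _ suc n)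
      (sum-cong-≗ {n} λ i → ind-⇔ (suc (toℕ i) <? σ ⟨ suc (toℕ i) ⟩) (toℕ i <? toℕ (lookup σ i))
    (λ i<σi → s≤s⁻¹ (subst (_ <_) (⟨⟩-lookup σ i) i<σi))
    (λ i<σi → subst (_ <_) (sym (⟨⟩-lookup σ i)) (s≤s i<σi)))

  punchIn-below : ∀ (p : Fin (suc n)) i → toℕ i < toℕ p → toℕ (punchIn p i) ≡ toℕ i
  punchIn-below (suc p) zero    _         = refl
  punchIn-below (suc p) (suc i) (s≤s i<p) = cong suc (punchIn-below p i i<p)

  punchIn-above : ∀ (p : Fin (suc n)) i → toℕ p ≤ toℕ i → toℕ (punchIn p i) ≡ suc (toℕ i)
  punchIn-above zero    i       _         = refl
  punchIn-above (suc p) (suc i) (s≤s p≤i) = cong suc (punchIn-above p i p≤i)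

  punchIn-≤-suc : ∀ (p : Fin (suc n)) i → toℕ (punchIn p i) ≤ suc (toℕ i)
  punchIn-≤-suc zero    i       = ≤-refl
  punchIn-≤-suc (suc p) zero    = z≤n
  punchIn-≤-suc (suc p) (suc i) = s≤s (punchIn-≤-suc p i)

  punchIn-≥ : ∀ (p : Fin (suc n)) i → toℕ i ≤ toℕ (punchIn p i)
  punchIn-≥ zero    i       = n≤1+n _
  punchIn-≥ (suc p) zero    = z≤n
  punchIn-≥ (suc p) (suc i) = s≤s (punchIn-≥ p i)

  punchIn-<⁺ : ∀ (p : Fin (suc n)) i j → toℕ i < toℕ j → toℕ (punchIn p i) < toℕ (punchIn p j)
  punchIn-<⁺ p i j i<j = ≰⇒> (<⇒≱ i<j ∘ punchIn-cancel-≤ p j i)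

  punchIn-<⁻ : ∀ (p : Fin (suc n)) i j → toℕ (punchIn p i) < toℕ (punchIn p j) → toℕ i < toℕ j
  punchIn-<⁻ p i j lt = ≰⇒> (<⇒≱ lt ∘ punchIn-mono-≤ p j i)

  punchIn-<-pivot⁺ : ∀ (p : Fin (suc n)) i → toℕ i < toℕ p → toℕ (punchIn p i) < toℕ p
  punchIn-<-pivot⁺ p i lt = subst (_< toℕ p) (sym (punchIn-below p i lt)) lt

  punchIn-<-pivot⁻ : ∀ (p : Fin (suc n)) i → toℕ (punchIn p i) < toℕ p → toℕ i < toℕ p
  punchIn-<-pivot⁻ p i lt = ≤-<-trans (punchIn-≥ p i) lt

  pivot-<-punchIn⁺ : ∀ (p : Fin (suc n)) i → toℕ p ≤ toℕ i → toℕ p < toℕ (punchIn p i)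
  pivot-<-punchIn⁺ p i le = subst (toℕ p <_) (sym (punchIn-above p i le)) (s≤s le)

  -- In the permutation matrix this is an empty a by b corner, a condition symmetric in positions
  -- and values.
  Avoid : ℕ → ℕ → Word n → Set
  Avoid a b σ = ∀ i → toℕ i < a → b ≤ toℕ (lookup σ i)

  avoid? : ∀ a b (σ : Word n) → Dec (Avoid a b σ)
  avoid? a b σ = Finₚ.all? λ i → (toℕ i <? a) →-dec (b ≤? toℕ (lookup σ i))

  Avoid-antitone : ∀ {a a′ b b′} {σ : Word n} → a′ ≤ a → b′ ≤ b → Avoid a b σ → Avoid a′ b′ σ
  Avoid-antitone a′≤a b′≤b av i i<a′ = ≤-trans b′≤b (av i (<-≤-trans i<a′ a′≤a))

  sum-< : ∀ {n m} → m ≤ n → sum {n} (λ i → ind (toℕ i <? m)) ≡ m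
  sum-< {zero}  z≤n       = refl
  sum-< {suc n} z≤n       = sum-< {n} z≤n
  sum-< {suc n} {suc m} (s≤s m≤n) = cong suc
    (trans (sum-cong-≗ {n} λ i → ind-⇔ (suc (toℕ i) <? suc m) (toℕ i <? m) s≤s⁻¹ s≤s) (sum-< m≤n))

  permutation : {σ : Word n} → Unique σ → Permutation n n
  permutation {σ = σ} u = Permutation.permutation (lookup σ) (λ v → proj₁ (value-occurs u v))
    (λ v → proj₂ (value-occurs u v))
    (λ i → lookup-injective u _ _ (proj₂ (value-occurs u (lookup σ i))))

  sum-values : {σ : Word n} → Unique σ → ∀ f → sum (λ i → f (lookup σ i)) ≡ sum f
  sum-values u f = sym (sum-permute f (permutation u))

  -- The empty corner leaves only larger values to the left of p, so each of the `toℕ p` positions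
  -- there forms an inversion with the new entry. Hence all `toℕ v` smaller values lie to its right,
  -- and each of them forms one as well.
  inversions-ins : ∀ p v {σ : Word n} → Unique σ → Avoid (toℕ p) (toℕ v) σ →
                   inversions (ins p v σ) ≡ toℕ p + toℕ v + inversions σ
  inversions-ins {n} p v {σ} u av = begin
    inversions τ
      ≡⟨ sum-remove {i = p} (λ i → sum (inverts τ i)) ⟩
    sum (inverts τ p) + sum (λ i → sum (inverts τ (punchIn p i)))
      ≡⟨ cong₂ _+_ (sum-remove {i = p} (inverts τ p))
                   (trans (sum-cong-≗ {n} λ i → sum-remove {i = p} (inverts τ (punchIn p i)))
                       (∑-distrib-+ (λ i → inverts τ (punchIn p i) p) _)) ⟩
    (inverts τ p p + sum (λ j → inverts τ p (punchIn p j))) +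
    (sum (λ i → inverts τ (punchIn p i) p) + sum (λ i → sum (λ j → inverts τ (punchIn p i) (punchIn p j))))
      ≡⟨ cong₂ _+_ (cong₂ _+_
          (ind-no (toℕ p <? toℕ p ×-dec toℕ (lookup τ p) <? toℕ (lookup τ p)) (<-irrefl refl ∘ proj₁)) right)
              (cong₂ _+_ left rest) ⟩
    toℕ v + (toℕ p + inversions σ)
      ≡⟨ +-assoc (toℕ v) _ _ ⟨
    toℕ v + toℕ p + inversions σ
      ≡⟨ cong (_+ inversions σ) (+-comm (toℕ v) _) ⟩
    toℕ p + toℕ v + inversions σ ∎
    where
    open ≡-Reasoning
    τ = ins p v σ

    at-p : toℕ (lookup τ p) ≡ toℕ v
    at-p = cong toℕ (ins-at p v σ)

    at-other : ∀ i → toℕ (lookup τ (punchIn p i)) ≡ toℕ (punchIn v (lookup σ i))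
    at-other i = cong toℕ (ins-punchIn p v σ i)

    inverts? : ∀ i j → Dec (toℕ i < toℕ j × toℕ (lookup τ j) < toℕ (lookup τ i))
    inverts? i j = toℕ i <? toℕ j ×-dec toℕ (lookup τ j) <? toℕ (lookup τ i)

    right : sum (λ j → inverts τ p (punchIn p j)) ≡ toℕ v
    right = trans (sum-cong-≗ {n} λ j → ind-⇔ (inverts? p (punchIn p j)) (toℕ (lookup σ j) <? toℕ v)
        (λ (_ , lt) → punchIn-<-pivot⁻ v (lookup σ j) (subst₂ _<_ (at-other j) at-p lt))
        (λ lt → pivot-<-punchIn⁺ p j (≮⇒≥ λ j<p → <⇒≱ lt (av j j<p)) ,
                subst₂ _<_ (sym (at-other j)) (sym at-p) (punchIn-<-pivot⁺ v _ lt)))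
      (trans (sum-values u (λ w → ind (toℕ w <? toℕ v))) (sum-< (s≤s⁻¹ (toℕ<n v))))

    left : sum (λ i → inverts τ (punchIn p i) p) ≡ toℕ p
    left = trans (sum-cong-≗ {n} λ i → ind-⇔ (inverts? (punchIn p i) p) (toℕ i <? toℕ p)
        (λ (lt , _) → punchIn-<-pivot⁻ p i lt)
        (λ lt → punchIn-<-pivot⁺ p i lt ,
                subst₂ _<_ (sym at-p) (sym (at-other i)) (pivot-<-punchIn⁺ v _ (av i lt))))
      (sum-< (s≤s⁻¹ (toℕ<n p)))

    rest : sum (λ i → sum (λ j → inverts τ (punchIn p i) (punchIn p j))) ≡ inversions σ
    rest = sum-cong-≗ {n} λ i → sum-cong-≗ {n} λ j →
      ind-⇔ (inverts? (punchIn p i) (punchIn p j)) (toℕ i <? toℕ j ×-dec toℕ (lookup σ j) <? toℕ (lookup σ i))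
      (λ (lt , gt) → punchIn-<⁻ p i j lt , punchIn-<⁻ v _ _ (subst₂ _<_ (at-other j) (at-other i) gt))
      (λ (lt , gt) → punchIn-<⁺ p i j lt , subst₂ _<_ (sym (at-other j)) (sym (at-other i)) (punchIn-<⁺ v _ _ gt))

  -- An old entry could change its status only if exactly one of its position and value is shifted.
  -- A position left of p lies in the corner, so its value is at least s ≥ r and it is an excedance
  -- already. A value below v ≤ s forces a position of at least r ≥ s - 1, so it cannot be an
  -- excedance.
  excedances-ins : ∀ p v {σ : Word n} {r s} → Avoid r s σ →
                   toℕ p ≤ r → toℕ v ≤ s → r ≤ s → s ≤ suc r →
                   excedances (ins p v σ) ≡ ind (toℕ p <? toℕ v) + excedances σ
  excedances-ins {n} p v {σ} {r} {s} av p≤r v≤s r≤s s≤1+r =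
    trans (sum-remove {i = p} (λ i → ind (toℕ i <? toℕ (lookup (ins p v σ) i)))) (cong₂ _+_
      (cong (λ w → ind (toℕ p <? w)) at-p)
      (sum-cong-≗ {n} λ i → trans
        (cong (λ w → ind (toℕ (punchIn p i) <? w)) (at-other i))
        (ind-⇔ (toℕ (punchIn p i) <? toℕ (punchIn v (lookup σ i))) (toℕ i <? toℕ (lookup σ i)) (to i) (from i))))
    where
    at-p : toℕ (lookup (ins p v σ) p) ≡ toℕ v
    at-p = cong toℕ (ins-at p v σ)

    at-other : ∀ i → toℕ (lookup (ins p v σ) (punchIn p i)) ≡ toℕ (punchIn v (lookup σ i))
    at-other i = cong toℕ (ins-punchIn p v σ i)

    to : ∀ i → toℕ (punchIn p i) < toℕ (punchIn v (lookup σ i)) → toℕ i < toℕ (lookup σ i)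
    to i lt with toℕ i <? toℕ p
    ... | yes i<p = <-≤-trans i<p (≤-trans p≤r (≤-trans r≤s (av i (<-≤-trans i<p p≤r))))
    ... | no  i≮p = s≤s⁻¹ (<-≤-trans (subst (_< _) (punchIn-above p i (≮⇒≥ i≮p)) lt) (punchIn-≤-suc v _))

    from : ∀ i → toℕ i < toℕ (lookup σ i) → toℕ (punchIn p i) < toℕ (punchIn v (lookup σ i))
    from i lt with toℕ (lookup σ i) <? toℕ v
    ... | no  σi≮v = subst (_ <_) (sym (punchIn-above v _ (≮⇒≥ σi≮v))) (s≤s (≤-trans (punchIn-≤-suc p i) lt))
    ... | yes σi<v = contradiction lt (≤⇒≯ (≤-trans (s≤s⁻¹ (<-≤-trans σi<v (≤-trans v≤s s≤1+r)))
                       (≮⇒≥ λ i<r → <⇒≱ (<-≤-trans σi<v v≤s) (av i i<r))))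

-- Recurrences for permutations with an empty corner

module ExcedanceRecursion where

  open import Algebra.Bundles using (CommutativeSemiring)
  open import Data.Fin as Fin using (Fin; zero; suc; toℕ; fromℕ<)
  open import Data.Fin.Properties using (punchInᵢ≢i; toℕ-fromℕ<; toℕ<n; toℕ-injective)
  open import Data.List using (allFin; upTo; cartesianProductWith)
  open import Data.List.Membership.Propositional using (_∈_)
  open import Data.Nat as ℕ using (ℕ; zero; suc; _≤_; _<_; _∸_; z≤n; s≤s; s≤s⁻¹)
  open import Data.Nat.Properties as ℕ using (_<?_; ≤-refl; ≤-trans; <-≤-trans; ≤-<-trans; n≤1+n; <⇒≱; ≮⇒≥; ≰⇒>; <-irrefl)
  open import Data.Product using (_×_; _,_)
  open import Data.Vec using (lookup)
  open import Data.Vec.Relation.Unary.Unique.Propositional using (Unique)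
  open import Relation.Binary.PropositionalEquality as ≡ using (_≡_; cong; cong₂; subst; subst₂)
  open import Relation.Nullary using (Dec; ¬_; yes; no; contradiction; ¬?; _×-dec_)
  open FiniteSums
  open QWeightSums
  open Insertions
  open InversionsAndExcedances

  private variable n : ℕ

  -- Only the zero-based value `suc h`, placed among the first `suc h` positions, can spoil the
  -- larger corner. Its deletion removes one of those positions and lowers the larger values by one,
  -- which leaves a corner of h positions and `suc h` values.
  avoid-value-step⁺ : ∀ {h} p v {σ : Word n} → toℕ v ≡ suc h →
    Avoid (suc h) (suc h) (ins p v σ) × ¬ Avoid (suc h) (suc (suc h)) (ins p v σ) →
    toℕ p < suc h × Avoid h (suc h) σ
  avoid-value-step⁺ {h = h} p v {σ} v≡h (av , ¬av) = p<h , avσ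
    where
    p<h : toℕ p < suc h
    p<h = ≰⇒> λ h≤p → ¬av λ i i<h → ℕ.≤∧≢⇒< (av i i<h) λ e → <⇒≱ i<h
      (subst (λ j → suc h ≤ toℕ j) (p≡ i (punchView p i) (≡.trans (≡.sym e) (≡.sym v≡h))) h≤p)
      where
      p≡ : ∀ i → PunchView p i → toℕ (lookup (ins p v σ) i) ≡ toℕ v → p ≡ i
      p≡ i at        e = ≡.refl
      p≡ _ (other i) e = contradiction (toℕ-injective (≡.trans (≡.sym (cong toℕ (ins-punchIn p v σ i))) e))
                           (punchInᵢ≢i v _)

    avσ : Avoid h (suc h) σ
    avσ i i<h = ≮⇒≥ λ σi<h → <⇒≱ (punchIn-<-pivot⁺ v (lookup σ i) (subst (_ <_) (≡.sym v≡h) σi<h))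
      (subst₂ _≤_ (≡.sym v≡h) (cong toℕ (ins-punchIn p v σ i))
        (av (Fin.punchIn p i) (≤-<-trans (punchIn-≤-suc p i) (s≤s i<h))))

  avoid-value-step⁻ : ∀ {h} p v {σ : Word n} → toℕ v ≡ suc h →
    toℕ p < suc h × Avoid h (suc h) σ →
    Avoid (suc h) (suc h) (ins p v σ) × ¬ Avoid (suc h) (suc (suc h)) (ins p v σ)
  avoid-value-step⁻ {h = h} p v {σ} v≡h (p<h , avσ) =
    (λ i → av i (punchView p i)) ,
    λ av → <-irrefl (≡.trans (≡.sym v≡h) (≡.sym (cong toℕ (ins-at p v σ)))) (av p p<h)
    where
    av : ∀ i → PunchView p i → toℕ i < suc h → suc h ≤ toℕ (lookup (ins p v σ) i)
    av _ at        i<h = ℕ.≤-reflexive (≡.trans (≡.sym v≡h) (≡.sym (cong toℕ (ins-at p v σ))))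
    av _ (other i) lt  = subst (suc h ≤_) (≡.sym (cong toℕ (ins-punchIn p v σ i)))
      (≤-trans (avσ i i<h) (punchIn-≥ v (lookup σ i)))
      where
      i<h : toℕ i < h
      i<h with toℕ i <? toℕ p
      ... | yes i<p = <-≤-trans i<p (s≤s⁻¹ p<h)
      ... | no  i≮p = s≤s⁻¹ (subst (_< suc h) (punchIn-above p i (≮⇒≥ i≮p)) lt)

  -- Position h is the only new one in the larger corner, so its entry must be at most h. The
  -- entries before it exceed it and drop by one on its deletion, which leaves a corner of h
  -- positions and h values.
  avoid-position-step⁺ : ∀ {h} p v {σ : Word n} → toℕ p ≡ h →
    Avoid h (suc h) (ins p v σ) × ¬ Avoid (suc h) (suc h) (ins p v σ) →
    toℕ v < suc h × Avoid h h σ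
  avoid-position-step⁺ {h = h} p v {σ} p≡h (av , ¬av) = v<h , avσ
    where
    v<h : toℕ v < suc h
    v<h = ≰⇒> λ h<v → ¬av λ i → extended h<v i (punchView p i)
      where
      extended : suc h ≤ toℕ v → ∀ i → PunchView p i → toℕ i < suc h → suc h ≤ toℕ (lookup (ins p v σ) i)
      extended h<v _ at        _  = subst (suc h ≤_) (≡.sym (cong toℕ (ins-at p v σ))) h<v
      extended h<v _ (other i) lt = av _ (ℕ.≤∧≢⇒< (s≤s⁻¹ lt) λ e →
        punchInᵢ≢i p i (toℕ-injective (≡.trans e (≡.sym p≡h))))

    avσ : Avoid h h σ
    avσ i i<h = s≤s⁻¹ (≤-trans (subst (suc h ≤_) (cong toℕ (ins-punchIn p v σ i))
        (av (Fin.punchIn p i) (subst (_ <_) p≡h (punchIn-<-pivot⁺ p i (subst (_ <_) (≡.sym p≡h) i<h)))))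
      (punchIn-≤-suc v _))

  avoid-position-step⁻ : ∀ {h} p v {σ : Word n} → toℕ p ≡ h →
    toℕ v < suc h × Avoid h h σ →
    Avoid h (suc h) (ins p v σ) × ¬ Avoid (suc h) (suc h) (ins p v σ)
  avoid-position-step⁻ {h = h} p v {σ} p≡h (v<h , avσ) =
    (λ i → av i (punchView p i)) ,
    λ av → <⇒≱ v<h (subst (suc h ≤_) (cong toℕ (ins-at p v σ)) (av p (s≤s (ℕ.≤-reflexive p≡h))))
    where
    av : ∀ i → PunchView p i → toℕ i < h → suc h ≤ toℕ (lookup (ins p v σ) i)
    av _ at        lt = contradiction lt (<-irrefl p≡h)
    av _ (other i) lt = subst (suc h ≤_) (≡.sym (cong toℕ (ins-punchIn p v σ i)))
      (subst (suc h ≤_) (≡.sym (punchIn-above v (lookup σ i) (≤-trans (s≤s⁻¹ v<h) h≤σi))) (s≤s h≤σi))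
      where
      h≤σi = avσ i (≤-<-trans (punchIn-≥ p i) lt)

  module ExcedanceSums {c ℓ} (S : CommutativeSemiring c ℓ)
    (q t : CommutativeSemiring.Carrier S) where

    open CommutativeSemiring S hiding (zero) renaming (refl to ≈-refl; sym to ≈-sym; trans to ≈-trans)
    open Summation S
    open QWeights S q
    open import Algebra.Properties.Semiring.Exp semiring using (_^_; ^-homo-*)
    open import Algebra.Solver.Ring.NaturalCoefficients.Default S
    open import Relation.Binary.Reasoning.Setoid setoid

    wt : Word n → Carrier
    wt σ = q ^ (inv σ ∸ exc σ) * t ^ exc σ

    -- The series at the even heights 2 h and odd heights 2 h + 1 of the S-fraction
    -- with coefficients V 1, t V 1, V 2, t V 2, ….
    E O : ℕ → ℕ → Carrier
    E n h = ∑ (𝔖 n) (λ σ → wt σ when avoid? h h σ)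
    O n h = ∑ (𝔖 n) (λ σ → wt σ when avoid? h (suc h) σ)

    private
      wt-form : ∀ (σ : Word n) {i e} → inversions σ ≡ i → excedances σ ≡ e → wt σ ≈ q ^ (i ∸ e) * t ^ e
      wt-form σ ≡.refl ≡.refl = reflexive (cong₂ (λ i e → q ^ (i ∸ e) * t ^ e) (inv≡inversions σ) (exc≡excedances σ))

      excedances≤inversions : {σ : Word n} → Unique σ → excedances σ ≤ inversions σ
      excedances≤inversions {σ = σ} u = subst₂ _≤_ (exc≡excedances σ) (inv≡inversions σ) (exc≤inv σ u)

    -- The insertion adds `toℕ p + suc h` inversions and one excedance. By `exc≤inv` the truncated
    -- difference belonging to σ can be split off.
    wt-ins-excedance : ∀ {h} p v {σ : Word n} → Unique σ → Avoid h (suc h) σ → toℕ v ≡ suc h → toℕ p < suc h →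
      wt (ins p v σ) ≈ t * q ^ (h ℕ.+ toℕ p) * wt σ
    wt-ins-excedance {h = h} p v {σ} u av v≡h p<h = begin
      wt (ins p v σ)
        ≈⟨ wt-form (ins p v σ) (inversions-ins p v u (Avoid-antitone {σ = σ} (s≤s⁻¹ p<h) v≤h av))
             (excedances-ins p v av (s≤s⁻¹ p<h) v≤h (n≤1+n h) ≤-refl) ⟩
      q ^ (toℕ p ℕ.+ toℕ v ℕ.+ I ∸ (ind (toℕ p <? toℕ v) ℕ.+ X)) * t ^ (ind (toℕ p <? toℕ v) ℕ.+ X)
        -- One of the `suc h` inversions with smaller values pays for the new excedance: a `suc`
        -- cancels on both sides of `∸`.
        ≡⟨ cong₂ (λ i e → q ^ (i ℕ.+ I ∸ (e ℕ.+ X)) * t ^ (e ℕ.+ X))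
             (≡.trans (cong (toℕ p ℕ.+_) v≡h) (ℕ.+-comm (toℕ p) (suc h)))
             (ind-yes (toℕ p <? toℕ v) (subst (toℕ p <_) (≡.sym v≡h) p<h)) ⟩
      q ^ (h ℕ.+ toℕ p ℕ.+ I ∸ X) * (t * t ^ X)
        ≡⟨ cong (λ e → q ^ e * (t * t ^ X)) (ℕ.+-∸-assoc (h ℕ.+ toℕ p) (excedances≤inversions u)) ⟩
      q ^ (h ℕ.+ toℕ p ℕ.+ (I ∸ X)) * (t * t ^ X)
        ≈⟨ *-congʳ (^-homo-* q (h ℕ.+ toℕ p) (I ∸ X)) ⟩
      q ^ (h ℕ.+ toℕ p) * q ^ (I ∸ X) * (t * t ^ X)
        ≈⟨ solve 4 (λ a b c d → a :* b :* (c :* d) := c :* a :* (b :* d)) ≈-refl _ _ _ _ ⟩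
      t * q ^ (h ℕ.+ toℕ p) * (q ^ (I ∸ X) * t ^ X)
        ≈⟨ *-congˡ (wt-form σ ≡.refl ≡.refl) ⟨
      t * q ^ (h ℕ.+ toℕ p) * wt σ ∎
      where
      I = inversions σ
      X = excedances σ
      v≤h = ℕ.≤-reflexive v≡h

    -- A value of at most h in position h is not an excedance, so all `h + toℕ v` new inversions
    -- remain in the exponent of q.
    wt-ins-nonexcedance : ∀ {h} p v {σ : Word n} → Unique σ → Avoid h h σ → toℕ p ≡ h → toℕ v < suc h →
      wt (ins p v σ) ≈ q ^ (h ℕ.+ toℕ v) * wt σ
    wt-ins-nonexcedance {h = h} p v {σ} u av p≡h v<h = begin
      wt (ins p v σ)
        ≈⟨ wt-form (ins p v σ) (inversions-ins p v u (Avoid-antitone {σ = σ} p≤h (s≤s⁻¹ v<h) av))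
             (excedances-ins p v av p≤h (s≤s⁻¹ v<h) ≤-refl (n≤1+n h)) ⟩
      q ^ (toℕ p ℕ.+ toℕ v ℕ.+ I ∸ (ind (toℕ p <? toℕ v) ℕ.+ X)) * t ^ (ind (toℕ p <? toℕ v) ℕ.+ X)
        ≡⟨ cong₂ (λ i e → q ^ (i ℕ.+ toℕ v ℕ.+ I ∸ (e ℕ.+ X)) * t ^ (e ℕ.+ X)) p≡h
             (ind-no (toℕ p <? toℕ v) λ p<v → <⇒≱ (subst (_< toℕ v) p≡h p<v) (s≤s⁻¹ v<h)) ⟩
      q ^ (h ℕ.+ toℕ v ℕ.+ I ∸ X) * t ^ X
        ≡⟨ cong (λ e → q ^ e * t ^ X) (ℕ.+-∸-assoc (h ℕ.+ toℕ v) (excedances≤inversions u)) ⟩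
      q ^ (h ℕ.+ toℕ v ℕ.+ (I ∸ X)) * t ^ X
        ≈⟨ *-congʳ (^-homo-* q (h ℕ.+ toℕ v) (I ∸ X)) ⟩
      q ^ (h ℕ.+ toℕ v) * q ^ (I ∸ X) * t ^ X
        ≈⟨ *-assoc _ _ _ ⟩
      q ^ (h ℕ.+ toℕ v) * (q ^ (I ∸ X) * t ^ X)
        ≈⟨ *-congˡ (wt-form σ ≡.refl ≡.refl) ⟨
      q ^ (h ℕ.+ toℕ v) * wt σ ∎
      where
      I = inversions σ
      X = excedances σ
      p≤h = ℕ.≤-reflexive p≡h

    private
      ∑-𝔖-split : ∀ n {P R : Word n → Set} (P? : ∀ σ → Dec (P σ)) (R? : ∀ σ → Dec (R σ)) → (∀ σ → R σ → P σ) →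
        ∑ (𝔖 n) (λ σ → wt σ when P? σ) ≈
        ∑ (𝔖 n) (λ σ → wt σ when R? σ) + ∑ (𝔖 n) (λ σ → wt σ when (P? σ ×-dec ¬? (R? σ)))
      ∑-𝔖-split n P? R? R⊆P = ≈-trans (∑-cong (𝔖 n) λ σ → when-split (P? σ) (R? σ) (R⊆P σ) (wt σ))
        (∑-distrib-+ (𝔖 n) _ _)

      ∑-weighted : ∀ {n h} → h ≤ suc n → ∀ (f : ℕ → Carrier) (x : Carrier) →
        ∑ (allFin (suc n)) (λ p → (f (toℕ p) * x) when (toℕ p <? h)) ≈ ∑ (upTo h) f * x
      ∑-weighted {n} {h} h≤n f x = begin
        ∑ (allFin (suc n)) (λ p → (f (toℕ p) * x) when (toℕ p <? h)) ≈⟨ ∑-allFin-< h≤n (λ i → f i * x) ⟩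
        ∑ (upTo h) (λ i → f i * x)  ≈⟨ ∑-cong (upTo h) (λ i → *-comm (f i) x) ⟩
        ∑ (upTo h) (λ i → x * f i)  ≈⟨ ∑-*ˡ x (upTo h) f ⟨
        x * ∑ (upTo h) f            ≈⟨ *-comm x _ ⟩
        ∑ (upTo h) f * x            ∎

    E-zero : ∀ n → E n 0 ≈ O n 0
    E-zero n = ∑-cong (𝔖 n) λ σ → when-⇔ (avoid? 0 0 σ) (avoid? 0 1 σ) (λ _ _ ()) (λ _ _ ()) (wt σ)

    -- The words lost from one corner to the next carry the zero-based value `suc h` at a place p of
    -- at most h. Decomposing by that place, the factors `t * q ^ (h + p)` add up to
    -- `t * V (suc h)`.
    E-suc : ∀ {n h} → suc h ≤ n → E (suc n) (suc h) ≈ O (suc n) (suc h) + t * V (suc h) * O n h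
    E-suc {n} {h} h<n = ≈-trans
      (∑-𝔖-split (suc n) (avoid? (suc h) (suc h)) (avoid? (suc h) (suc (suc h)))
        λ σ → Avoid-antitone {σ = σ} ≤-refl (n≤1+n _))
      (+-congˡ (begin
        ∑ (𝔖 (suc n)) f
          ≈⟨ ∑-↭ f (𝔖-by-value v) ⟩
        ∑ (cartesianProductWith (λ p → ins p v) (allFin (suc n)) (𝔖 n)) f
          ≈⟨ ∑-cartesianProductWith (λ p → ins p v) (allFin (suc n)) (𝔖 n) f ⟩
        ∑ (allFin (suc n)) (λ p → ∑ (𝔖 n) (λ σ → f (ins p v σ)))
          ≈⟨ ∑-cong (allFin (suc n)) (λ p → begin
               ∑ (𝔖 n) (λ σ → f (ins p v σ))
                 ≈⟨ ∑-cong-∈ (𝔖 n) (term p) ⟩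
               ∑ (𝔖 n) (λ σ → (t * q ^ (h ℕ.+ toℕ p) * (wt σ when avoid? h (suc h) σ)) when (toℕ p <? suc h))
                 ≈⟨ ∑-when (toℕ p <? suc h) (𝔖 n) _ ⟩
               (∑ (𝔖 n) (λ σ → t * q ^ (h ℕ.+ toℕ p) * (wt σ when avoid? h (suc h) σ)) when (toℕ p <? suc h))
                 ≈⟨ when-cong (toℕ p <? suc h) (λ _ → ∑-*ˡ _ (𝔖 n) _) ⟨
               ((t * q ^ (h ℕ.+ toℕ p) * O n h) when (toℕ p <? suc h)) ∎) ⟩
        ∑ (allFin (suc n)) (λ p → (t * q ^ (h ℕ.+ toℕ p) * O n h) when (toℕ p <? suc h))
          ≈⟨ ∑-weighted (s≤s (≤-trans (n≤1+n h) h<n)) (λ p → t * q ^ (h ℕ.+ p)) (O n h) ⟩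
        ∑ (upTo (suc h)) (λ p → t * q ^ (h ℕ.+ p)) * O n h
          ≈⟨ *-congʳ (∑-*ˡ t (upTo (suc h)) _) ⟨
        t * ∑ (upTo (suc h)) (λ p → q ^ (h ℕ.+ p)) * O n h
          ≈⟨ *-congʳ (*-congˡ (V-suc h)) ⟨
        t * V (suc h) * O n h ∎))
      where
      v : Fin (suc n)
      v = fromℕ< (s≤s h<n)

      v≡h : toℕ v ≡ suc h
      v≡h = toℕ-fromℕ< (s≤s h<n)

      f : Word (suc n) → Carrier
      f σ = wt σ when (avoid? (suc h) (suc h) σ ×-dec ¬? (avoid? (suc h) (suc (suc h)) σ))

      term : ∀ p σ → σ ∈ 𝔖 n → f (ins p v σ) ≈
          ((t * q ^ (h ℕ.+ toℕ p) * (wt σ when avoid? h (suc h) σ)) when (toℕ p <? suc h))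
      term p σ σ∈ = begin
        f (ins p v σ)
          ≈⟨ when-⇔ (avoid? (suc h) (suc h) (ins p v σ) ×-dec ¬? (avoid? (suc h) (suc (suc h)) (ins p v σ)))
               (toℕ p <? suc h ×-dec avoid? h (suc h) σ)
               (avoid-value-step⁺ p v v≡h) (avoid-value-step⁻ p v v≡h) _ ⟩
        (wt (ins p v σ) when (toℕ p <? suc h ×-dec avoid? h (suc h) σ))
          ≈⟨ when-cong (toℕ p <? suc h ×-dec avoid? h (suc h) σ)
               (λ (p<h , av) → wt-ins-excedance p v (∈-𝔖⁻ σ∈) av v≡h p<h) ⟩
        ((t * q ^ (h ℕ.+ toℕ p) * wt σ) when (toℕ p <? suc h ×-dec avoid? h (suc h) σ))
          ≈⟨ when-×-dec (toℕ p <? suc h) (avoid? h (suc h) σ) _ ⟩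
        (((t * q ^ (h ℕ.+ toℕ p) * wt σ) when avoid? h (suc h) σ) when (toℕ p <? suc h))
          ≈⟨ when-cong (toℕ p <? suc h) (λ _ → *-when (avoid? h (suc h) σ) _ _) ⟨
        ((t * q ^ (h ℕ.+ toℕ p) * (wt σ when avoid? h (suc h) σ)) when (toℕ p <? suc h)) ∎

    -- Here the corners differ in position h, so the decomposition is by the entry there; its values
    -- v of at most h contribute the factors `q ^ (h + v)`.
    O-suc : ∀ {n h} → h ≤ n → O (suc n) h ≈ E (suc n) (suc h) + V (suc h) * E n h
    O-suc {n} {h} h≤n = ≈-trans
      (∑-𝔖-split (suc n) (avoid? h (suc h)) (avoid? (suc h) (suc h))
        λ σ → Avoid-antitone {σ = σ} (n≤1+n _) ≤-refl)
      (+-congˡ (begin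
        ∑ (𝔖 (suc n)) f
          ≈⟨ ∑-↭ f (𝔖-by-position p) ⟩
        ∑ (cartesianProductWith (ins p) (allFin (suc n)) (𝔖 n)) f
          ≈⟨ ∑-cartesianProductWith (ins p) (allFin (suc n)) (𝔖 n) f ⟩
        ∑ (allFin (suc n)) (λ v → ∑ (𝔖 n) (λ σ → f (ins p v σ)))
          ≈⟨ ∑-cong (allFin (suc n)) (λ v → begin
               ∑ (𝔖 n) (λ σ → f (ins p v σ))
                 ≈⟨ ∑-cong-∈ (𝔖 n) (term v) ⟩
               ∑ (𝔖 n) (λ σ → (q ^ (h ℕ.+ toℕ v) * (wt σ when avoid? h h σ)) when (toℕ v <? suc h))
                 ≈⟨ ∑-when (toℕ v <? suc h) (𝔖 n) _ ⟩
               (∑ (𝔖 n) (λ σ → q ^ (h ℕ.+ toℕ v) * (wt σ when avoid? h h σ)) when (toℕ v <? suc h))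
                 ≈⟨ when-cong (toℕ v <? suc h) (λ _ → ∑-*ˡ _ (𝔖 n) _) ⟨
               ((q ^ (h ℕ.+ toℕ v) * E n h) when (toℕ v <? suc h)) ∎) ⟩
        ∑ (allFin (suc n)) (λ v → (q ^ (h ℕ.+ toℕ v) * E n h) when (toℕ v <? suc h))
          ≈⟨ ∑-weighted (s≤s h≤n) (λ v → q ^ (h ℕ.+ v)) (E n h) ⟩
        ∑ (upTo (suc h)) (λ v → q ^ (h ℕ.+ v)) * E n h
          ≈⟨ *-congʳ (V-suc h) ⟨
        V (suc h) * E n h ∎))
      where
      p : Fin (suc n)
      p = fromℕ< (s≤s h≤n)

      p≡h : toℕ p ≡ h
      p≡h = toℕ-fromℕ< (s≤s h≤n)

      f : Word (suc n) → Carrier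
      f σ = wt σ when (avoid? h (suc h) σ ×-dec ¬? (avoid? (suc h) (suc h) σ))

      term : ∀ v σ → σ ∈ 𝔖 n → f (ins p v σ) ≈ ((q ^ (h ℕ.+ toℕ v) * (wt σ when avoid? h h σ)) when (toℕ v <? suc h))
      term v σ σ∈ = begin
        f (ins p v σ)
          ≈⟨ when-⇔ (avoid? h (suc h) (ins p v σ) ×-dec ¬? (avoid? (suc h) (suc h) (ins p v σ)))
               (toℕ v <? suc h ×-dec avoid? h h σ)
               (avoid-position-step⁺ p v p≡h) (avoid-position-step⁻ p v p≡h) _ ⟩
        (wt (ins p v σ) when (toℕ v <? suc h ×-dec avoid? h h σ))
          ≈⟨ when-cong (toℕ v <? suc h ×-dec avoid? h h σ)
               (λ (v<h , av) → wt-ins-nonexcedance p v (∈-𝔖⁻ σ∈) av p≡h v<h) ⟩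
        ((q ^ (h ℕ.+ toℕ v) * wt σ) when (toℕ v <? suc h ×-dec avoid? h h σ))
          ≈⟨ when-×-dec (toℕ v <? suc h) (avoid? h h σ) _ ⟩
        (((q ^ (h ℕ.+ toℕ v) * wt σ) when avoid? h h σ) when (toℕ v <? suc h))
          ≈⟨ when-cong (toℕ v <? suc h) (λ _ → *-when (avoid? h h σ) _ _) ⟨
        ((q ^ (h ℕ.+ toℕ v) * (wt σ when avoid? h h σ)) when (toℕ v <? suc h)) ∎

    E-base-zero : E 0 0 ≈ 1#
    E-base-zero = solve 0 (con 1 :* con 1 :+ con 0 := con 1) ≈-refl

    -- The first entry would have to exceed every available value.
    E-base-suc : ∀ h → E (suc h) (suc h) ≈ 0#
    E-base-suc h = ∑-zero (𝔖 (suc h)) λ σ _ → when-no (avoid? (suc h) (suc h) σ)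
      (λ av → <⇒≱ (toℕ<n (lookup σ zero)) (av zero (s≤s z≤n))) (wt σ)

-- Cutting words into blocks and inserting a smallest letter

module BlockSequences where

  open import Algebra.Bundles using (CommutativeSemiring)
  open import Data.Bool using (Bool)
  open import Data.Fin using (Fin; zero; suc)
  open import Data.List as List using (List; []; _∷_; _++_; allFin)
  open import Data.List.Properties using (map-++; map-∘)
  open import Data.List.Relation.Unary.All as All using (All; []; _∷_)
  import Data.List.Relation.Unary.All.Properties as All
  open import Data.Nat
  open import Data.Nat.Properties
  open import Data.Vec as Vec using (Vec; []; _∷_; insertAt)
  open import Function using (_∘_)
  open import Relation.Binary.PropositionalEquality using (_≡_; refl; sym; trans; cong; cong₂; module ≡-Reasoning)
  open FiniteSums

  private variable n : ℕ

  data Place : Set where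
    outside inside : Place

  private variable p : Place

  -- A sequence of nonempty blocks of letters, each closed by sep; the index
  -- tells whether the reading point is between two blocks or inside one.
  infixr 5 _∷_
  data Blocks : Place → Set where
    end : Blocks outside
    _∷_ : ℕ → Blocks inside → Blocks p
    sep : Blocks outside → Blocks inside

  ↑ : Blocks p → Blocks p
  ↑ end     = end
  ↑ (x ∷ w) = suc x ∷ ↑ w
  ↑ (sep w) = sep (↑ w)

  -- Every gap between letters may be cut or not. The index `outside` forces a letter before the
  -- next separator, which keeps the blocks nonempty.
  splits : ∀ p → Vec ℕ n → List (Blocks p)
  splits outside  []      = end ∷ []
  splits outside  (x ∷ w) = List.map (x ∷_) (splits inside w)
  splits inside []      = sep end ∷ []
  splits inside (x ∷ w) = List.map (x ∷_) (splits inside w) ++ List.map (λ b → sep (x ∷ b)) (splits inside w)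

  splits-suc : ∀ p (w : Vec ℕ n) → splits p (Vec.map suc w) ≡ List.map ↑ (splits p w)
  splits-suc outside  []      = refl
  splits-suc inside []      = refl
  splits-suc outside  (x ∷ w) = begin
    List.map (suc x ∷_) (splits inside (Vec.map suc w)) ≡⟨ cong (List.map (suc x ∷_)) (splits-suc inside w) ⟩
    List.map (suc x ∷_) (List.map ↑ (splits inside w))   ≡⟨ map-∘ _ ⟨
    List.map (↑ ∘ (x ∷_)) (splits inside w)              ≡⟨ map-∘ _ ⟩
    List.map ↑ (List.map (x ∷_) (splits inside w))       ∎
    where open ≡-Reasoning
  splits-suc inside (x ∷ w) = begin
    List.map (suc x ∷_) (splits inside (Vec.map suc w)) ++ List.map (λ b → sep (suc x ∷ b))
        (splits inside (Vec.map suc w))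
      ≡⟨ cong (λ bs → List.map (suc x ∷_) bs ++ List.map (λ b → sep (suc x ∷ b)) bs) (splits-suc inside w) ⟩
    List.map (suc x ∷_) (List.map ↑ bs) ++ List.map (λ b → sep (suc x ∷ b)) (List.map ↑ bs)
      ≡⟨ cong₂ _++_ (trans (sym (map-∘ bs)) (map-∘ bs)) (trans (sym (map-∘ bs)) (map-∘ bs)) ⟩
    List.map ↑ (List.map (x ∷_) bs) ++ List.map ↑ (List.map (λ b → sep (x ∷ b)) bs)
      ≡⟨ map-++ ↑ (List.map (x ∷_) bs) _ ⟨
    List.map ↑ (splits inside (x ∷ w)) ∎
    where
    open ≡-Reasoning
    bs = splits inside w

  data Kind : Set where
    peak doubleAscent valley doubleDescent : Kind

  -- grow κ p w inserts into ↑ w a new smallest letter 0 that becomes an element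
  -- of kind κ: a peak is a new singleton block, a double ascent opens an
  -- existing block, a double descent closes one, and a valley replaces a sep
  -- between two blocks.
  growFront : Kind → ℕ → Blocks inside → List (Blocks outside)
  growFront peak         x w = (0 ∷ sep (suc x ∷ ↑ w)) ∷ []
  growFront doubleAscent x w = (0 ∷ suc x ∷ ↑ w) ∷ []
  growFront _            x w = []

  growAtSep : Kind → Blocks outside → List (Blocks inside)
  growAtSep valley        (x ∷ w) = (0 ∷ suc x ∷ ↑ w) ∷ []
  growAtSep doubleDescent w       = (0 ∷ sep (↑ w)) ∷ []
  -- This also covers a valley at the last separator, which has no block to its right to be joined.
  growAtSep _             _       = []

  growEnd : Kind → List (Blocks outside)
  growEnd peak = (0 ∷ sep end) ∷ []
  growEnd _    = []

  grow : Kind → ∀ p → Blocks p → List (Blocks p)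
  grow κ outside  end     = growEnd κ
  grow κ outside  (x ∷ w) = growFront κ x w ++ List.map (suc x ∷_) (grow κ inside w)
  grow κ inside (x ∷ w) = List.map (suc x ∷_) (grow κ inside w)
  grow κ inside (sep w) = growAtSep κ w ++ List.map sep (grow κ outside w)

  module SplitSums {c ℓ} (S : CommutativeSemiring c ℓ) where
    open CommutativeSemiring S hiding (zero) renaming (_+_ to _⊹_; refl to ≈-refl; sym to ≈-sym; trans to ≈-trans)
    open Summation S
    open import Algebra.Solver.Ring.NaturalCoefficients.Default S
    open import Relation.Binary.Reasoning.Setoid setoid

    growths : ∀ p → Blocks p → (Blocks p → Carrier) → Carrier
    growths p w f = ∑ (peak ∷ doubleAscent ∷ valley ∷ doubleDescent ∷ []) (λ κ → ∑ (grow κ p w) f)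

    private
      growths-+ : ∀ p w f g → growths p w (λ b → f b ⊹ g b) ≈ growths p w f ⊹ growths p w g
      growths-+ p w f g = ≈-trans
        (∑-cong kinds λ κ → ∑-distrib-+ (grow κ p w) f g)
        (∑-distrib-+ kinds (λ κ → ∑ (grow κ p w) f) (λ κ → ∑ (grow κ p w) g))
        where kinds = peak ∷ doubleAscent ∷ valley ∷ doubleDescent ∷ []

      growths-front : ∀ x w f → growths outside (x ∷ w) f ≈
        (f (0 ∷ suc x ∷ ↑ w) ⊹ f (0 ∷ sep (suc x ∷ ↑ w))) ⊹ growths inside w (λ b → f (suc x ∷ b))
      growths-front x w f
        rewrite ∑-map (suc x ∷_) (grow peak inside w) f
              | ∑-map (suc x ∷_) (grow doubleAscent inside w) f
              | ∑-map (suc x ∷_) (grow valley inside w) f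
              | ∑-map (suc x ∷_) (grow doubleDescent inside w) f
        = solve 6 (λ a b u v y z → (a :+ u) :+ ((b :+ v) :+ (y :+ (z :+ con 0))) :=
                                   (b :+ a) :+ (u :+ (v :+ (y :+ (z :+ con 0))))) ≈-refl _ _ _ _ _ _

      growths-letter : ∀ x w f → growths inside (x ∷ w) f ≈ growths inside w (λ b → f (suc x ∷ b))
      growths-letter x w f = reflexive (cong₂ _⊹_ (∑-map (suc x ∷_) (grow peak inside w) f)
        (cong₂ _⊹_ (∑-map (suc x ∷_) (grow doubleAscent inside w) f)
        (cong₂ _⊹_ (∑-map (suc x ∷_) (grow valley inside w) f)
        (cong (_⊹ 0#) (∑-map (suc x ∷_) (grow doubleDescent inside w) f)))))

      growths-sep : ∀ x w f → growths inside (sep (x ∷ w)) f ≈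
        (f (0 ∷ suc x ∷ ↑ w) ⊹ f (0 ∷ sep (suc x ∷ ↑ w))) ⊹ growths outside (x ∷ w) (λ b → f (sep b))
      growths-sep x w f
        rewrite ∑-map sep (grow peak outside (x ∷ w)) f
              | ∑-map sep (grow doubleAscent outside (x ∷ w)) f
              | ∑-map sep (grow valley outside (x ∷ w)) f
              | ∑-map sep (grow doubleDescent outside (x ∷ w)) f
        = solve 6 (λ a b u v y z → u :+ (v :+ ((a :+ y) :+ ((b :+ z) :+ con 0))) :=
                                   (a :+ b) :+ (u :+ (v :+ (y :+ (z :+ con 0))))) ≈-refl _ _ _ _ _ _

      splits-letter : ∀ x (w : Vec ℕ n) f →
        ∑ (splits inside (x ∷ w)) f ≈ ∑ (splits inside w) (λ b → f (x ∷ b) ⊹ f (sep (x ∷ b)))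
      splits-letter x w f = begin
        ∑ (splits inside (x ∷ w)) f
          ≈⟨ ∑-++ (List.map (x ∷_) (splits inside w)) _ f ⟩
        ∑ (List.map (x ∷_) (splits inside w)) f ⊹ ∑ (List.map (λ b → sep (x ∷ b)) (splits inside w)) f
          ≡⟨ cong₂ _⊹_ (∑-map (x ∷_) (splits inside w) f) (∑-map (λ b → sep (x ∷ b)) (splits inside w) f) ⟩
        ∑ (splits inside w) (λ b → f (x ∷ b)) ⊹ ∑ (splits inside w) (λ b → f (sep (x ∷ b)))
          ≈⟨ ∑-distrib-+ (splits inside w) _ _ ⟨
        ∑ (splits inside w) (λ b → f (x ∷ b) ⊹ f (sep (x ∷ b))) ∎

      ∑-splits-suc : ∀ p (w : Vec ℕ n) f → ∑ (splits p (Vec.map suc w)) f ≈ ∑ (splits p w) (f ∘ ↑)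
      ∑-splits-suc p w f = reflexive (trans (cong (λ bs → ∑ bs f) (splits-suc p w)) (∑-map ↑ (splits p w) f))

    -- Deleting the smallest letter 0 from a splitting leaves a splitting of w, up
    -- to the merging of adjacent seps, and grow lists the splittings above it.
    ∑-insert : ∀ p (w : Vec ℕ n) f →
      ∑ (allFin (suc n)) (λ i → ∑ (splits p (insertAt (Vec.map suc w) i 0)) f) ≈
      ∑ (splits p w) (λ b → growths p b f)
    ∑-insert outside  []      f = solve 1
        (λ x → (x :+ con 0) :+ con 0 := ((x :+ con 0) :+ (con 0 :+ (con 0 :+ (con 0 :+ con 0)))) :+ con 0) ≈-refl _
    ∑-insert inside []      f = solve 2 (λ x y → (x :+ (y :+ con 0)) :+ con 0 :=
      ((y :+ con 0) :+ (con 0 :+ (con 0 :+ ((x :+ con 0) :+ con 0)))) :+ con 0) ≈-refl _ _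
    ∑-insert {suc n} outside (x ∷ w) f = begin
      ∑ (allFin (2+ n)) (λ i → ∑ (splits outside (insertAt (Vec.map suc (x ∷ w)) i 0)) f)
        ≡⟨ ∑-allFin-suc (suc n) _ ⟩
      ∑ (List.map (0 ∷_) (splits inside (suc x ∷ Vec.map suc w))) f ⊹
      ∑ (allFin (suc n)) (λ i → ∑ (List.map (suc x ∷_) (splits inside (insertAt (Vec.map suc w) i 0))) f)
        ≈⟨ +-cong
             (≈-trans (reflexive (∑-map (0 ∷_) (splits inside (suc x ∷ Vec.map suc w)) f))
             (≈-trans (splits-letter (suc x) (Vec.map suc w) (λ b → f (0 ∷ b)))
                      (∑-splits-suc inside w _)))
             (≈-trans (∑-cong (allFin (suc n)) λ i → reflexive
                 (∑-map (suc x ∷_) (splits inside (insertAt (Vec.map suc w) i 0)) f))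
                      (∑-insert inside w (λ b → f (suc x ∷ b)))) ⟩
      ∑ (splits inside w) (λ b → f (0 ∷ suc x ∷ ↑ b) ⊹ f (0 ∷ sep (suc x ∷ ↑ b))) ⊹
      ∑ (splits inside w) (λ b → growths inside b (λ s → f (suc x ∷ s)))
        ≈⟨ ∑-distrib-+ (splits inside w) _ _ ⟨
      ∑ (splits inside w) (λ b → (f (0 ∷ suc x ∷ ↑ b) ⊹ f (0 ∷ sep (suc x ∷ ↑ b))) ⊹
          growths inside b (λ s → f (suc x ∷ s)))
        ≈⟨ ∑-cong (splits inside w) (λ b → growths-front x b f) ⟨
      ∑ (splits inside w) (λ b → growths outside (x ∷ b) f)
        ≡⟨ ∑-map (x ∷_) (splits inside w) _ ⟨
      ∑ (splits outside (x ∷ w)) (λ b → growths outside b f) ∎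
    ∑-insert {suc n} inside (x ∷ w) f = begin
      ∑ (allFin (2+ n)) (λ i → ∑ (splits inside (insertAt (Vec.map suc (x ∷ w)) i 0)) f)
        ≡⟨ ∑-allFin-suc (suc n) _ ⟩
      ∑ (splits inside (0 ∷ suc x ∷ Vec.map suc w)) f ⊹
      ∑ (allFin (suc n)) (λ i → ∑ (splits inside (suc x ∷ insertAt (Vec.map suc w) i 0)) f)
        ≈⟨ +-cong
             (≈-trans (splits-letter 0 (suc x ∷ Vec.map suc w) f)
             (≈-trans (splits-letter (suc x) (Vec.map suc w) _)
                      (∑-splits-suc inside w _)))
             (≈-trans (∑-cong (allFin (suc n)) λ i → splits-letter (suc x) (insertAt (Vec.map suc w) i 0) f)
                      (∑-insert inside w (λ b → f (suc x ∷ b) ⊹ f (sep (suc x ∷ b))))) ⟩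
      ∑ (splits inside w) (λ b → (f (0 ∷ suc x ∷ ↑ b) ⊹ f (sep (0 ∷ suc x ∷ ↑ b))) ⊹
                                 (f (0 ∷ sep (suc x ∷ ↑ b)) ⊹ f (sep (0 ∷ sep (suc x ∷ ↑ b))))) ⊹
      ∑ (splits inside w) (λ b → growths inside b (λ s → f (suc x ∷ s) ⊹ f (sep (suc x ∷ s))))
        ≈⟨ ∑-distrib-+ (splits inside w) _ _ ⟨
      ∑ (splits inside w) (λ b → ((f (0 ∷ suc x ∷ ↑ b) ⊹ f (sep (0 ∷ suc x ∷ ↑ b))) ⊹
                                  (f (0 ∷ sep (suc x ∷ ↑ b)) ⊹ f (sep (0 ∷ sep (suc x ∷ ↑ b))))) ⊹
                                 growths inside b (λ s → f (suc x ∷ s) ⊹ f (sep (suc x ∷ s))))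
        -- With 0 directly before x there are four ways to cut around it. All of them grow from the
        -- cutting that has a separator before x: there 0 becomes a valley, a double descent, a
        -- double ascent or a peak.
        ≈⟨ ∑-cong (splits inside w) regroup ⟩
      ∑ (splits inside w) (λ b → growths inside (x ∷ b) f ⊹ growths inside (sep (x ∷ b)) f)
        ≈⟨ splits-letter x w (λ b → growths inside b f) ⟨
      ∑ (splits inside (x ∷ w)) (λ b → growths inside b f) ∎
      where
      regroup : ∀ b → ((f (0 ∷ suc x ∷ ↑ b) ⊹ f (sep (0 ∷ suc x ∷ ↑ b))) ⊹
                       (f (0 ∷ sep (suc x ∷ ↑ b)) ⊹ f (sep (0 ∷ sep (suc x ∷ ↑ b))))) ⊹
                      growths inside b (λ s → f (suc x ∷ s) ⊹ f (sep (suc x ∷ s))) ≈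
                      growths inside (x ∷ b) f ⊹ growths inside (sep (x ∷ b)) f
      regroup b = begin
        _ ≈⟨ +-congˡ (growths-+ inside b _ _) ⟩
        _ ≈⟨ solve 6 (λ a a′ d d′ g g′ → ((a :+ a′) :+ (d :+ d′)) :+ (g :+ g′) :=
            g :+ ((a :+ d) :+ ((a′ :+ d′) :+ g′))) ≈-refl _ _ _ _ _ _ ⟩
        growths inside b (λ s → f (suc x ∷ s)) ⊹
        ((f (0 ∷ suc x ∷ ↑ b) ⊹ f (0 ∷ sep (suc x ∷ ↑ b))) ⊹
         ((f (sep (0 ∷ suc x ∷ ↑ b)) ⊹ f (sep (0 ∷ sep (suc x ∷ ↑ b)))) ⊹
             growths inside b (λ s → f (sep (suc x ∷ s)))))
          ≈⟨ +-cong (growths-letter x b f) (≈-trans (growths-sep x b f) (+-congˡ (growths-front x b (f ∘ sep)))) ⟨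
        growths inside (x ∷ b) f ⊹ growths inside (sep (x ∷ b)) f ∎

-- Statistics of block sequences and their change under growth

module BlockStatistics where

  open import Data.Bool using (Bool; true; false) renaming (_∧_ to infixr 3 _∧_)
  open import Data.List as List using (List; []; _∷_)
  open import Data.List.Relation.Unary.All as All using (All; []; _∷_)
  import Data.List.Relation.Unary.All.Properties as All
  open import Data.Nat
  open import Data.Nat.Properties
  open import Data.Product using (_×_; _,_)
  open import Data.Nat.Tactic.RingSolver using (solve-∀)
  open import Relation.Binary.PropositionalEquality using (_≡_; refl; sym; trans; cong; cong₂)
  open BlockSequences

  private variable p : Place

  𝟙 : Bool → ℕ
  𝟙 true  = 1
  𝟙 false = 0

  -- In the statistics below a letter x has height suc x and a separator has
  -- height 0; the argument a is the height of the preceding element.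

  height : Blocks p → ℕ
  height end     = 0
  height (x ∷ _) = suc x
  height (sep _) = 0

  seps : Blocks p → ℕ
  seps end     = 0
  seps (x ∷ w) = seps w
  seps (sep w) = suc (seps w)

  -- The letters that can play the 2 of a pattern 31-2 whose adjacent pair has heights a and b.
  between : ℕ → ℕ → Blocks p → ℕ
  between a b end     = 0
  between a b (x ∷ w) = 𝟙 (suc x <ᵇ a ∧ b <ᵇ suc x) + between a b w
  between a b (sep w) = between a b w

  -- The adjacent pairs that can play the 13 for a 2 of height l.
  ascentsAcross : ℕ → ℕ → Blocks p → ℕ
  ascentsAcross l a end     = 0
  ascentsAcross l a (x ∷ w) = 𝟙 (l <ᵇ suc x ∧ a <ᵇ l) + ascentsAcross l (suc x) w
  ascentsAcross l a (sep w) = ascentsAcross l 0 w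

  -- (31-2) + 2 (2-13), with separators allowed in the role of 1.
  patterns : ℕ → Blocks p → ℕ
  patterns a end     = 0
  patterns a (x ∷ w) = between a (suc x) w + 2 * ascentsAcross (suc x) (suc x) w + patterns (suc x) w
  patterns a (sep w) = between a 0 w + patterns 0 w

  valleyCount : ℕ → Blocks p → ℕ
  valleyCount a end     = 0
  valleyCount a (x ∷ w) = 𝟙 (suc x <ᵇ a ∧ suc x <ᵇ height w) + valleyCount (suc x) w
  valleyCount a (sep w) = valleyCount 0 w

  doubleDescentCount : ℕ → Blocks p → ℕ
  doubleDescentCount a end     = 0
  doubleDescentCount a (x ∷ w) = 𝟙 (suc x <ᵇ a ∧ height w <ᵇ suc x) + doubleDescentCount (suc x) w
  doubleDescentCount a (sep w) = doubleDescentCount 0 w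

  -- The effect of `↑` on heights: separators stay at 0, which frees height 1 for the new letter.
  raise : ℕ → ℕ
  raise zero    = zero
  raise (suc a) = suc (suc a)

  -- Outside the blocks the preceding element is a separator or the boundary.
  context : Place → ℕ → ℕ
  context outside a = 0
  context inside  a = suc a

  <ᵇ-raise : ∀ a b → (raise a <ᵇ raise b) ≡ (a <ᵇ b)
  <ᵇ-raise zero    zero    = refl
  <ᵇ-raise zero    (suc b) = refl
  <ᵇ-raise (suc a) zero    = refl
  <ᵇ-raise (suc a) (suc b) = refl

  height-↑ : ∀ (w : Blocks p) → height (↑ w) ≡ raise (height w)
  height-↑ end     = refl
  height-↑ (x ∷ w) = refl
  height-↑ (sep w) = refl

  seps-↑ : ∀ (w : Blocks p) → seps (↑ w) ≡ seps w
  seps-↑ end     = refl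
  seps-↑ (x ∷ w) = seps-↑ w
  seps-↑ (sep w) = cong suc (seps-↑ w)

  between-↑ : ∀ a b (w : Blocks p) → between (raise a) (raise b) (↑ w) ≡ between a b w
  between-↑ a b end     = refl
  between-↑ a b (x ∷ w) = cong₂ _+_ (cong₂ (λ u v → 𝟙 (u ∧ v)) (<ᵇ-raise (suc x) a) (<ᵇ-raise b (suc x)))
      (between-↑ a b w)
  between-↑ a b (sep w) = between-↑ a b w

  between-↑-1 : ∀ a (w : Blocks p) → between (suc a) 1 (↑ w) ≡ between a 0 w
  between-↑-1 a end     = refl
  between-↑-1 a (x ∷ w) = cong (𝟙 (suc x <ᵇ a ∧ true) +_) (between-↑-1 a w)
  between-↑-1 a (sep w) = between-↑-1 a w

  between-low : ∀ {a} → a ≤ 1 → ∀ b (w : Blocks p) → between a b w ≡ 0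
  between-low a≤1       b end     = refl
  between-low z≤n       b (x ∷ w) = between-low z≤n b w
  between-low (s≤s z≤n) b (x ∷ w) = between-low (s≤s z≤n) b w
  between-low a≤1       b (sep w) = between-low a≤1 b w

  ascentsAcross-↑ : ∀ l a (w : Blocks p) → ascentsAcross (suc (suc l)) (raise a) (↑ w) ≡ ascentsAcross (suc l) a w
  ascentsAcross-↑ l a end     = refl
  ascentsAcross-↑ l a (x ∷ w) = cong₂ _+_ (cong (λ u → 𝟙 (suc l <ᵇ suc x ∧ u)) (<ᵇ-raise a (suc l)))
      (ascentsAcross-↑ l (suc x) w)
  ascentsAcross-↑ l a (sep w) = ascentsAcross-↑ l 0 w

  patterns-↑ : ∀ a (w : Blocks p) → patterns (raise a) (↑ w) ≡ patterns a w
  patterns-↑ a end     = refl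
  patterns-↑ a (x ∷ w) = cong₂ _+_
      (cong₂ (λ u v → u + 2 * v) (between-↑ a (suc x) w) (ascentsAcross-↑ x (suc x) w)) (patterns-↑ (suc x) w)
  patterns-↑ a (sep w) = cong₂ _+_ (between-↑ a 0 w) (patterns-↑ 0 w)

  valleyCount-↑ : ∀ a (w : Blocks p) → valleyCount (raise a) (↑ w) ≡ valleyCount a w
  valleyCount-↑ a end     = refl
  valleyCount-↑ a (x ∷ w) = cong₂ _+_
    (cong₂ (λ u v → 𝟙 (u ∧ v)) (<ᵇ-raise (suc x) a)
        (trans (cong (suc (suc x) <ᵇ_) (height-↑ w)) (<ᵇ-raise (suc x) (height w))))
    (valleyCount-↑ (suc x) w)
  valleyCount-↑ a (sep w) = valleyCount-↑ 0 w

  doubleDescentCount-↑ : ∀ a (w : Blocks p) → doubleDescentCount (raise a) (↑ w) ≡ doubleDescentCount a w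
  doubleDescentCount-↑ a end     = refl
  doubleDescentCount-↑ a (x ∷ w) = cong₂ _+_
    (cong₂ (λ u v → 𝟙 (u ∧ v)) (<ᵇ-raise (suc x) a)
        (trans (cong (_<ᵇ suc (suc x)) (height-↑ w)) (<ᵇ-raise (height w) (suc x))))
    (doubleDescentCount-↑ (suc x) w)
  doubleDescentCount-↑ a (sep w) = doubleDescentCount-↑ 0 w

  private
    x+[y+z] : ∀ x y z → x + (y + z) ≡ y + (x + z)
    x+[y+z] = solve-∀

  -- Wherever it is put, the new letter has height 1. It lies between the bounds exactly when the
  -- upper one belongs to a letter and the lower one to a separator.
  between-grow : ∀ κ p a b w → All
      (λ s → between (raise a) (raise b) s ≡ 𝟙 (1 <ᵇ raise a ∧ raise b <ᵇ 1) + between a b w) (grow κ p w)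
  between-grow peak          outside a b end = refl ∷ []
  between-grow doubleAscent  outside a b end = []
  between-grow valley        outside a b end = []
  between-grow doubleDescent outside a b end = []
  between-grow κ outside a b (x ∷ w) = All.++⁺ (front κ)
      (All.map⁺ (All.map (λ {s} → step {s}) (between-grow κ inside a b w)))
    where
    δ = 𝟙 (1 <ᵇ raise a ∧ raise b <ᵇ 1)
    front : ∀ κ → All (λ s → between (raise a) (raise b) s ≡ δ + between a b (_∷_ {p = outside} x w))
        (growFront κ x w)
    front peak          = cong (δ +_) (between-↑ a b (_∷_ {p = outside} x w)) ∷ []
    front doubleAscent  = cong (δ +_) (between-↑ a b (_∷_ {p = outside} x w)) ∷ []
    front valley        = []
    front doubleDescent = []
    step : ∀ {s} → between (raise a) (raise b) s ≡ δ + between a b w →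
        between (raise a) (raise b) (_∷_ {p = outside} (suc x) s) ≡ δ + between a b (_∷_ {p = outside} x w)
    step e = trans (cong₂ _+_ (cong₂ (λ u v → 𝟙 (u ∧ v)) (<ᵇ-raise (suc x) a) (<ᵇ-raise b (suc x))) e)
        (x+[y+z] (𝟙 (suc x <ᵇ a ∧ b <ᵇ suc x)) δ (between a b w))
  between-grow κ inside a b (x ∷ w) = All.map⁺ (All.map (λ {s} → step {s}) (between-grow κ inside a b w))
    where
    δ = 𝟙 (1 <ᵇ raise a ∧ raise b <ᵇ 1)
    step : ∀ {s} → between (raise a) (raise b) s ≡ δ + between a b w →
        between (raise a) (raise b) (_∷_ {p = inside} (suc x) s) ≡ δ + between a b (_∷_ {p = inside} x w)
    step e = trans (cong₂ _+_ (cong₂ (λ u v → 𝟙 (u ∧ v)) (<ᵇ-raise (suc x) a) (<ᵇ-raise b (suc x))) e)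
        (x+[y+z] (𝟙 (suc x <ᵇ a ∧ b <ᵇ suc x)) δ (between a b w))
  between-grow κ inside a b (sep w) = All.++⁺ (atSep κ w) (All.map⁺ (between-grow κ outside a b w))
    where
    δ = 𝟙 (1 <ᵇ raise a ∧ raise b <ᵇ 1)
    atSep : ∀ κ w → All (λ s → between (raise a) (raise b) s ≡ δ + between a b w) (growAtSep κ w)
    atSep valley        end     = []
    atSep valley        (x ∷ w) = cong (δ +_) (between-↑ a b (_∷_ {p = inside} x w)) ∷ []
    atSep doubleDescent w       = cong (δ +_) (between-↑ a b w) ∷ []
    atSep peak          w       = []
    atSep doubleAscent  w       = []

  -- The new letter is placed beside a separator or replaces one. Both lie below the level, so the
  -- crossings are the same as before.
  ascentsAcross-grow : ∀ κ p a l w →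
    All (λ s → ascentsAcross (suc (suc l)) (raise (context p a)) s ≡ ascentsAcross (suc l) (context p a) w)
        (grow κ p w)
  ascentsAcross-grow peak          outside a l end = refl ∷ []
  ascentsAcross-grow doubleAscent  outside a l end = []
  ascentsAcross-grow valley        outside a l end = []
  ascentsAcross-grow doubleDescent outside a l end = []
  ascentsAcross-grow κ outside a l (x ∷ w) =
    All.++⁺ (front κ) (All.map⁺ (All.map (cong (𝟙 (suc l <ᵇ suc x ∧ true) +_)) (ascentsAcross-grow κ inside x l w)))
    where
    front : ∀ κ → All (λ s → ascentsAcross (suc (suc l)) 0 s ≡ ascentsAcross (suc l) 0 (_∷_ {p = outside} x w))
        (growFront κ x w)
    front peak          = ascentsAcross-↑ l 0 (_∷_ {p = outside} x w) ∷ []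
    front doubleAscent  = ascentsAcross-↑ l 0 (_∷_ {p = outside} x w) ∷ []
    front valley        = []
    front doubleDescent = []
  ascentsAcross-grow κ inside a l (x ∷ w) =
    All.map⁺ (All.map (cong (𝟙 (suc l <ᵇ suc x ∧ suc a <ᵇ suc l) +_)) (ascentsAcross-grow κ inside x l w))
  ascentsAcross-grow κ inside a l (sep w) =
    All.++⁺ (atSep κ w) (All.map⁺ (ascentsAcross-grow κ outside a l w))
    where
    atSep : ∀ κ w → All (λ s → ascentsAcross (suc (suc l)) (suc (suc a)) s ≡ ascentsAcross (suc l) 0 w)
        (growAtSep κ w)
    atSep valley        end     = []
    atSep valley        (x ∷ w) = ascentsAcross-↑ l 0 (_∷_ {p = inside} x w) ∷ []
    atSep doubleDescent w       = ascentsAcross-↑ l 0 w ∷ []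
    atSep peak          w       = []
    atSep doubleAscent  w       = []

  -- `pred` covers both kinds of head: a letter has been raised by one, and a separator of height 0
  -- either stays or gives way to the new letter of height 1. Comparisons with a letter in front are
  -- therefore unaffected.
  height-grow : ∀ κ w → All (λ s → pred (height s) ≡ height w) (grow κ inside w)
  height-grow κ (x ∷ w) = All.map⁺ (All.universal (λ _ → refl) (grow κ inside w))
  height-grow κ (sep w) = All.++⁺ (atSep κ w) (All.map⁺ (All.universal (λ _ → refl) (grow κ outside w)))
    where
    atSep : ∀ κ w → All (λ s → pred (height s) ≡ 0) (growAtSep κ w)
    atSep valley        end     = []
    atSep valley        (x ∷ w) = refl ∷ []
    atSep doubleDescent w       = refl ∷ []
    atSep peak          w       = []
    atSep doubleAscent  w       = []

  suc-<ᵇ-pred : ∀ x a → (suc (suc x) <ᵇ a) ≡ (suc x <ᵇ pred a)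
  suc-<ᵇ-pred x zero    = refl
  suc-<ᵇ-pred x (suc a) = refl

  pred-<ᵇ-suc : ∀ x a → (a <ᵇ suc (suc x)) ≡ (pred a <ᵇ suc x)
  pred-<ᵇ-suc x zero    = refl
  pred-<ᵇ-suc x (suc a) = refl

  newValleys newDoubleDescents : Kind → ℕ
  newValleys valley = 1
  newValleys _      = 0
  newDoubleDescents doubleDescent = 1
  newDoubleDescents _             = 0

  -- An old letter may find the new letter where it had a separator for a neighbour, but both are
  -- lower than itself. So old letters keep their kinds, and only the new one adds to the count.
  valleyCount-grow : ∀ κ p a w →
    All (λ s → valleyCount (raise (context p a)) s ≡ newValleys κ + valleyCount (context p a) w) (grow κ p w)
  valleyCount-grow peak          outside a end = refl ∷ []
  valleyCount-grow doubleAscent  outside a end = []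
  valleyCount-grow valley        outside a end = []
  valleyCount-grow doubleDescent outside a end = []
  valleyCount-grow κ outside a (x ∷ w) = All.++⁺ (front κ) (All.map⁺ (valleyCount-grow κ inside x w))
    where
    front : ∀ κ → All (λ s → valleyCount 0 s ≡ newValleys κ + valleyCount 0 (_∷_ {p = outside} x w)) (growFront κ x w)
    front peak          = valleyCount-↑ 0 (_∷_ {p = outside} x w) ∷ []
    front doubleAscent  = valleyCount-↑ 0 (_∷_ {p = outside} x w) ∷ []
    front valley        = []
    front doubleDescent = []
  valleyCount-grow κ inside a (x ∷ w) = All.map⁺
      (All.zipWith (λ {s} → step {s}) (height-grow κ w , valleyCount-grow κ inside x w))
    where
    v = 𝟙 (suc x <ᵇ suc a ∧ suc x <ᵇ height w)
    step : ∀ {s} → pred (height s) ≡ height w × valleyCount (suc (suc x)) s ≡ newValleys κ + valleyCount (suc x) w →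
           valleyCount (suc (suc a)) (_∷_ {p = inside} (suc x) s) ≡ newValleys κ +
               valleyCount (suc a) (_∷_ {p = inside} x w)
    step {s} (h , e) = trans
      (cong₂ (λ u v → 𝟙 (suc x <ᵇ suc a ∧ u) + v) (trans (suc-<ᵇ-pred x (height s)) (cong (suc x <ᵇ_) h)) e)
      (x+[y+z] v (newValleys κ) _)
  valleyCount-grow κ inside a (sep w) = All.++⁺ (atSep κ w) (All.map⁺ (valleyCount-grow κ outside a w))
    where
    atSep : ∀ κ w → All (λ s → valleyCount (suc (suc a)) s ≡ newValleys κ + valleyCount 0 w) (growAtSep κ w)
    atSep valley        end     = []
    atSep valley        (x ∷ w) = cong suc (valleyCount-↑ 0 (_∷_ {p = inside} x w)) ∷ []
    atSep doubleDescent w       = valleyCount-↑ 0 w ∷ []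
    atSep peak          w       = []
    atSep doubleAscent  w       = []

  doubleDescentCount-grow : ∀ κ p a w →
    All (λ s → doubleDescentCount (raise (context p a)) s ≡ newDoubleDescents κ +
        doubleDescentCount (context p a) w) (grow κ p w)
  doubleDescentCount-grow peak          outside a end = refl ∷ []
  doubleDescentCount-grow doubleAscent  outside a end = []
  doubleDescentCount-grow valley        outside a end = []
  doubleDescentCount-grow doubleDescent outside a end = []
  doubleDescentCount-grow κ outside a (x ∷ w) = All.++⁺ (front κ) (All.map⁺ (doubleDescentCount-grow κ inside x w))
    where
    front : ∀ κ → All (λ s → doubleDescentCount 0 s ≡ newDoubleDescents κ +
        doubleDescentCount 0 (_∷_ {p = outside} x w)) (growFront κ x w)
    front peak          = doubleDescentCount-↑ 0 (_∷_ {p = outside} x w) ∷ []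
    front doubleAscent  = doubleDescentCount-↑ 0 (_∷_ {p = outside} x w) ∷ []
    front valley        = []
    front doubleDescent = []
  doubleDescentCount-grow κ inside a (x ∷ w) = All.map⁺
      (All.zipWith (λ {s} → step {s}) (height-grow κ w , doubleDescentCount-grow κ inside x w))
    where
    d = 𝟙 (suc x <ᵇ suc a ∧ height w <ᵇ suc x)
    step : ∀ {s} → pred (height s) ≡ height w × doubleDescentCount (suc (suc x)) s ≡ newDoubleDescents κ +
        doubleDescentCount (suc x) w →
           doubleDescentCount (suc (suc a)) (_∷_ {p = inside} (suc x) s) ≡ newDoubleDescents κ +
               doubleDescentCount (suc a) (_∷_ {p = inside} x w)
    step {s} (h , e) = trans
      (cong₂ (λ u v → 𝟙 (suc x <ᵇ suc a ∧ u) + v) (trans (pred-<ᵇ-suc x (height s)) (cong (_<ᵇ suc x) h)) e)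
      (x+[y+z] d (newDoubleDescents κ) _)
  doubleDescentCount-grow κ inside a (sep w) = All.++⁺ (atSep κ w) (All.map⁺ (doubleDescentCount-grow κ outside a w))
    where
    atSep : ∀ κ w → All (λ s → doubleDescentCount (suc (suc a)) s ≡ newDoubleDescents κ +
        doubleDescentCount 0 w) (growAtSep κ w)
    atSep valley        end     = []
    atSep valley        (x ∷ w) = doubleDescentCount-↑ 0 (_∷_ {p = inside} x w) ∷ []
    atSep doubleDescent w       = cong suc (doubleDescentCount-↑ 0 w) ∷ []
    atSep peak          w       = []
    atSep doubleAscent  w       = []

  -- The change in the number of blocks is kept as two natural numbers, so that it can be stated
  -- without subtraction.
  lostSeps gainedSeps : Kind → ℕ
  lostSeps valley = 1
  lostSeps _      = 0
  gainedSeps peak = 1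
  gainedSeps _    = 0

  seps-grow : ∀ κ p w → All (λ s → lostSeps κ + seps s ≡ gainedSeps κ + seps w) (grow κ p w)
  seps-grow peak          outside end = refl ∷ []
  seps-grow doubleAscent  outside end = []
  seps-grow valley        outside end = []
  seps-grow doubleDescent outside end = []
  seps-grow κ outside (x ∷ w) = All.++⁺ (front κ) (All.map⁺ (seps-grow κ inside w))
    where
    front : ∀ κ → All (λ s → lostSeps κ + seps s ≡ gainedSeps κ + seps w) (growFront κ x w)
    front peak          = cong suc (seps-↑ w) ∷ []
    front doubleAscent  = seps-↑ w ∷ []
    front valley        = []
    front doubleDescent = []
  seps-grow κ inside (x ∷ w) = All.map⁺ (seps-grow κ inside w)
  seps-grow κ inside (sep w) = All.++⁺ (atSep κ w) (All.map⁺ (All.map (λ {s} → step {s}) (seps-grow κ outside w)))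
    where
    atSep : ∀ κ w → All (λ s → lostSeps κ + seps s ≡ gainedSeps κ + suc (seps w)) (growAtSep κ w)
    atSep valley        end     = []
    atSep valley        (x ∷ w) = cong suc (seps-↑ w) ∷ []
    atSep doubleDescent w       = cong suc (seps-↑ w) ∷ []
    atSep peak          w       = []
    atSep doubleAscent  w       = []
    step : ∀ {s} → lostSeps κ + seps s ≡ gainedSeps κ + seps w → lostSeps κ + suc (seps s) ≡ gainedSeps κ +
        suc (seps w)
    step {s} e = trans (+-suc (lostSeps κ) (seps s)) (trans (cong suc e) (sym (+-suc (gainedSeps κ) (seps w))))

-- Patterns gained by a new smallest letter

module PatternGains where

  open import Data.Bool using (Bool; false) renaming (_∧_ to infixr 3 _∧_)
  open import Data.List as List using (List; []; _∷_)
  open import Data.List.Properties using (map-∘; map-cong; map-cong-local)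
  open import Data.List.Relation.Unary.All as All using (All; []; _∷_)
  open import Data.Nat
  open import Data.Nat.Properties
  open import Data.Nat.Tactic.RingSolver using (solve-∀)
  open import Data.Product using (_×_; _,_)
  open import Relation.Binary.PropositionalEquality using (_≡_; refl; sym; trans; cong; cong₂; module ≡-Reasoning)
  open BlockSequences
  open BlockStatistics

  private variable p : Place

  -- The (31-2) + 2 (2-13) patterns gained by a new smallest letter playing 2
  -- in one of m blocks, from left to right: i + 2 (m - 1 - i) for i < m.
  gains : ℕ → List ℕ
  gains zero    = []
  gains (suc m) = 2 * m ∷ List.map suc (gains m)

  -- Level 1 is crossed upwards exactly at the start of each block, and in the
  -- second case the current block has already started.
  ascentsAcross-1-outside : ∀ (w : Blocks outside) → ascentsAcross 1 0 (↑ w) ≡ seps w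
  ascentsAcross-1-inside  : ∀ a (w : Blocks inside) → suc (ascentsAcross 1 (suc a) (↑ w)) ≡ seps w
  ascentsAcross-1-outside end     = refl
  ascentsAcross-1-outside (x ∷ w) = ascentsAcross-1-inside (suc x) w
  ascentsAcross-1-inside a (x ∷ w) = ascentsAcross-1-inside (suc x) w
  ascentsAcross-1-inside a (sep w) = cong suc (ascentsAcross-1-outside w)

  patterns-1 : ∀ (w : Blocks p) → patterns 1 w ≡ patterns 0 w
  patterns-1 end     = refl
  patterns-1 (x ∷ w) = cong (λ u → u + 2 * ascentsAcross (suc x) (suc x) w + patterns (suc x) w)
    (trans (between-low (s≤s z≤n) (suc x) w) (sym (between-low z≤n (suc x) w)))
  patterns-1 (sep w) = cong (_+ patterns 0 w) (trans (between-low (s≤s z≤n) 0 w) (sym (between-low z≤n 0 w)))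

  -- With m blocks ahead there are m + 1 gaps for a peak, m block fronts for a double ascent and m -
  -- 1 inner separators for a valley. When reading starts inside a block, its front has passed, and
  -- the remaining places for a peak or a double ascent lie beyond its closing separator. That
  -- descent to the separator acts as the 31 for the new letter, hence the `suc`.
  newGains : Kind → Place → ℕ → List ℕ
  newGains peak         outside m = gains (suc m)
  newGains peak         inside  m = List.map suc (gains m)
  newGains doubleAscent outside m = gains m
  newGains doubleAscent inside  m = List.map suc (gains (pred m))
  newGains _            _       m = gains (pred m)

  data PreservesDescents : Kind → Set where
    peak         : PreservesDescents peak
    doubleAscent : PreservesDescents doubleAscent
    valley       : PreservesDescents valley

  -- The lists agree entry by entry because `grow` and `gains` both run from left to right. A
  -- separator ending a block before the new letter gives one 31-2, and every later block gives one
  -- 2-13 by the ascent that enters it.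
  patterns-grow : ∀ {κ} → PreservesDescents κ → ∀ p a w →
    List.map (patterns (raise (context p a))) (grow κ p w) ≡
    List.map (patterns (context p a) w +_) (newGains κ p (seps w))
  patterns-grow-letter : ∀ {κ} → PreservesDescents κ → ∀ p a x w →
    List.map (λ s → patterns (raise (context p a)) (_∷_ {p = p} (suc x) s)) (grow κ inside w) ≡
    List.map (patterns (context p a) (_∷_ {p = p} x w) +_) (newGains κ inside (seps w))
  patterns-grow-sep : ∀ {κ} → PreservesDescents κ → ∀ a w →
    List.map (λ s → patterns (suc (suc a)) (sep s)) (grow κ outside w) ≡
    List.map (patterns (suc a) (sep w) +_) (List.map suc (newGains κ outside (seps w)))

  patterns-grow-letter {κ} κ! p a x w = begin
    List.map (λ s → patterns (raise (context p a)) (_∷_ {p = p} (suc x) s)) (grow κ inside w)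
      ≡⟨ map-cong-local (All.zipWith (λ {s} → step {s}) (between-grow κ inside (context p a) (suc x) w ,
          ascentsAcross-grow κ inside x x w)) ⟩
    List.map (λ s → K + patterns (suc (suc x)) s) (grow κ inside w)
      ≡⟨ map-∘ (grow κ inside w) ⟩
    List.map (K +_) (List.map (patterns (suc (suc x))) (grow κ inside w))
      ≡⟨ cong (List.map (K +_)) (patterns-grow κ! inside x w) ⟩
    List.map (K +_) (List.map (patterns (suc x) w +_) new)
      ≡⟨ map-∘ new ⟨
    List.map (λ i → K + (patterns (suc x) w + i)) new
      ≡⟨ map-cong (λ i → sym (+-assoc K (patterns (suc x) w) i)) new ⟩
    List.map (patterns (context p a) (_∷_ {p = p} x w) +_) new ∎
    where
    open ≡-Reasoning
    K   = between (context p a) (suc x) w + 2 * ascentsAcross (suc x) (suc x) w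
    new = newGains κ inside (seps w)

    -- The new letter is below x, so it is never the 2 of a 31-2 whose 1 is x.
    no-1 : ∀ p → (1 <ᵇ raise (context p a) ∧ false) ≡ false
    no-1 outside = refl
    no-1 inside  = refl

    step : ∀ {s} →
      between (raise (context p a)) (suc (suc x)) s ≡ 𝟙 (1 <ᵇ raise (context p a) ∧ false) +
          between (context p a) (suc x) w ×
      ascentsAcross (suc (suc x)) (suc (suc x)) s ≡ ascentsAcross (suc x) (suc x) w →
      patterns (raise (context p a)) (_∷_ {p = p} (suc x) s) ≡ K + patterns (suc (suc x)) s
    step {s} (e , f) = cong₂ (λ u v → u + 2 * v + patterns (suc (suc x)) s)
      (trans e (cong (λ b → 𝟙 b + between (context p a) (suc x) w) (no-1 p))) f

  patterns-grow-sep {κ} κ! a w = begin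
    List.map (λ s → patterns (suc (suc a)) (sep s)) (grow κ outside w)
      -- The `suc` in `suc B` is the pattern 31-2 formed by the letter before this separator, the
      -- separator and the new letter.
      ≡⟨ map-cong-local (All.map (λ {s} → cong (_+ patterns 0 s)) (between-grow κ outside (suc a) 0 w)) ⟩
    List.map (λ s → suc B + patterns 0 s) (grow κ outside w)
      ≡⟨ map-∘ (grow κ outside w) ⟩
    List.map (suc B +_) (List.map (patterns 0) (grow κ outside w))
      ≡⟨ cong (List.map (suc B +_)) (patterns-grow κ! outside 0 w) ⟩
    List.map (suc B +_) (List.map (patterns 0 w +_) new)
      ≡⟨ map-∘ new ⟨
    List.map (λ i → suc B + (patterns 0 w + i)) new
      ≡⟨ map-cong (λ i → regroup B (patterns 0 w) i) new ⟩
    List.map (λ i → patterns (suc a) (sep w) + suc i) new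
      ≡⟨ map-∘ new ⟩
    List.map (patterns (suc a) (sep w) +_) (List.map suc new) ∎
    where
    open ≡-Reasoning
    B   = between (suc a) 0 w
    new = newGains κ outside (seps w)
    regroup : ∀ b c i → suc b + (c + i) ≡ b + c + suc i
    regroup = solve-∀

  private
    patterns-new : ∀ (w : Blocks p) → patterns 1 (↑ w) ≡ patterns 0 w
    patterns-new w = trans (patterns-1 (↑ w)) (patterns-↑ 0 w)

  patterns-grow peak         outside a end     = refl
  patterns-grow doubleAscent outside a end     = refl
  patterns-grow valley       outside a end     = refl
  patterns-grow peak         outside a (x ∷ w) = cong₂ _∷_ (begin
      -- As a 2 the new letter has one 13 for each later block. The adjacent heights 0, 1 and 1, 0
      -- around it admit no letter strictly between them.
      between 0 1 v + 2 * ascentsAcross 1 0 v + (between 1 0 v + patterns 0 v)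
        ≡⟨ cong₂ (λ b n → b + 2 * n + (between 1 0 v + patterns 0 v)) (between-low z≤n 1 v)
            (ascentsAcross-1-outside (x ∷ w)) ⟩
      2 * seps w + (between 1 0 v + patterns 0 v)
        ≡⟨ cong₂ (λ b n → 2 * seps w + (b + n)) (between-low ≤-refl 0 v) (patterns-↑ 0 (_∷_ {p = outside} x w)) ⟩
      2 * seps w + patterns 0 (_∷_ {p = outside} x w)
        ≡⟨ +-comm (2 * seps w) _ ⟩
      patterns 0 (_∷_ {p = outside} x w) + 2 * seps w ∎)
    (trans (sym (map-∘ (grow peak inside w))) (patterns-grow-letter peak outside 0 x w))
    where
    open ≡-Reasoning
    v = _∷_ {p = outside} (suc x) (↑ w)
  patterns-grow doubleAscent outside a (x ∷ w)
    -- Matching turns `seps w` into `suc m`, the block being opened together with the m later ones,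
    -- so that `gains (seps w)` unfolds to `2 * m` and a tail.
    with seps w | ascentsAcross-1-inside (suc x) w | patterns-grow-letter doubleAscent outside 0 x w
  ... | _ | refl | rest = cong₂ _∷_ (trans
      (cong₂ (λ b c → b + 2 * m + c) (between-low z≤n 1 v) (patterns-new (_∷_ {p = outside} x w)))
      (+-comm (2 * m) _))
    (trans (sym (map-∘ (grow doubleAscent inside w))) rest)
    where
    v = _∷_ {p = outside} (suc x) (↑ w)
    m = ascentsAcross 1 (suc (suc x)) (↑ w)
  patterns-grow valley       outside a (x ∷ w) = trans (sym (map-∘ (grow valley inside w)))
      (patterns-grow-letter valley outside 0 x w)
  patterns-grow peak         inside  a (x ∷ w) = trans (sym (map-∘ (grow peak inside w)))
      (patterns-grow-letter peak inside a x w)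
  patterns-grow doubleAscent inside  a (x ∷ w) = trans (sym (map-∘ (grow doubleAscent inside w)))
      (patterns-grow-letter doubleAscent inside a x w)
  patterns-grow valley       inside  a (x ∷ w) = trans (sym (map-∘ (grow valley inside w)))
      (patterns-grow-letter valley inside a x w)
  patterns-grow peak         inside  a (sep w) = trans (sym (map-∘ (grow peak outside w)))
      (patterns-grow-sep peak a w)
  patterns-grow doubleAscent inside  a (sep w) = trans (sym (map-∘ (grow doubleAscent outside w)))
      (patterns-grow-sep doubleAscent a w)
  patterns-grow valley       inside  a (sep end) = refl
  patterns-grow valley       inside  a (sep (x ∷ w))
    with seps w | ascentsAcross-1-inside (suc x) w | patterns-grow-sep valley a (x ∷ w)
  ... | _ | refl | rest = cong₂ _∷_ (trans
      -- The new letter takes over from the separator as the 1 of the patterns 31-2, with the same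
      -- letters above it to play 2.
      (cong₂ (λ b c → b + 2 * m + c) (between-↑-1 (suc a) (_∷_ {p = outside} x w))
          (patterns-new (_∷_ {p = outside} x w)))
      (regroup (between (suc a) 0 (_∷_ {p = outside} x w)) m _))
    (trans (sym (map-∘ (grow valley outside (x ∷ w)))) rest)
    where
    m = ascentsAcross 1 (suc (suc x)) (↑ w)
    regroup : ∀ b m c → b + 2 * m + c ≡ b + c + 2 * m
    regroup = solve-∀

-- Statistics of a permutation read off its single block

module OneLineWords where

  open import Data.Bool using (Bool) renaming (_∧_ to infixr 3 _∧_)
  open import Data.Fin as Fin using (Fin; zero; suc; toℕ; fromℕ<)
  open import Data.Fin.Properties using (toℕ-fromℕ<)
  open import Data.Nat
  open import Data.Nat.Properties
  open import Data.Nat.Tactic.RingSolver using (solve-∀)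
  open import Data.Product using (_×_; _,_; proj₁; proj₂)
  open import Data.Vec as Vec using (Vec; []; _∷_; lookup)
  open import Relation.Binary.PropositionalEquality using (_≡_; refl; sym; trans; cong; cong₂; subst; module ≡-Reasoning)
  open import Relation.Nullary using (Dec; does; yes; no; _×-dec_)
  open import Algebra.Properties.CommutativeMonoid.Sum +-0-commutativeMonoid using (sum; sum-cong-≗)
  open InversionsAndExcedances
  open BlockSequences
  open BlockStatistics

  private variable n : ℕ

  letters : Word n → Vec ℕ n
  letters = Vec.map toℕ

  -- The closing separator has height 0 and so realises the convention σ(n+1) = 0; the context 0 in
  -- front realises σ(0) = 0.
  oneBlock : Vec ℕ n → Blocks inside
  oneBlock []      = sep end
  oneBlock (x ∷ w) = x ∷ oneBlock w

  -- at w i is the height of the i-th letter of w (from 0), or 0 past the end;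
  -- at⁻ a w i is the height just before it, where a precedes the word.
  at  : Vec ℕ n → ℕ → ℕ
  at⁻ : ℕ → Vec ℕ n → ℕ → ℕ
  at []      i = 0
  at (x ∷ w) i = at⁻ (suc x) w i
  at⁻ a w zero    = a
  at⁻ a w (suc i) = at w i

  at-lookup : ∀ {m} (w : Vec (Fin n) m) i → at (Vec.map toℕ w) (toℕ i) ≡ suc (toℕ (lookup w i))
  at-lookup (x ∷ w) zero    = refl
  at-lookup (x ∷ w) (suc i) = at-lookup w i

  at-≥ : ∀ (w : Vec ℕ n) i → n ≤ i → at w i ≡ 0
  at-≥ []      i       _         = refl
  at-≥ (x ∷ w) (suc i) (s≤s n≤i) = at-≥ w i n≤i

  ⟨⟩-at : ∀ (σ : Word n) i → σ ⟨ i ⟩ ≡ at⁻ 0 (letters σ) i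
  ⟨⟩-at σ zero    = refl
  ⟨⟩-at {n} σ (suc i) with i <? n
  ... | yes i<n = trans (sym (at-lookup σ (fromℕ< i<n))) (cong (at (letters σ)) (toℕ-fromℕ< i<n))
  ... | no  i≮n = sym (at-≥ (letters σ) i (≮⇒≥ i≮n))

  ind≡𝟙 : ∀ {P : Set} (P? : Dec P) → ind P? ≡ 𝟙 (does P?)
  ind≡𝟙 (yes _) = refl
  ind≡𝟙 (no _)  = refl

  height-oneBlock : ∀ (w : Vec ℕ n) → height (oneBlock w) ≡ at w 0
  height-oneBlock []      = refl
  height-oneBlock (x ∷ w) = refl

  isValley? : ∀ a (w : Vec ℕ n) i → Dec (at w i < at⁻ a w i × at w i < at w (suc i))
  isValley? a w i = at w i <? at⁻ a w i ×-dec at w i <? at w (suc i)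

  isDoubleDescent? : ∀ a (w : Vec ℕ n) i → Dec (at w i < at⁻ a w i × at w (suc i) < at w i)
  isDoubleDescent? a w i = at w i <? at⁻ a w i ×-dec at w (suc i) <? at w i

  is31-2? : ∀ a (w : Vec ℕ n) i j → Dec (i < j × at w j < at⁻ a w i × at w i < at w j)
  is31-2? a w i j = i <? j ×-dec at w j <? at⁻ a w i ×-dec at w i <? at w j

  is2-13? : ∀ (w : Vec ℕ n) i j → Dec (i < j × at w i < at w (suc j) × at w j < at w i)
  is2-13? w i j = i <? j ×-dec at w i <? at w (suc j) ×-dec at w j <? at w i

  -- By the mutual recursion of `at` and `at⁻`, the summands after the first compute to those of w
  -- preceded by height `suc x`.
  sum-valleys : ∀ a (w : Vec ℕ n) → sum {n} (λ i → ind (isValley? a w (toℕ i))) ≡ valleyCount a (oneBlock w)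
  sum-valleys a []      = refl
  sum-valleys a (x ∷ w) = cong₂ _+_
    (trans (ind≡𝟙 (isValley? a (x ∷ w) 0)) (cong (λ h → 𝟙 (suc x <ᵇ a ∧ suc x <ᵇ h)) (sym (height-oneBlock w))))
    (sum-valleys (suc x) w)

  sum-doubleDescents : ∀ a (w : Vec ℕ n) → sum {n} (λ i → ind (isDoubleDescent? a w (toℕ i))) ≡
      doubleDescentCount a (oneBlock w)
  sum-doubleDescents a []      = refl
  sum-doubleDescents a (x ∷ w) = cong₂ _+_
    (trans (ind≡𝟙 (isDoubleDescent? a (x ∷ w) 0))
        (cong (λ h → 𝟙 (suc x <ᵇ a ∧ h <ᵇ suc x)) (sym (height-oneBlock w))))
    (sum-doubleDescents (suc x) w)

  sum-between : ∀ a b (w : Vec ℕ n) → sum {n} (λ j → ind (at w (toℕ j) <? a ×-dec b <? at w (toℕ j))) ≡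
      between a b (oneBlock w)
  sum-between a b []      = refl
  sum-between a b (x ∷ w) = cong₂ _+_ (ind≡𝟙 (suc x <? a ×-dec b <? suc x)) (sum-between a b w)

  sum-ascentsAcross : ∀ l a (w : Vec ℕ n) →
    𝟙 (l <ᵇ at w 0 ∧ a <ᵇ l) + sum {n} (λ j → ind (l <? at w (suc (toℕ j)) ×-dec at w (toℕ j) <? l)) ≡
        ascentsAcross l a (oneBlock w)
  sum-ascentsAcross l a []      = refl
  sum-ascentsAcross {suc n} l a (x ∷ w) = cong (𝟙 (l <ᵇ suc x ∧ a <ᵇ l) +_)
    (trans (cong (_+ sum {n} (λ j → ind (l <? at w (suc (toℕ j)) ×-dec at w (toℕ j) <? l)))
        (ind≡𝟙 (l <? at w 0 ×-dec suc x <? l)))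
           (sum-ascentsAcross l (suc x) w))

  -- An ascent that starts at height `suc x` does not cross the level `suc x`, so x is never the 1
  -- of its own pattern.
  sum-ascentsAcross-self : ∀ x (w : Vec ℕ n) →
    sum {n} (λ j → ind (suc x <? at w (suc (toℕ j)) ×-dec at w (toℕ j) <? suc x)) ≡
        ascentsAcross (suc x) (suc x) (oneBlock w)
  sum-ascentsAcross-self {n} x w = trans
    (cong (_+ sum {n} (λ j → ind (suc x <? at w (suc (toℕ j)) ×-dec at w (toℕ j) <? suc x)))
      (trans (sym (ind-no (suc x <? at w 0 ×-dec suc x <? suc x) (λ (_ , lt) → <-irrefl refl lt)))
          (ind≡𝟙 (suc x <? at w 0 ×-dec suc x <? suc x))))
    (sum-ascentsAcross (suc x) (suc x) w)

  sum31-2 : ∀ a (w : Vec ℕ n) → ℕ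
  sum31-2 {n} a w = sum {n} (λ i → sum {n} (λ j → ind (is31-2? a w (toℕ i) (toℕ j))))

  sum2-13 : Vec ℕ n → ℕ
  sum2-13 {n} w = sum {n} (λ i → sum {n} (λ j → ind (is2-13? w (toℕ i) (toℕ j))))

  sum31-2-∷ : ∀ a x (w : Vec ℕ n) → sum31-2 a (x ∷ w) ≡ between a (suc x) (oneBlock w) + sum31-2 (suc x) w
  sum31-2-∷ {n} a x w = cong₂ _+_
    (cong₂ _+_ (ind-no (is31-2? a (x ∷ w) 0 0) λ ())
      (trans (sum-cong-≗ {n} λ j → ind-⇔ (is31-2? a (x ∷ w) 0 (suc (toℕ j)))
          (at w (toℕ j) <? a ×-dec suc x <? at w (toℕ j))
               proj₂ (λ r → z<s , r))
             (sum-between a (suc x) w)))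
    (sum-cong-≗ {n} λ i → cong₂ _+_ (ind-no (is31-2? a (x ∷ w) (suc (toℕ i)) 0) λ ())
      (sum-cong-≗ {n} λ j → ind-⇔ (is31-2? a (x ∷ w) (suc (toℕ i)) (suc (toℕ j))) (is31-2? (suc x) w (toℕ i) (toℕ j))
        (λ (lt , r) → s≤s⁻¹ lt , r) (λ (lt , r) → s≤s lt , r)))

  sum2-13-∷ : ∀ x (w : Vec ℕ n) → sum2-13 (x ∷ w) ≡ ascentsAcross (suc x) (suc x) (oneBlock w) + sum2-13 w
  sum2-13-∷ {n} x w = cong₂ _+_
    (cong₂ _+_ (ind-no (is2-13? (x ∷ w) 0 0) λ ())
      (trans (sum-cong-≗ {n} λ j → ind-⇔ (is2-13? (x ∷ w) 0 (suc (toℕ j)))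
          (suc x <? at w (suc (toℕ j)) ×-dec at w (toℕ j) <? suc x)
               proj₂ (λ r → z<s , r))
             (sum-ascentsAcross-self x w)))
    (sum-cong-≗ {n} λ i → cong₂ _+_ (ind-no (is2-13? (x ∷ w) (suc (toℕ i)) 0) λ ())
      (sum-cong-≗ {n} λ j → ind-⇔ (is2-13? (x ∷ w) (suc (toℕ i)) (suc (toℕ j))) (is2-13? w (toℕ i) (toℕ j))
        (λ (lt , r) → s≤s⁻¹ lt , r) (λ (lt , r) → s≤s lt , r)))

  patterns-oneBlock : ∀ a (w : Vec ℕ n) → patterns a (oneBlock w) ≡ 2 * sum2-13 w + sum31-2 a w
  patterns-oneBlock a []      = refl
  patterns-oneBlock a (x ∷ w) = begin
    B + 2 * A + patterns (suc x) (oneBlock w)        ≡⟨ cong (B + 2 * A +_) (patterns-oneBlock (suc x) w) ⟩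
    B + 2 * A + (2 * sum2-13 w + sum31-2 (suc x) w)  ≡⟨ regroup A B (sum2-13 w) (sum31-2 (suc x) w) ⟩
    2 * (A + sum2-13 w) + (B + sum31-2 (suc x) w)    ≡⟨ cong₂ (λ u v → 2 * u + v) (sum2-13-∷ x w) (sum31-2-∷ a x w) ⟨
    2 * sum2-13 (x ∷ w) + sum31-2 a (x ∷ w)          ∎
    where
    open ≡-Reasoning
    A = ascentsAcross (suc x) (suc x) (oneBlock w)
    B = between a (suc x) (oneBlock w)
    regroup : ∀ a b c d → b + 2 * a + (2 * c + d) ≡ 2 * (a + c) + (b + d)
    regroup = solve-∀

  module _ {n} (σ : Word n) where
    private
      w = letters σ

      ⟨⟩-next : ∀ i → σ ⟨ suc i + 1 ⟩ ≡ at w (suc i)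
      ⟨⟩-next i = trans (cong (σ ⟨_⟩) (cong suc (+-comm i 1))) (⟨⟩-at σ (suc (suc i)))

    valleys≡ : valleys σ ≡ valleyCount 0 (oneBlock w)
    valleys≡ = trans (count-applyUpTo _ suc n) (trans (sum-cong-≗ {n} eq) (sum-valleys 0 w))
      where
      eq : ∀ (i : Fin n) → ind (σ ⟨ toℕ i ⟩ >? σ ⟨ suc (toℕ i) ⟩ ×-dec
          σ ⟨ suc (toℕ i) ⟩ <? σ ⟨ suc (toℕ i) + 1 ⟩) ≡ ind (isValley? 0 w (toℕ i))
      eq i rewrite ⟨⟩-at σ (toℕ i) | ⟨⟩-at σ (suc (toℕ i)) | ⟨⟩-next (toℕ i) = refl

    doubleDescents≡ : doubleDescents σ ≡ doubleDescentCount 0 (oneBlock w)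
    doubleDescents≡ = trans (count-applyUpTo _ suc n) (trans (sum-cong-≗ {n} eq) (sum-doubleDescents 0 w))
      where
      eq : ∀ (i : Fin n) → ind (σ ⟨ toℕ i ⟩ >? σ ⟨ suc (toℕ i) ⟩ ×-dec
          σ ⟨ suc (toℕ i) ⟩ >? σ ⟨ suc (toℕ i) + 1 ⟩) ≡ ind (isDoubleDescent? 0 w (toℕ i))
      eq i rewrite ⟨⟩-at σ (toℕ i) | ⟨⟩-at σ (suc (toℕ i)) | ⟨⟩-next (toℕ i) = refl

    [31-2]≡ : [31-2] σ ≡ sum31-2 0 w
    [31-2]≡ = trans (count-pairs _ suc n suc n) (sum-cong-≗ {n} λ i → sum-cong-≗ {n} λ j → eq (toℕ i) (toℕ j))
      where
      eq : ∀ i j → ind (2 ≤? suc i ×-dec suc i <? suc j ×-dec σ ⟨ i ⟩ >? σ ⟨ suc j ⟩ ×-dec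
          σ ⟨ suc j ⟩ >? σ ⟨ suc i ⟩) ≡ ind (is31-2? 0 w i j)
      eq i j rewrite ⟨⟩-at σ i | ⟨⟩-at σ (suc i) | ⟨⟩-at σ (suc j) = ind-⇔
        (2 ≤? suc i ×-dec suc i <? suc j ×-dec at w j <? at⁻ 0 w i ×-dec at w i <? at w j) (is31-2? 0 w i j)
        (λ (_ , lt , r) → s≤s⁻¹ lt , r)
        (λ (lt , r) → s≤s (positive i (proj₁ r)) , s≤s lt , r)
        where
        -- Before the first letter the height is 0, with nothing below it; this yields `2 ≤ suc i`.
        positive : ∀ i → at w j < at⁻ 0 w i → 1 ≤ i
        positive (suc i) _ = s≤s z≤n

    [2-13]≡ : [2-13] σ ≡ sum2-13 w
    [2-13]≡ = trans (count-pairs _ suc n suc n) (sum-cong-≗ {n} λ i → sum-cong-≗ {n} λ j → eq (toℕ i) (toℕ j))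
      where
      eq : ∀ i j → ind (suc i <? suc j ×-dec suc j ≤? n ∸ 1 ×-dec σ ⟨ suc j + 1 ⟩ >? σ ⟨ suc i ⟩ ×-dec
          σ ⟨ suc i ⟩ >? σ ⟨ suc j ⟩) ≡ ind (is2-13? w i j)
      eq i j rewrite ⟨⟩-at σ (suc i) | ⟨⟩-at σ (suc j) | ⟨⟩-next j = ind-⇔
        (suc i <? suc j ×-dec suc j ≤? n ∸ 1 ×-dec at w i <? at w (suc j) ×-dec at w j <? at w i) (is2-13? w i j)
        (λ (lt , _ , r) → s≤s⁻¹ lt , r)
        -- If j + 1 lay past the end, its height would be 0 and could not be the 3 of the pattern.
        (λ (lt , r) → s≤s lt , m+n≤o⇒m≤o∸n (suc j)
            (subst (_≤ n) (+-comm 1 (suc j)) (≰⇒> λ n≤1+j →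
                n≮0 (subst (at w i <_) (at-≥ w (suc j) n≤1+j) (proj₁ r)))) , r)

    patterns≡ : patterns 0 (oneBlock w) ≡ 2 * [2-13] σ + [31-2] σ
    patterns≡ = trans (patterns-oneBlock 0 w) (sym (cong₂ (λ u v → 2 * u + v) [2-13]≡ [31-2]≡))

-- Recurrence for weighted sums over cut permutations

module ValleyRecursion where

  open import Algebra.Bundles using (CommutativeSemiring)
  open import Data.Fin using (Fin; zero; suc; toℕ)
  open import Data.List as List using (List; []; _∷_; allFin)
  open import Data.List.Relation.Unary.All as All using (All; []; _∷_)
  open import Data.Nat as ℕ using (ℕ; zero; suc; pred; _≟_)
  open import Data.Nat.Properties as ℕ using (suc-injective)
  open import Data.Product using (_×_; _,_; proj₁; proj₂)
  open import Data.Vec as Vec using (Vec; []; _∷_; insertAt)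
  import Data.Vec.Properties as Vec
  open import Function using (_∘_)
  open import Relation.Binary.PropositionalEquality as ≡ using (_≡_; _≢_; cong; cong₂)
  open import Relation.Nullary using (Dec; _×-dec_)
  open FiniteSums
  open QWeightSums
  open Insertions
  open BlockSequences
  open BlockStatistics
  open PatternGains
  open OneLineWords

  private variable n : ℕ

  seps-inside : ∀ (b : Blocks inside) → seps b ≢ 0
  seps-inside (x ∷ b) = seps-inside b
  seps-inside (sep b) ()

  letters-ins : ∀ i (σ : Word n) → letters (ins i zero σ) ≡ insertAt (Vec.map suc (letters σ)) i 0
  letters-ins i σ = ≡.trans (Vec.map-insertAt toℕ zero (Vec.map suc σ) i)
    (cong (λ w → insertAt w i 0) (≡.trans (≡.sym (Vec.map-∘ toℕ suc σ)) (Vec.map-∘ suc toℕ σ)))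

  module BlockSums {c ℓ} (S : CommutativeSemiring c ℓ) (q : CommutativeSemiring.Carrier S) where
    open CommutativeSemiring S hiding (zero) renaming (refl to ≈-refl; sym to ≈-sym; trans to ≈-trans)
    open Summation S
    open SplitSums S
    open QWeights S q
    open import Algebra.Properties.Semiring.Exp semiring using (_^_; ^-homo-*)
    open import Algebra.Solver.Ring.NaturalCoefficients.Default S
    open import Relation.Binary.Reasoning.Setoid setoid hiding (start)

    Status : ℕ → ℕ → ∀ {p} → Blocks p → Set
    Status m k w = seps w ≡ m × valleyCount 0 w ≡ k × doubleDescentCount 0 w ≡ 0

    status? : ∀ m k {p} (w : Blocks p) → Dec (Status m k w)
    status? m k w = seps w ≟ m ×-dec valleyCount 0 w ≟ k ×-dec doubleDescentCount 0 w ≟ 0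

    weight : ℕ → ℕ → ∀ {p} → Blocks p → Carrier
    weight m k w = q ^ patterns 0 w when status? m k w

    ∑-gains : ∀ m → ∑ (gains m) (q ^_) ≈ V m
    ∑-gains zero    = ≈-refl
    ∑-gains (suc m) = +-congˡ (begin
      ∑ (List.map suc (gains m)) (q ^_) ≡⟨ ∑-map suc (gains m) (q ^_) ⟩
      ∑ (gains m) (λ i → q * q ^ i)     ≈⟨ ∑-*ˡ q (gains m) (q ^_) ⟨
      q * ∑ (gains m) (q ^_)            ≈⟨ *-congˡ (∑-gains m) ⟩
      q * V m                           ∎)

    -- Whether a grown sequence has the wanted status depends only on κ and w. The condition thus
    -- leaves the sum, and `patterns-grow` evaluates what remains.
    ∑-grow : ∀ {κ} → PreservesDescents κ → ∀ (w : Blocks outside) {m k} {R : Set} (R? : Dec R) →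
      All (λ s → (Status m k s → R) × (R → Status m k s)) (grow κ outside w) →
      ∑ (grow κ outside w) (weight m k) ≈ (q ^ patterns 0 w * ∑ (newGains κ outside (seps w)) (q ^_) when R?)
    ∑-grow {κ} κ! w {m} {k} R? status = begin
      ∑ (grow κ outside w) (weight m k)
        ≈⟨ ∑-cong-∈ (grow κ outside w) (λ s s∈ → let to , from = All.lookup status s∈ in when-⇔ (status? m k s) R? to from _) ⟩
      ∑ (grow κ outside w) (λ s → q ^ patterns 0 s when R?)
        ≈⟨ ∑-when R? (grow κ outside w) _ ⟩
      (∑ (grow κ outside w) (λ s → q ^ patterns 0 s) when R?)
        ≈⟨ when-cong R? (λ _ → begin
             ∑ (grow κ outside w) (λ s → q ^ patterns 0 s)
               ≡⟨ ∑-map (patterns 0) (grow κ outside w) (q ^_) ⟨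
             ∑ (List.map (patterns 0) (grow κ outside w)) (q ^_)
               ≡⟨ cong (λ es → ∑ es (q ^_)) (patterns-grow κ! outside 0 w) ⟩
             ∑ (List.map (patterns 0 w ℕ.+_) new) (q ^_)
               ≡⟨ ∑-map (patterns 0 w ℕ.+_) new (q ^_) ⟩
             ∑ new (λ i → q ^ (patterns 0 w ℕ.+ i))
               ≈⟨ ∑-cong new (λ i → ^-homo-* q (patterns 0 w) i) ⟩
             ∑ new (λ i → q ^ patterns 0 w * q ^ i)
               ≈⟨ ∑-*ˡ (q ^ patterns 0 w) new (q ^_) ⟨
             q ^ patterns 0 w * ∑ new (q ^_) ∎) ⟩
      (q ^ patterns 0 w * ∑ new (q ^_) when R?) ∎
      where new = newGains κ outside (seps w)

    -- The value of f at m - 1, with 0 when m = 0, so that recurrences keep one form at the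
    -- boundary.
    before : ℕ → (ℕ → Carrier) → Carrier
    before zero    f = 0#
    before (suc m) f = f m

    before-cong : ∀ m {f g} → (∀ i → f i ≈ g i) → before m f ≈ before m g
    before-cong zero    e = ≈-refl
    before-cong (suc m) e = e m

    private
      extract : ∀ {R : Set} (R? : Dec R) x y {z} → (R → y ≈ z) → (x * y when R?) ≈ z * (x when R?)
      extract R? x y {z} e = begin
        (x * y when R?)   ≈⟨ when-cong R? (λ r → ≈-trans (*-congˡ (e r)) (*-comm x z)) ⟩
        (z * x when R?)   ≈⟨ *-when R? z x ⟨
        z * (x when R?)   ∎

      GrownStatus : Kind → Blocks outside → ℕ → ℕ → Set
      GrownStatus κ w m k =
        gainedSeps κ ℕ.+ seps w ≡ lostSeps κ ℕ.+ m ×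
        newValleys κ ℕ.+ valleyCount 0 w ≡ k ×
        newDoubleDescents κ ℕ.+ doubleDescentCount 0 w ≡ 0

      grownStatus? : ∀ κ w m k → Dec (GrownStatus κ w m k)
      grownStatus? κ w m k =
        gainedSeps κ ℕ.+ seps w ≟ lostSeps κ ℕ.+ m ×-dec
        newValleys κ ℕ.+ valleyCount 0 w ≟ k ×-dec
        newDoubleDescents κ ℕ.+ doubleDescentCount 0 w ≟ 0

      status-grow : ∀ κ (w : Blocks outside) m k → All (λ s →
        (Status m k s → GrownStatus κ w m k) ×
        (GrownStatus κ w m k → Status m k s))
        (grow κ outside w)
      status-grow κ w m k = All.zipWith
        (λ (s , v , d) →
          (λ (m≡ , k≡ , d≡) → ≡.trans (≡.sym s) (cong (lostSeps κ ℕ.+_) m≡) , ≡.trans (≡.sym v) k≡ ,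
              ≡.trans (≡.sym d) d≡) ,
          (λ (m≡ , k≡ , d≡) → ℕ.+-cancelˡ-≡ (lostSeps κ) _ _ (≡.trans s m≡) , ≡.trans v k≡ , ≡.trans d d≡))
        (seps-grow κ outside w , All.zip (valleyCount-grow κ outside 0 w , doubleDescentCount-grow κ outside 0 w))

    ∑-grow-peak : ∀ (w : Blocks outside) m k → ∑ (grow peak outside w) (weight m k) ≈ V m *
        before m (λ m → weight m k w)
    ∑-grow-peak w m k = ≈-trans (∑-grow peak w (grownStatus? peak w m k) (status-grow peak w m k)) (from m)
      where
      from : ∀ m → (q ^ patterns 0 w * ∑ (gains (suc (seps w))) (q ^_) when grownStatus? peak w m k) ≈ V m *
          before m (λ m → weight m k w)
      from zero    = ≈-trans
          (when-no (grownStatus? peak w 0 k) (λ ()) (q ^ patterns 0 w * ∑ (gains (suc (seps w))) (q ^_)))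
              (≈-sym (zeroʳ (V 0)))
      from (suc m) = ≈-trans
        (extract (grownStatus? peak w (suc m) k) _ _ {V (suc m)}
            (λ (e , _) → ≈-trans (∑-gains (suc (seps w))) (reflexive (cong V e))))
        (*-congˡ (when-⇔ (grownStatus? peak w (suc m) k) (status? m k w)
          (λ (e , r) → suc-injective e , r) (λ (e , r) → cong suc e , r) _))

    ∑-grow-doubleAscent : ∀ (w : Blocks outside) m k → ∑ (grow doubleAscent outside w) (weight m k) ≈ V m *
        weight m k w
    ∑-grow-doubleAscent w m k = ≈-trans
      (∑-grow doubleAscent w (grownStatus? doubleAscent w m k) (status-grow doubleAscent w m k))
      (extract (grownStatus? doubleAscent w m k) _ _ (λ (e , _) → ≈-trans (∑-gains (seps w)) (reflexive (cong V e))))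

    ∑-grow-valley : ∀ (w : Blocks outside) m k → ∑ (grow valley outside w) (weight m k) ≈ V m *
        before k (λ k → weight (suc m) k w)
    ∑-grow-valley w m k = ≈-trans (∑-grow valley w (grownStatus? valley w m k) (status-grow valley w m k)) (from k)
      where
      from : ∀ k → (q ^ patterns 0 w * ∑ (gains (pred (seps w))) (q ^_) when grownStatus? valley w m k) ≈ V m *
          before k (λ k → weight (suc m) k w)
      from zero    = ≈-trans
          (when-no (grownStatus? valley w m 0) (λ ()) (q ^ patterns 0 w * ∑ (gains (pred (seps w))) (q ^_)))
              (≈-sym (zeroʳ (V m)))
      from (suc k) = ≈-trans
        (extract (grownStatus? valley w m (suc k)) _ _ {V m}
            (λ (e , _) → ≈-trans (∑-gains (pred (seps w))) (reflexive (cong (V ∘ pred) e))))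
        (*-congˡ (when-⇔ (grownStatus? valley w m (suc k)) (status? (suc m) k w)
          (λ (e , v , d) → e , suc-injective v , d) (λ (e , v , d) → e , cong suc v , d) _))

    ∑-grow-doubleDescent : ∀ (w : Blocks outside) m k → ∑ (grow doubleDescent outside w) (weight m k) ≈ 0#
    ∑-grow-doubleDescent w m k = ∑-zero (grow doubleDescent outside w) λ s s∈ →
      when-no (status? m k s) (λ r →
          case (proj₂ (proj₂ (proj₁ (All.lookup (status-grow doubleDescent w m k) s∈) r)))) _
      where
      case : ∀ {x} → suc x ≢ 0
      case ()

    growths-weight : ∀ (w : Blocks outside) m k → growths outside w (weight m k) ≈
      V m * (before m (λ m → weight m k w) + weight m k w + before k (λ k → weight (suc m) k w))
    growths-weight w m k = begin
      growths outside w (weight m k)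
        ≈⟨ +-cong (∑-grow-peak w m k)
            (+-cong (∑-grow-doubleAscent w m k)
                (+-cong (∑-grow-valley w m k) (+-congʳ (∑-grow-doubleDescent w m k)))) ⟩
      V m * before m (λ m → weight m k w) +
          (V m * weight m k w + (V m * before k (λ k → weight (suc m) k w) + (0# + 0#)))
        ≈⟨ solve 4 (λ v x y z → v :* x :+ (v :* y :+ (v :* z :+ (con 0 :+ con 0))) :=
            v :* (x :+ y :+ z)) ≈-refl _ _ _ _ ⟩
      V m * (before m (λ m → weight m k w) + weight m k w + before k (λ k → weight (suc m) k w)) ∎

    splitSum : ∀ n → (Blocks outside → Carrier) → Carrier
    splitSum n f = ∑ (𝔖 n) (λ σ → ∑ (splits outside (letters σ)) f)

    -- The permutations are decomposed by the place of their smallest letter. For a fixed remaining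
    -- word, `∑-insert` exchanges the sum over places and cuttings for one over cuttings and their
    -- growths.
    splitSum-suc : ∀ n f → splitSum (suc n) f ≈ splitSum n (λ w → growths outside w f)
    splitSum-suc n f = begin
      ∑ (𝔖 (suc n)) F
        ≈⟨ ∑-↭ F (𝔖-by-value zero) ⟩
      ∑ (List.cartesianProductWith (λ i → ins i zero) (allFin (suc n)) (𝔖 n)) F
        ≈⟨ ∑-cartesianProductWith (λ i → ins i zero) (allFin (suc n)) (𝔖 n) F ⟩
      ∑ (allFin (suc n)) (λ i → ∑ (𝔖 n) (λ σ → F (ins i zero σ)))
        ≈⟨ ∑-swap (allFin (suc n)) (𝔖 n) (λ i σ → F (ins i zero σ)) ⟩
      ∑ (𝔖 n) (λ σ → ∑ (allFin (suc n)) (λ i → F (ins i zero σ)))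
        ≈⟨ ∑-cong (𝔖 n) (λ σ → ∑-cong (allFin (suc n)) λ i →
            reflexive (cong (λ w → ∑ (splits outside w) f) (letters-ins i σ))) ⟩
      ∑ (𝔖 n) (λ σ → ∑ (allFin (suc n)) (λ i → ∑ (splits outside (insertAt (Vec.map suc (letters σ)) i 0)) f))
        ≈⟨ ∑-cong (𝔖 n) (λ σ → ∑-insert outside (letters σ) f) ⟩
      splitSum n (λ w → growths outside w f) ∎
      where
      F : Word (suc n) → Carrier
      F σ = ∑ (splits outside (letters σ)) f

    splitSum-cong : ∀ n {f g} → (∀ w → f w ≈ g w) → splitSum n f ≈ splitSum n g
    splitSum-cong n e = ∑-cong (𝔖 n) λ σ → ∑-cong (splits outside (letters σ)) e

    splitSum-+ : ∀ n f g → splitSum n (λ w → f w + g w) ≈ splitSum n f + splitSum n g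
    splitSum-+ n f g = ≈-trans (∑-cong (𝔖 n) λ σ → ∑-distrib-+ (splits outside (letters σ)) f g)
        (∑-distrib-+ (𝔖 n) _ _)

    splitSum-*ˡ : ∀ n y f → y * splitSum n f ≈ splitSum n (λ w → y * f w)
    splitSum-*ˡ n y f = ≈-trans (∑-*ˡ y (𝔖 n) _) (∑-cong (𝔖 n) λ σ → ∑-*ˡ y (splits outside (letters σ)) f)

    splitSum-before : ∀ n m (f : ℕ → Blocks outside → Carrier) →
      splitSum n (λ w → before m (λ i → f i w)) ≈ before m (λ i → splitSum n (f i))
    splitSum-before n zero    f = ∑-zero (𝔖 n) λ σ _ → ∑-zero (splits outside (letters σ)) λ _ _ → ≈-refl
    splitSum-before n (suc m) f = ≈-refl

    -- B n m k is the sum of q ^ patterns over all sequences of m blocks formed by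
    -- n letters with k valleys and no double descents.
    B : ℕ → ℕ → ℕ → Carrier
    B zero    zero zero = 1#
    B zero    _    _    = 0#
    B (suc n) m    k    = V m * (before m (λ m → B n m k) + B n m k + before k (λ k → B n (suc m) k))

    splitSum-weight : ∀ n m k → splitSum n (weight m k) ≈ B n m k
    splitSum-weight zero zero    zero    = solve 0 ((con 1 :+ con 0) :+ con 0 := con 1) ≈-refl
    splitSum-weight zero zero    (suc k) = solve 0 ((con 0 :+ con 0) :+ con 0 := con 0) ≈-refl
    splitSum-weight zero (suc m) k       = solve 0 ((con 0 :+ con 0) :+ con 0 := con 0) ≈-refl
    splitSum-weight (suc n) m    k       = begin
      splitSum (suc n) (weight m k)
        ≈⟨ splitSum-suc n (weight m k) ⟩
      splitSum n (λ w → growths outside w (weight m k))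
        ≈⟨ splitSum-cong n (λ w → growths-weight w m k) ⟩
      splitSum n (λ w → V m * (before m (λ m → weight m k w) + weight m k w + before k (λ k → weight (suc m) k w)))
        ≈⟨ splitSum-*ˡ n (V m) _ ⟨
      V m * splitSum n (λ w → before m (λ m → weight m k w) + weight m k w + before k (λ k → weight (suc m) k w))
        ≈⟨ *-congˡ (≈-trans (splitSum-+ n _ _) (+-congʳ (splitSum-+ n _ _))) ⟩
      V m * (splitSum n (λ w → before m (λ m → weight m k w)) + splitSum n (weight m k) +
          splitSum n (λ w → before k (λ k → weight (suc m) k w)))
        ≈⟨ *-congˡ (+-cong
             (+-cong (≈-trans (splitSum-before n m (λ m → weight m k))
                 (before-cong m λ m → splitSum-weight n m k)) (splitSum-weight n m k))
             (≈-trans (splitSum-before n k (λ k → weight (suc m) k))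
                 (before-cong k λ k → splitSum-weight n (suc m) k))) ⟩
      B (suc n) m k ∎

    private
      -- Every cut adds a separator to the closing one, so only the uncut word has exactly one.
      ∑-splits-oneBlock : ∀ (w : Vec ℕ n) f → (∀ b → seps b ≢ 1 → f b ≈ 0#) → ∑ (splits inside w) f ≈ f (oneBlock w)
      ∑-splits-oneBlock []      f f≈0 = +-identityʳ _
      ∑-splits-oneBlock (x ∷ w) f f≈0 = begin
        ∑ (splits inside (x ∷ w)) f
          ≈⟨ ∑-++ (List.map (x ∷_) (splits inside w)) _ f ⟩
        ∑ (List.map (x ∷_) (splits inside w)) f + ∑ (List.map (λ b → sep (x ∷ b)) (splits inside w)) f
          ≡⟨ cong₂ _+_ (∑-map (x ∷_) (splits inside w) f) (∑-map (λ b → sep (x ∷ b)) (splits inside w) f) ⟩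
        ∑ (splits inside w) (λ b → f (x ∷ b)) + ∑ (splits inside w) (λ b → f (sep (x ∷ b)))
          ≈⟨ +-cong (∑-splits-oneBlock w (λ b → f (x ∷ b)) (λ b → f≈0 (x ∷ b)))
                    (∑-zero (splits inside w) λ b _ → f≈0 (sep (x ∷ b)) λ e → seps-inside b (suc-injective e)) ⟩
        f (x ∷ oneBlock w) + 0#
          ≈⟨ +-identityʳ _ ⟩
        f (oneBlock (x ∷ w)) ∎

      seps-oneBlock : ∀ (w : Vec ℕ n) → seps (oneBlock w) ≡ 1
      seps-oneBlock []      = ≡.refl
      seps-oneBlock (x ∷ w) = seps-oneBlock w

      ∑-splits-weight : ∀ (w : Vec ℕ (suc n)) k → ∑ (splits outside w) (weight 1 k) ≈ weight 1 k (oneBlock w)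
      ∑-splits-weight (x ∷ w) k = ≈-trans (reflexive (∑-map (x ∷_) (splits inside w) (weight 1 k)))
        (∑-splits-oneBlock w (λ b → weight 1 k (_∷_ {p = outside} x b))
          (λ b ≢1 → when-no (status? 1 k (_∷_ {p = outside} x b)) (λ r → ≢1 (proj₁ r)) _))

    ∑-𝔖[,] : ∀ n k → ∑ 𝔖[ suc n , k ] (λ σ → q ^ (2 ℕ.* [2-13] σ ℕ.+ [31-2] σ)) ≈ B (suc n) 1 k
    ∑-𝔖[,] n k = begin
      ∑ 𝔖[ suc n , k ] (λ σ → q ^ (2 ℕ.* [2-13] σ ℕ.+ [31-2] σ))
        ≈⟨ ∑-filter (λ σ → valleys σ ≟ k ×-dec doubleDescents σ ≟ 0) (𝔖 (suc n)) _ ⟩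
      ∑ (𝔖 (suc n)) (λ σ → q ^ (2 ℕ.* [2-13] σ ℕ.+ [31-2] σ) when (valleys σ ≟ k ×-dec doubleDescents σ ≟ 0))
        ≈⟨ ∑-cong (𝔖 (suc n)) term ⟨
      splitSum (suc n) (weight 1 k)
        ≈⟨ splitSum-weight (suc n) 1 k ⟩
      B (suc n) 1 k ∎
      where
      term : ∀ σ → ∑ (splits outside (letters σ)) (weight 1 k) ≈
                   (q ^ (2 ℕ.* [2-13] σ ℕ.+ [31-2] σ) when (valleys σ ≟ k ×-dec doubleDescents σ ≟ 0))
      term σ = begin
        ∑ (splits outside (letters σ)) (weight 1 k)
          ≈⟨ ∑-splits-weight (letters σ) k ⟩
        weight 1 k (oneBlock (letters σ))
          ≈⟨ when-⇔ (status? 1 k (oneBlock (letters σ))) (valleys σ ≟ k ×-dec doubleDescents σ ≟ 0)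
               (λ (_ , v , d) → ≡.trans (valleys≡ σ) v , ≡.trans (doubleDescents≡ σ) d)
               (λ (v , d) → seps-oneBlock (letters σ) , ≡.trans (≡.sym (valleys≡ σ)) v ,
                   ≡.trans (≡.sym (doubleDescents≡ σ)) d) _ ⟩
        (q ^ patterns 0 (oneBlock (letters σ)) when (valleys σ ≟ k ×-dec doubleDescents σ ≟ 0))
          ≡⟨ cong (λ e → q ^ e when (valleys σ ≟ k ×-dec doubleDescents σ ≟ 0)) (patterns≡ σ) ⟩
        (q ^ (2 ℕ.* [2-13] σ ℕ.+ [31-2] σ) when (valleys σ ≟ k ×-dec doubleDescents σ ≟ 0)) ∎

-- Motzkin paths, divisibility and the γ-expansion

module MotzkinPaths where

  open import Algebra.Bundles using (CommutativeSemiring)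
  open import Data.List using (upTo)
  open import Data.Nat as ℕ using (ℕ; zero; suc; pred; _<_; _∸_; s≤s; s≤s⁻¹; z≤n)
  open import Data.Nat.Properties as ℕ using (_≤?_)
  open import Data.Product using (_,_)
  open import Function using (_∘_)
  open import Relation.Binary.PropositionalEquality as ≡ using (_≡_; cong; subst)
  open import Relation.Nullary using (yes; no)
  open FiniteSums
  open QWeightSums
  open InversionsAndExcedances
  open ExcedanceRecursion
  open ValleyRecursion

  module Histories {c ℓ} (S : CommutativeSemiring c ℓ) (q : CommutativeSemiring.Carrier S) where
    open CommutativeSemiring S hiding (zero) renaming (refl to ≈-refl; sym to ≈-sym; trans to ≈-trans)
    open Summation S
    open QWeights S q
    open BlockSums S q
    open import Algebra.Definitions.RawSemiring rawSemiring using (_∣_)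
    open import Algebra.Definitions.RawMagma *-rawMagma using (_,_)
    open import Algebra.Properties.Semiring.Exp semiring using (_^_)
    open import Algebra.Properties.CommutativeSemiring.Exp S using (^-distrib-*)
    open import Algebra.Solver.Ring.NaturalCoefficients.Default S
    open import Relation.Binary.Reasoning.Setoid setoid

    -- D m h k sums, over the Motzkin paths with m steps from height h to 0 and
    -- k up steps, products of weights: 1 for an up step, V (1 + i) for a level
    -- step at height i, V (1 + i) V i for a down step from height i.
    D : ℕ → ℕ → ℕ → Carrier
    D zero    zero zero = 1#
    D zero    _    _    = 0#
    D (suc m) h    k    = before k (λ k → D m (suc h) k) + V (suc h) * D m h k +
                          before h (λ h′ → V (suc h) * V h * D m h′ k)

    private
      V! : ℕ → Carrier
      V! zero    = 1#
      V! (suc h) = V (suc h) * V! h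

    -- In `B` every step carries the weight of its own level, whereas `D` moves the weight of an up
    -- step to the down step matching it. The down steps from heights h, ..., 1 that match no up
    -- step would otherwise lack one factor each, which `V! h` supplies. The shift by one on the
    -- right is the first letter deposited, necessarily a peak, of weight V 1 = 1.
    D≈V!B : ∀ m h k → D m h k ≈ V! h * B (suc m) (suc h) k
    D≈V!B zero zero    zero    = solve 1
        (λ q → con 1 := con 1 :* ((con 1 :+ q :* con 0) :* (con 1 :+ con 0 :+ con 0))) ≈-refl q
    D≈V!B zero zero    (suc k) = solve 1
        (λ q → con 0 := con 1 :* ((con 1 :+ q :* con 0) :* (con 0 :+ con 0 :+ con 0))) ≈-refl q
    D≈V!B zero (suc h) k       = begin
      0#                                                             ≈⟨ solve 2
          (λ x y → con 0 := x :* (y :* (con 0 :+ con 0 :+ con 0))) ≈-refl _ _ ⟩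
      V! (suc h) * (V (2 ℕ.+ h) * (0# + 0# + 0#))                    ≈⟨ *-congˡ (*-congˡ (+-congˡ (before-zero k))) ⟨
      V! (suc h) * B 1 (suc (suc h)) k ∎
      where
      before-zero : ∀ k → before k (λ _ → 0#) ≈ 0#
      before-zero zero    = ≈-refl
      before-zero (suc k) = ≈-refl
    D≈V!B (suc m) h k = begin
      before k (λ k → D m (suc h) k) + V (suc h) * D m h k + before h (λ h′ → V (suc h) * V h * D m h′ k)
        ≈⟨ +-cong (+-cong (up k) (*-congˡ (D≈V!B m h k))) (down h) ⟩
      V (suc h) * V! h * before k (λ k → B (suc m) (2 ℕ.+ h) k) + V (suc h) * (V! h * B (suc m) (suc h) k) +
          V (suc h) * V! h * B (suc m) h k
        ≈⟨ solve 5 (λ v w x y z → v :* w :* x :+ v :* (w :* y) :+ v :* w :* z :=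
            w :* (v :* (z :+ y :+ x))) ≈-refl _ _ _ _ _ ⟩
      V! h * B (2 ℕ.+ m) (suc h) k ∎
      where
      up : ∀ k → before k (λ k → D m (suc h) k) ≈ V (suc h) * V! h * before k (λ k → B (suc m) (2 ℕ.+ h) k)
      up zero    = ≈-sym (zeroʳ _)
      up (suc k) = D≈V!B m (suc h) k

      down : ∀ h → before h (λ h′ → V (suc h) * V h * D m h′ k) ≈ V (suc h) * V! h * B (suc m) h k
      down zero    = solve 2 (λ x y → con 0 := x :* (con 0 :* y)) ≈-refl _ _
      down (suc h) = ≈-trans (*-congˡ (D≈V!B m h k))
        (solve 4 (λ a b c d → a :* b :* (c :* d) := a :* (b :* c) :* d) ≈-refl _ _ _ _)

    -- A path from h to 0 with k up steps has `h + k` down steps, hence at least `h + 2 * k` steps.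
    D-vanishes : ∀ m h k → m < h ℕ.+ 2 ℕ.* k → D m h k ≈ 0#
    D-vanishes zero    zero    (suc k) lt = ≈-refl
    D-vanishes zero    (suc h) k       lt = ≈-refl
    D-vanishes (suc m) h       k       lt = begin
      before k (λ k → D m (suc h) k) + V (suc h) * D m h k + before h (λ h′ → V (suc h) * V h * D m h′ k)
        ≈⟨ +-cong (+-cong (up k lt) (*-congˡ (D-vanishes m h k (ℕ.<-trans (ℕ.n<1+n m) lt)))) (down h lt) ⟩
      0# + V (suc h) * 0# + 0#
        ≈⟨ solve 1 (λ v → con 0 :+ v :* con 0 :+ con 0 := con 0) ≈-refl _ ⟩
      0# ∎
      where
      up : ∀ k → suc m < h ℕ.+ 2 ℕ.* k → before k (λ k → D m (suc h) k) ≈ 0#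
      up zero    lt = ≈-refl
      up (suc k) lt = D-vanishes m (suc h) k (s≤s⁻¹ (subst (suc m <_) (shift h k) lt))
        where
        shift : ∀ h k → h ℕ.+ 2 ℕ.* suc k ≡ suc (suc h ℕ.+ 2 ℕ.* k)
        shift h k = ≡.trans (cong (h ℕ.+_) (ℕ.*-suc 2 k)) (≡.trans (ℕ.+-suc h _) (cong suc (ℕ.+-suc h _)))

      down : ∀ h → suc m < h ℕ.+ 2 ℕ.* k → before h (λ h′ → V (suc h) * V h * D m h′ k) ≈ 0#
      down zero    lt = ≈-refl
      down (suc h) lt = ≈-trans (*-congˡ (D-vanishes m h k (s≤s⁻¹ lt))) (zeroʳ _)

    private
      ∣-0 : ∀ {x} → x ∣ 0#
      ∣-0 {x} = 0# , zeroˡ x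

      ∣-+ : ∀ {x y z} → x ∣ y → x ∣ z → x ∣ (y + z)
      ∣-+ {x} (a , e) (b , f) = (a + b) , ≈-trans (distribʳ x a b) (+-cong e f)

      ∣-* : ∀ {x y} z → x ∣ y → x ∣ (z * y)
      ∣-* {x} z (a , e) = (z * a) , ≈-trans (*-assoc z a x) (*-congˡ e)

      ∣-*-* : ∀ {x y z w} → x ∣ y → z ∣ w → (x * z) ∣ (y * w)
      ∣-*-* {x} {z = z} (a , e) (b , f) = (a * b) ,
        ≈-trans (solve 4 (λ a b x z → (a :* b) :* (x :* z) := (a :* x) :* (b :* z)) ≈-refl a b x z) (*-cong e f)

    u : Carrier
    u = q * (1# + q)

    -- Of V h and V (1 + h), the one of even index is divisible by q (1 + q).
    u∣VV : ∀ h → u ∣ (V (suc h) * V h)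
    u∣VV zero    = 0# , solve 2 (λ x y → con 0 :* x := y :* con 0) ≈-refl u (V 1)
    -- Unfolding twice gives `V (2 + h) = q ^ (2 * h) * u + q * q * V h`; multiplied by `V (suc h)`,
    -- the last term is covered by induction.
    u∣VV (suc h) with a , e ← u∣VV h = (q ^ (2 ℕ.* h) * V (suc h) + q * q * a) , (begin
      (q ^ (2 ℕ.* h) * V (suc h) + q * q * a) * u
        ≈⟨ solve 4 (λ x v q a → (x :* v :+ q :* q :* a) :* (q :* (con 1 :+ q)) :=
            x :* v :* (q :* (con 1 :+ q)) :+ q :* q :* (a :* (q :* (con 1 :+ q)))) ≈-refl _ _ _ _ ⟩
      q ^ (2 ℕ.* h) * V (suc h) * u + q * q * (a * u)
        ≈⟨ +-congˡ (*-congˡ e) ⟩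
      q ^ (2 ℕ.* h) * V (suc h) * u + q * q * (V (suc h) * V h)
        ≈⟨ solve 4 (λ x v q w → x :* v :* (q :* (con 1 :+ q)) :+ q :* q :* (v :* w) :=
            (q :* (q :* x) :+ q :* (x :+ q :* w)) :* v) ≈-refl _ _ _ _ ⟩
      (q ^ (2 ℕ.+ 2 ℕ.* h) + q * V (suc h)) * V (suc h)
        ≡⟨ cong (λ e → (q ^ e + q * V (suc h)) * V (suc h)) (ℕ.*-suc 2 h) ⟨
      V (2 ℕ.+ h) * V (suc h) ∎)

    -- The exponent is the number of down steps, each of which has a weight divisible by u.
    u∣D : ∀ m h k → (u ^ (k ℕ.+ h)) ∣ D m h k
    u∣D zero    zero    zero    = 1# , *-identityˡ 1#
    u∣D zero    zero    (suc k) = ∣-0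
    u∣D zero    (suc h) k       = ∣-0
    u∣D (suc m) h       k       = ∣-+ (∣-+ (up k) (∣-* (V (suc h)) (u∣D m h k))) (down h)
      where
      up : ∀ k → (u ^ (k ℕ.+ h)) ∣ before k (λ k → D m (suc h) k)
      up zero    = ∣-0
      up (suc k) = subst (λ e → (u ^ e) ∣ D m (suc h) k) (ℕ.+-suc k h) (u∣D m (suc h) k)

      down : ∀ h → (u ^ (k ℕ.+ h)) ∣ before h (λ h′ → V (suc h) * V h * D m h′ k)
      down zero    = ∣-0
      down (suc h) = subst (λ e → (u ^ e) ∣ (V (2 ℕ.+ h) * V (suc h) * D m h k)) (≡.sym (ℕ.+-suc k h))
        (∣-*-* (u∣VV (suc h)) (u∣D m h k))

    ∑-𝔖[,]≈D : ∀ m k → ∑ 𝔖[ suc m , k ] (λ σ → q ^ (2 ℕ.* [2-13] σ ℕ.+ [31-2] σ)) ≈ D m 0 k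
    ∑-𝔖[,]≈D m k = ≈-trans (∑-𝔖[,] m k) (≈-sym (≈-trans (D≈V!B m 0 k) (*-identityˡ _)))

    ∣∑-𝔖[,] : ∀ m k → (q ^ k * (1# + q) ^ k) ∣ ∑ 𝔖[ suc m , k ] (λ σ → q ^ (2 ℕ.* [2-13] σ ℕ.+ [31-2] σ))
    ∣∑-𝔖[,] m k with a , e ← u∣D m 0 k = a , (begin
      a * (q ^ k * (1# + q) ^ k)  ≈⟨ *-congˡ (^-distrib-* q (1# + q) k) ⟨
      a * u ^ k                   ≡⟨ cong (λ k → a * u ^ k) (ℕ.+-identityʳ k) ⟨
      a * u ^ (k ℕ.+ 0)           ≈⟨ e ⟩
      D m 0 k                     ≈⟨ ∑-𝔖[,]≈D m k ⟨
      _                           ∎)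

  -- Contraction of the S-fraction and the γ-expansion

  module Expansion {c ℓ} (S : CommutativeSemiring c ℓ) (q t : CommutativeSemiring.Carrier S) where
    open CommutativeSemiring S hiding (zero) renaming (refl to ≈-refl; sym to ≈-sym; trans to ≈-trans)
    open Summation S
    open QWeights S q
    open BlockSums S q
    open Histories S q
    open ExcedanceSums S q t
    open import Algebra.Properties.Semiring.Exp semiring using (_^_)
    open import Algebra.Solver.Ring.NaturalCoefficients.Default S
    open import Relation.Binary.Reasoning.Setoid setoid

    O-base-zero : O 1 0 ≈ 1#
    O-base-zero = begin
      O 1 0                  ≈⟨ O-suc {0} {0} z≤n ⟩
      E 1 1 + V 1 * E 0 0    ≈⟨ +-cong (E-base-suc 0) (*-congˡ E-base-zero) ⟩
      0# + V 1 * 1#          ≈⟨ solve 1 (λ q → con 0 :+ (con 1 :+ q :* con 0) :* con 1 := con 1) ≈-refl q ⟩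
      1#                     ∎

    O-base-suc : ∀ h → O (2 ℕ.+ h) (suc h) ≈ 0#
    O-base-suc h = begin
      O (2 ℕ.+ h) (suc h)                                              ≈⟨ O-suc {suc h} {suc h} ℕ.≤-refl ⟩
      E (2 ℕ.+ h) (2 ℕ.+ h) + V (2 ℕ.+ h) * E (suc h)
          (suc h)          ≈⟨ +-cong (E-base-suc (suc h)) (*-congˡ (E-base-suc h)) ⟩
      0# + V (2 ℕ.+ h) * 0#                                            ≈⟨ solve 1
          (λ v → con 0 :+ v :* con 0 := con 0) ≈-refl _ ⟩
      0#                                                               ∎

    E-step : ∀ m h → E (suc (m ℕ.+ h)) h ≈ O (suc (m ℕ.+ h)) h + before h (λ h′ → t * V h * O (suc (m ℕ.+ h′)) h′)
    E-step m zero    = ≈-trans (E-zero (suc (m ℕ.+ 0))) (≈-sym (+-identityʳ _))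
    E-step m (suc h) = ≈-trans (E-suc {m ℕ.+ suc h} {h} (ℕ.m≤n+m (suc h) m))
      (+-congˡ (*-congˡ (reflexive (cong (λ n → O n h) (ℕ.+-suc m h)))))

    -- The even heights are eliminated. A level step at height h passes through the even height
    -- above, with weight `t * V (suc h)`, or through the one below, with weight `V (suc h)`. In the
    -- indexing n = 1 + m + h, every summand has one step fewer.
    O-step : ∀ m h → O (suc (suc m ℕ.+ h)) h ≈
      O (suc (m ℕ.+ suc h)) (suc h) + t * V (suc h) * O (suc (m ℕ.+ h)) h +
      V (suc h) * (O (suc (m ℕ.+ h)) h + before h (λ h′ → t * V h * O (suc (m ℕ.+ h′)) h′))
    O-step m h = ≈-trans (O-suc {suc m ℕ.+ h} {h} (ℕ.m≤n+m h (suc m))) (+-cong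
      (≈-trans (E-suc {suc (m ℕ.+ h)} {h} (s≤s (ℕ.m≤n+m h m)))
          (+-congʳ (reflexive (cong (λ n → O (suc n) (suc h)) (≡.sym (ℕ.+-suc m h))))))
      (*-congˡ (E-step m h)))

    -- The exponent of `1# + t` is the number of level steps. The k down steps matching up steps
    -- give `t ^ k`; the other h of them are accounted for separately by `t ^ h`.
    term : ℕ → ℕ → ℕ → Carrier
    term m h k = D m h k * (t ^ k * (1# + t) ^ (m ∸ (h ℕ.+ 2 ℕ.* k)))

    private
      -- If `h + 2 * k` exceeds m, the truncated exponents need not differ by one, but then both
      -- sides vanish with `D m h k`.
      level-term : ∀ m h k → D m h k * (t ^ k * (1# + t) ^ (suc m ∸ (h ℕ.+ 2 ℕ.* k))) ≈ (1# + t) * term m h k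
      level-term m h k with h ℕ.+ 2 ℕ.* k ≤? m
      ... | yes le = begin
        D m h k * (t ^ k * (1# + t) ^ (suc m ∸ (h ℕ.+ 2 ℕ.* k)))
          ≡⟨ cong (λ e → D m h k * (t ^ k * (1# + t) ^ e)) (ℕ.+-∸-assoc 1 le) ⟩
        D m h k * (t ^ k * ((1# + t) * (1# + t) ^ (m ∸ (h ℕ.+ 2 ℕ.* k))))
          ≈⟨ solve 4 (λ d a z b → d :* (a :* (z :* b)) := z :* (d :* (a :* b))) ≈-refl _ _ _ _ ⟩
        (1# + t) * term m h k ∎
      ... | no nle = begin
        D m h k * (t ^ k * (1# + t) ^ (suc m ∸ (h ℕ.+ 2 ℕ.* k)))  ≈⟨ *-congʳ D≈0 ⟩
        0# * (t ^ k * (1# + t) ^ (suc m ∸ (h ℕ.+ 2 ℕ.* k)))       ≈⟨ solve 3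
            (λ x z y → con 0 :* x := z :* (con 0 :* y)) ≈-refl _ _ _ ⟩
        (1# + t) * (0# * (t ^ k * (1# + t) ^ (m ∸ (h ℕ.+ 2 ℕ.* k)))) ≈⟨ *-congˡ (*-congʳ D≈0) ⟨
        (1# + t) * term m h k ∎
        where D≈0 = D-vanishes m h k (ℕ.≰⇒> nle)

      shift : ∀ h k → h ℕ.+ 2 ℕ.* suc k ≡ suc (suc h ℕ.+ 2 ℕ.* k)
      shift h k = ≡.trans (cong (h ℕ.+_) (ℕ.*-suc 2 k)) (≡.trans (ℕ.+-suc h _) (cong suc (ℕ.+-suc h _)))

      up-terms : ∀ m h K →
        ∑ (upTo K) (λ k → before k (λ k → D m (suc h) k) * (t ^ k * (1# + t) ^ (suc m ∸ (h ℕ.+ 2 ℕ.* k)))) ≈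
        t * ∑ (upTo (pred K)) (term m (suc h))
      up-terms m h zero    = ≈-sym (zeroʳ t)
      up-terms m h (suc K) = begin
        ∑ (upTo (suc K)) f                              ≡⟨ ∑-upTo-suc K f ⟩
        0# * _ + ∑ (upTo K) (f ∘ suc)                   ≈⟨ ≈-trans (+-congʳ (zeroˡ _)) (+-identityˡ _) ⟩
        ∑ (upTo K) (f ∘ suc)                            ≈⟨ ∑-cong (upTo K) each ⟩
        ∑ (upTo K) (λ k → t * term m (suc h) k)         ≈⟨ ∑-*ˡ t (upTo K) _ ⟨
        t * ∑ (upTo K) (term m (suc h))                 ∎
        where
        f : ℕ → Carrier
        f k = before k (λ k → D m (suc h) k) * (t ^ k * (1# + t) ^ (suc m ∸ (h ℕ.+ 2 ℕ.* k)))

        each : ∀ k → f (suc k) ≈ t * term m (suc h) k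
        each k = begin
          D m (suc h) k * (t * t ^ k * (1# + t) ^ (suc m ∸ (h ℕ.+ 2 ℕ.* suc k)))
            ≡⟨ cong (λ e → D m (suc h) k * (t * t ^ k * (1# + t) ^ (suc m ∸ e))) (shift h k) ⟩
          D m (suc h) k * (t * t ^ k * (1# + t) ^ (m ∸ (suc h ℕ.+ 2 ℕ.* k)))
            ≈⟨ solve 4 (λ d t a b → d :* (t :* a :* b) := t :* (d :* (a :* b))) ≈-refl _ _ _ _ ⟩
          t * term m (suc h) k ∎

      down-terms : ∀ m h K →
        ∑ (upTo K) (λ k → before h (λ h′ → V (suc h) * V h * D m h′ k) *
            (t ^ k * (1# + t) ^ (suc m ∸ (h ℕ.+ 2 ℕ.* k)))) ≈
        before h (λ h′ → V (suc h) * V h * ∑ (upTo K) (term m h′))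
      down-terms m zero    K = ∑-zero (upTo K) λ _ _ → zeroˡ _
      down-terms m (suc h) K = ≈-trans (∑-cong (upTo K) λ k → *-assoc _ _ _) (≈-sym (∑-*ˡ _ (upTo K) _))

      ∑-term-suc : ∀ m h K → ∑ (upTo K) (term (suc m) h) ≈
        t * ∑ (upTo (pred K)) (term m (suc h)) + V (suc h) * ((1# + t) * ∑ (upTo K) (term m h)) +
        before h (λ h′ → V (suc h) * V h * ∑ (upTo K) (term m h′))
      ∑-term-suc m h K = begin
        ∑ (upTo K) (term (suc m) h)
          ≈⟨ ∑-cong (upTo K) (λ k → solve 5
              (λ a v d b x → (a :+ v :* d :+ b) :* x := a :* x :+ v :* (d :* x) :+ b :* x) ≈-refl _ _ _ _ _) ⟩
        ∑ (upTo K) (λ k → before k (λ k → D m (suc h) k) * w k + V (suc h) * (D m h k * w k) +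
            before h (λ h′ → V (suc h) * V h * D m h′ k) * w k)
          ≈⟨ ≈-trans (∑-distrib-+ (upTo K) _ _) (+-congʳ (∑-distrib-+ (upTo K) _ _)) ⟩
        ∑ (upTo K) (λ k → before k (λ k → D m (suc h) k) * w k) + ∑ (upTo K) (λ k → V (suc h) * (D m h k * w k)) +
        ∑ (upTo K) (λ k → before h (λ h′ → V (suc h) * V h * D m h′ k) * w k)
          ≈⟨ +-cong (+-cong (up-terms m h K) levels) (down-terms m h K) ⟩
        t * ∑ (upTo (pred K)) (term m (suc h)) + V (suc h) * ((1# + t) * ∑ (upTo K) (term m h)) +
        before h (λ h′ → V (suc h) * V h * ∑ (upTo K) (term m h′)) ∎
        where
        w : ℕ → Carrier
        w k = t ^ k * (1# + t) ^ (suc m ∸ (h ℕ.+ 2 ℕ.* k))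

        levels : ∑ (upTo K) (λ k → V (suc h) * (D m h k * w k)) ≈ V (suc h) * ((1# + t) * ∑ (upTo K) (term m h))
        levels = ≈-trans (≈-sym (∑-*ˡ (V (suc h)) (upTo K) _))
          (*-congˡ (≈-trans (∑-cong (upTo K) (level-term m h)) (≈-sym (∑-*ˡ (1# + t) (upTo K) _))))

    -- K is left free, as long as `D` vanishes from K on, because the up step shifts k and passes to
    -- `pred K` while the other steps keep K.
    O≈∑-term : ∀ m h K → m < h ℕ.+ 2 ℕ.* K → O (suc (m ℕ.+ h)) h ≈ t ^ h * ∑ (upTo K) (term m h)
    O≈∑-term zero    zero    (suc K) lt = begin
      O 1 0                                          ≈⟨ O-base-zero ⟩
      1#                                             ≈⟨ solve 0
          (con 1 := con 1 :* (con 1 :* (con 1 :* con 1) :+ con 0)) ≈-refl ⟩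
      1# * (term 0 0 0 + 0#)                         ≈⟨ *-congˡ (+-congˡ (∑-zero (upTo K) λ k _ → zeroˡ _)) ⟨
      1# * (term 0 0 0 + ∑ (upTo K) (term 0 0 ∘ suc)) ≡⟨ cong (1# *_) (∑-upTo-suc K (term 0 0)) ⟨
      1# * ∑ (upTo (suc K)) (term 0 0)               ∎
    O≈∑-term zero    (suc h) K       lt = begin
      O (2 ℕ.+ h) (suc h)                       ≈⟨ O-base-suc h ⟩
      0#                                        ≈⟨ zeroʳ _ ⟨
      t ^ suc h * 0#                            ≈⟨ *-congˡ (∑-zero (upTo K) λ k _ → zeroˡ _) ⟨
      t ^ suc h * ∑ (upTo K) (term 0 (suc h))   ∎
    O≈∑-term (suc m) h       K       lt = begin
      O (suc (suc m ℕ.+ h)) h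
        ≈⟨ O-step m h ⟩
      O (suc (m ℕ.+ suc h)) (suc h) + t * V (suc h) * O (suc (m ℕ.+ h)) h +
      V (suc h) * (O (suc (m ℕ.+ h)) h + before h (λ h′ → t * V h * O (suc (m ℕ.+ h′)) h′))
        ≈⟨ +-cong (+-cong (O≈∑-term m (suc h) (pred K) (lt↑ K lt)) (*-congˡ IH)) (*-congˡ (+-cong IH (down h lt))) ⟩
      t * t ^ h * ∑ (upTo (pred K)) (term m (suc h)) + t * V (suc h) * (t ^ h * ∑ (upTo K) (term m h)) +
      V (suc h) * (t ^ h * ∑ (upTo K) (term m h) + t ^ h * before h (λ h′ → V h * ∑ (upTo K) (term m h′)))
        -- The contributions from the even heights above and below merge into the factor `1 + t` of
        -- a level step.
        ≈⟨ solve 6 (λ t p v x y z → t :* p :* x :+ t :* v :* (p :* y) :+ v :* (p :* y :+ p :* z) :=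
                                    p :* (t :* x :+ v :* ((con 1 :+ t) :* y) :+ v :* z)) ≈-refl _ _ _ _ _ _ ⟩
      t ^ h * (t * ∑ (upTo (pred K)) (term m (suc h)) + V (suc h) * ((1# + t) * ∑ (upTo K) (term m h)) +
               V (suc h) * before h (λ h′ → V h * ∑ (upTo K) (term m h′)))
        ≈⟨ *-congˡ (+-congˡ (inner h)) ⟩
      t ^ h * (t * ∑ (upTo (pred K)) (term m (suc h)) + V (suc h) * ((1# + t) * ∑ (upTo K) (term m h)) +
               before h (λ h′ → V (suc h) * V h * ∑ (upTo K) (term m h′)))
        ≈⟨ *-congˡ (∑-term-suc m h K) ⟨
      t ^ h * ∑ (upTo K) (term (suc m) h) ∎
      where
      IH = O≈∑-term m h K (ℕ.<-trans (ℕ.n<1+n m) lt)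

      lt↑ : ∀ K → suc m < h ℕ.+ 2 ℕ.* K → m < suc h ℕ.+ 2 ℕ.* pred K
      lt↑ zero    lt = ℕ.<-trans (ℕ.n<1+n m) (ℕ.<-trans lt (ℕ.n<1+n _))
      lt↑ (suc K) lt = s≤s⁻¹ (subst (suc m <_) (shift h K) lt)

      down : ∀ h → suc m < h ℕ.+ 2 ℕ.* K →
        before h (λ h′ → t * V h * O (suc (m ℕ.+ h′)) h′) ≈ t ^ h * before h (λ h′ → V h * ∑ (upTo K) (term m h′))
      down zero    lt = ≈-sym (zeroʳ _)
      down (suc h) lt = ≈-trans (*-congˡ (O≈∑-term m h K (s≤s⁻¹ lt)))
        (solve 4 (λ t v p x → t :* v :* (p :* x) := t :* p :* (v :* x)) ≈-refl _ _ _ _)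

      inner : ∀ h → V (suc h) * before h (λ h′ → V h * ∑ (upTo K) (term m h′)) ≈
          before h (λ h′ → V (suc h) * V h * ∑ (upTo K) (term m h′))
      inner zero    = zeroʳ _
      inner (suc h) = ≈-sym (*-assoc _ _ _)

    ∑-wt : ∀ m K → m < 2 ℕ.* K → ∑ (𝔖 (suc m)) wt ≈
      ∑ (upTo K) (λ k → ∑ 𝔖[ suc m , k ] (λ σ → q ^ (2 ℕ.* [2-13] σ ℕ.+ [31-2] σ)) *
          (t ^ k * (1# + t) ^ (m ∸ 2 ℕ.* k)))
    ∑-wt m K lt = begin
      ∑ (𝔖 (suc m)) wt
        ≈⟨ ∑-cong (𝔖 (suc m)) (λ σ → when-yes (avoid? 0 0 σ) (λ _ ()) (wt σ)) ⟨
      E (suc m) 0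
        ≈⟨ E-zero (suc m) ⟩
      O (suc m) 0
        ≡⟨ cong (λ n → O (suc n) 0) (ℕ.+-identityʳ m) ⟨
      O (suc (m ℕ.+ 0)) 0
        ≈⟨ ≈-trans (O≈∑-term m 0 K lt) (*-identityˡ _) ⟩
      ∑ (upTo K) (term m 0)
        ≈⟨ ∑-cong (upTo K) (λ k → *-congʳ (∑-𝔖[,]≈D m k)) ⟨
      ∑ (upTo K) (λ k → ∑ 𝔖[ suc m , k ] (λ σ → q ^ (2 ℕ.* [2-13] σ ℕ.+ [31-2] σ)) *
          (t ^ k * (1# + t) ^ (m ∸ 2 ℕ.* k))) ∎

-- Specialisation to ℤ[q] and ℤ[q][t]

open PolynomialRings
open FiniteSums
open MotzkinPaths
open import Algebra.Bundles using (CommutativeSemiring)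
open import Algebra.Structures using (IsCommutativeRing)
open import Data.List using (List; []; _∷_; upTo; map)
open import Data.Integer as ℤ using (ℤ)
import Data.Integer.Properties as ℤ
open import Data.Nat using (ℕ; zero; suc; _+_; _*_; _∸_; _≤_; _<_; z≤n; s≤s; ⌊_/2⌋)
open import Data.Nat.Properties using (*-suc)
open import Data.Product using (_×_; _,_; Σ-syntax)
open import Relation.Binary.PropositionalEquality using (_≡_; refl; sym; subst)

ℤ[q]-semiring : CommutativeSemiring _ _
ℤ[q]-semiring = record
  { isCommutativeSemiring = PolynomialSemiring.isCommutativeSemiring ℤ.+-*-rawRing
      (IsCommutativeRing.isCommutativeSemiring ℤ.+-*-isCommutativeRing) }

ℤ[q][t]-semiring : CommutativeSemiring _ _
ℤ[q][t]-semiring = record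
  { isCommutativeSemiring = PolynomialSemiring.isCommutativeSemiring ℤ[q]
      (CommutativeSemiring.isCommutativeSemiring ℤ[q]-semiring) }

private
  module R  = CommutativeSemiring ℤ[q]-semiring
  module RT = CommutativeSemiring ℤ[q][t]-semiring
  module ∑T = Summation ℤ[q][t]-semiring

-- The constant list with a zero entry is not the empty list; the two agree only coefficientwise.
ι-0 : ι Q.0# QT.≈ QT.0#
ι-0 zero    = R.refl {[]}
ι-0 (suc i) = R.refl {[]}

ι-* : ∀ a b → ι (a Q.* b) QT.≈ (ι a QT.* ι b)
ι-* a b zero    = R.sym {(a Q.* b) Q.+ Q.0#} {a Q.* b} (R.+-identityʳ (a Q.* b))
ι-* a b (suc i) = R.refl {[]}

ι-^ : ∀ a n → ι (a Q.^ n) QT.≈ (ι a QT.^ n)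
ι-^ a zero    = RT.refl {QT.1#}
ι-^ a (suc n) = RT.trans {ι (a Q.* a Q.^ n)} {ι a QT.* ι (a Q.^ n)} {ι a QT.* ι a QT.^ n}
  (ι-* a (a Q.^ n)) (RT.*-congˡ {ι a} {ι (a Q.^ n)} {ι a QT.^ n} (ι-^ a n))

ι-∑ : ∀ {A : Set} (xs : List A) f → ι (Q.∑ xs f) QT.≈ QT.∑ xs (λ x → ι (f x))
ι-∑ []       f = ι-0
ι-∑ (x ∷ xs) f = RT.+-congˡ {ι (f x)} {ι (Q.∑ xs f)} {QT.∑ xs (λ x → ι (f x))} (ι-∑ xs f)

private
  *-nonneg : ∀ {a b} → ℤ.0ℤ ℤ.≤ a → ℤ.0ℤ ℤ.≤ b → ℤ.0ℤ ℤ.≤ a ℤ.* b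
  *-nonneg {ℤ.+ a} {ℤ.+ b} _ _ = subst (ℤ.0ℤ ℤ.≤_) (ℤ.pos-* a b) (ℤ.+≤+ z≤n)

+-NonNegativeCoefficients : ∀ p r → NonNegativeCoefficients p → NonNegativeCoefficients r →
    NonNegativeCoefficients (p Q.+ r)
+-NonNegativeCoefficients []      r       p≥0 r≥0 i       = r≥0 i
+-NonNegativeCoefficients (a ∷ p) []      p≥0 r≥0 i       = p≥0 i
+-NonNegativeCoefficients (a ∷ p) (b ∷ r) p≥0 r≥0 zero    = ℤ.+-mono-≤ (p≥0 0) (r≥0 0)
+-NonNegativeCoefficients (a ∷ p) (b ∷ r) p≥0 r≥0 (suc i) = +-NonNegativeCoefficients p r (λ i → p≥0 (suc i))
    (λ i → r≥0 (suc i)) i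

*-NonNegativeCoefficients : ∀ p r → NonNegativeCoefficients p → NonNegativeCoefficients r →
    NonNegativeCoefficients (p Q.* r)
*-NonNegativeCoefficients []      r p≥0 r≥0 i = ℤ.≤-refl
*-NonNegativeCoefficients (a ∷ p) r p≥0 r≥0 = +-NonNegativeCoefficients (map (a ℤ.*_) r) (ℤ.0ℤ ∷ (p Q.* r))
  (scaled r r≥0)
  λ { zero → ℤ.≤-refl ; (suc i) → *-NonNegativeCoefficients p r (λ i → p≥0 (suc i)) r≥0 i }
  where
  scaled : ∀ r → NonNegativeCoefficients r → NonNegativeCoefficients (map (a ℤ.*_) r)
  scaled []      r≥0 i       = ℤ.≤-refl
  scaled (b ∷ r) r≥0 zero    = *-nonneg (p≥0 0) (r≥0 0)
  scaled (b ∷ r) r≥0 (suc i) = scaled r (λ i → r≥0 (suc i)) i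

q^-NonNegativeCoefficients : ∀ n → NonNegativeCoefficients (q Q.^ n)
q^-NonNegativeCoefficients zero    zero    = ℤ.+≤+ z≤n
q^-NonNegativeCoefficients zero    (suc i) = ℤ.≤-refl
q^-NonNegativeCoefficients (suc n) = *-NonNegativeCoefficients q (q Q.^ n) q≥0 (q^-NonNegativeCoefficients n)
  where
  q≥0 : NonNegativeCoefficients q
  q≥0 zero          = ℤ.≤-refl
  q≥0 (suc zero)    = ℤ.+≤+ z≤n
  q≥0 (suc (suc i)) = ℤ.≤-refl

∑-NonNegativeCoefficients : ∀ {A : Set} (xs : List A) f → (∀ x → NonNegativeCoefficients (f x)) →
    NonNegativeCoefficients (Q.∑ xs f)
∑-NonNegativeCoefficients []       f f≥0 i = ℤ.≤-refl
∑-NonNegativeCoefficients (x ∷ xs) f f≥0 = +-NonNegativeCoefficients (f x) (Q.∑ xs f) (f≥0 x)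
    (∑-NonNegativeCoefficients xs f f≥0)

m<2*[1+⌊m/2⌋] : ∀ m → m < 2 * suc ⌊ m /2⌋
m<2*[1+⌊m/2⌋] zero          = s≤s z≤n
m<2*[1+⌊m/2⌋] (suc zero)    = s≤s (s≤s z≤n)
m<2*[1+⌊m/2⌋] (suc (suc m)) = subst (suc (suc m) <_) (sym (*-suc 2 (suc ⌊ m /2⌋))) (s≤s (s≤s (m<2*[1+⌊m/2⌋] m)))

theorem5 : ∀ (n : ℕ) → 1 ≤ n →
    Σ[ γ ∈ (ℕ → Q.Carrier) ]
    (∀ k → k ≤ ⌊ n ∸ 1 /2⌋ → NonNegativeCoefficients (γ k))
    × (QT.∑ (𝔖 n) (λ σ → ι (q Q.^ (inv σ ∸ exc σ)) QT.* t QT.^ exc σ)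
    QT.≈
    QT.∑ (upTo (suc ⌊ n ∸ 1 /2⌋))
    (λ k → ι (γ k) QT.* (t QT.^ k QT.* (QT.1# QT.+ t) QT.^ (n ∸ 1 ∸ 2 * k))))
    × (∀ k → k ≤ ⌊ n ∸ 1 /2⌋ →
    γ k Q.≈ Q.∑ 𝔖[ n , k ] (λ σ → q Q.^ (2 * [2-13] σ + [31-2] σ)))
    × (∀ k → k ≤ ⌊ n ∸ 1 /2⌋ →
    (q Q.^ k Q.* (Q.1# Q.+ q) Q.^ k) Q.∣ γ k)
theorem5 (suc m) _ =
  γ ,
  (λ k _ → ∑-NonNegativeCoefficients 𝔖[ suc m , k ] _ λ σ → q^-NonNegativeCoefficients (2 * [2-13] σ + [31-2] σ)) ,
  expansion ,
  (λ k _ → R.refl {γ k}) ,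
  (λ k _ → Histories.∣∑-𝔖[,] ℤ[q]-semiring q m k)
  where
  γ : ℕ → Q.Carrier
  γ k = Q.∑ 𝔖[ suc m , k ] (λ σ → q Q.^ (2 * [2-13] σ + [31-2] σ))

  ιq^stat : Word (suc m) → QT.Carrier
  ιq^stat σ = ι q QT.^ (2 * [2-13] σ + [31-2] σ)

  -- The expansion is taken over ℤ[q][t] with `ι q` as its first parameter, whereas `γ k` lives in
  -- ℤ[q]; the two readings of γ agree since ι respects sums and powers.
  ι-γ : ∀ k → ι (γ k) QT.≈ QT.∑ 𝔖[ suc m , k ] ιq^stat
  ι-γ k = RT.trans {ι (γ k)} {QT.∑ 𝔖[ suc m , k ] ιstat} {QT.∑ 𝔖[ suc m , k ] ιq^stat}
    (ι-∑ 𝔖[ suc m , k ] (λ σ → q Q.^ (2 * [2-13] σ + [31-2] σ)))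
    (∑T.∑-cong 𝔖[ suc m , k ] {ιstat} {ιq^stat} λ σ → ι-^ q (2 * [2-13] σ + [31-2] σ))
    where
    ιstat : Word (suc m) → QT.Carrier
    ιstat σ = ι (q Q.^ (2 * [2-13] σ + [31-2] σ))

  wt wt′ : Word (suc m) → QT.Carrier
  wt  σ = ι (q Q.^ (inv σ ∸ exc σ)) QT.* t QT.^ exc σ
  wt′ σ = ι q QT.^ (inv σ ∸ exc σ) QT.* t QT.^ exc σ

  wt≈wt′ : ∀ σ → wt σ QT.≈ wt′ σ
  wt≈wt′ σ = RT.*-congʳ {t QT.^ exc σ} {ι (q Q.^ (inv σ ∸ exc σ))} {ι q QT.^ (inv σ ∸ exc σ)}
    (ι-^ q (inv σ ∸ exc σ))

  term term′ : ℕ → QT.Carrier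
  term  k = ι (γ k) QT.* (t QT.^ k QT.* (QT.1# QT.+ t) QT.^ (m ∸ 2 * k))
  term′ k = QT.∑ 𝔖[ suc m , k ] ιq^stat QT.* (t QT.^ k QT.* (QT.1# QT.+ t) QT.^ (m ∸ 2 * k))

  term≈term′ : ∀ k → term k QT.≈ term′ k
  term≈term′ k = RT.*-congʳ {t QT.^ k QT.* (QT.1# QT.+ t) QT.^ (m ∸ 2 * k)}
    {ι (γ k)} {QT.∑ 𝔖[ suc m , k ] ιq^stat} (ι-γ k)

  range : List ℕ
  range = upTo (suc ⌊ m /2⌋)

  expansion : QT.∑ (𝔖 (suc m)) wt QT.≈ QT.∑ range term
  expansion = begin
    QT.∑ (𝔖 (suc m)) wt   ≈⟨ ∑T.∑-cong (𝔖 (suc m)) {wt} {wt′} wt≈wt′ ⟩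
    -- The cut-off K is `suc ⌊ m /2⌋`, which retains exactly the k with `2 * k ≤ m`.
    QT.∑ (𝔖 (suc m)) wt′  ≈⟨ Expansion.∑-wt ℤ[q][t]-semiring (ι q) t m (suc ⌊ m /2⌋) (m<2*[1+⌊m/2⌋] m) ⟩
    QT.∑ range term′      ≈⟨ ∑T.∑-cong range {term} {term′} term≈term′ ⟨
    QT.∑ range term       ∎
    where open import Relation.Binary.Reasoning.Setoid RT.setoid
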